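{- Let $\mathcal{M}$ be a model of Presburger arithmetic $T=\mathrm{Th}(\mathbb{Z},+,<,-,\{\equiv_n\}_{n\in\mathbb{N}},0,1)$ and let $(G,\cdot,e)$ be a group definable (with parameters) in $\mathcal{M}$. Then $G$ is definably abelian-by-finite: there is a definable abelian subgroup $G'$ of $G$ of finite index in $G$.
   Context: A group definable in $\mathcal{M}$ means a definable set $G\subseteq \mathcal{M}^n$ (for some $n$) together with a definable group operation $G\times G\to G$. -}

module Defs where

open import Data.Nat using (ℕ; suc; _+_)
open import Data.Fin using (Fin)
open import Data.Integer as ℤ using (ℤ; 0ℤ; 1ℤ; +_)
open import Data.Integer.Divisibility as ℤDiv using ()
open import Data.Vec.Functional using (Vector; _++_; _∷_)
open import Data.Product using (Σ; ∃; _×_; _,_)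
open import Data.Sum using (_⊎_)
open import Data.Empty using (⊥)
open import Relation.Binary.PropositionalEquality using (_≡_)
open import Function.Bundles using (_⇔_)

data Term (k : ℕ) : Set where
  var  : Fin k → Term k
  zer  : Term k
  one  : Term k
  _⊕_  : Term k → Term k → Term k
  neg  : Term k → Term k

data Formula (k : ℕ) : Set where
  _≐_   : Term k → Term k → Formula k
  _≺_   : Term k → Term k → Formula k
  cong  : ℕ → Term k → Term k → Formula k
  ⊥f    : Formula k
  _∧f_  : Formula k → Formula k → Formula k
  _∨f_  : Formula k → Formula k → Formula k
  _⇒f_  : Formula k → Formula k → Formula k
  ∀f    : Formula (suc k) → Formula k
  ∃f    : Formula (suc k) → Formula k

Sentence : Set
Sentence = Formula 0

record Structure : Set₁ where
  field
    Carrier : Set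
    zeroS   : Carrier
    oneS    : Carrier
    plusS   : Carrier → Carrier → Carrier
    negS    : Carrier → Carrier
    ltS     : Carrier → Carrier → Set
    congS   : ℕ → Carrier → Carrier → Set

module _ (M : Structure) where
  open Structure M

  evalT : ∀ {k} → Term k → Vector Carrier k → Carrier
  evalT (var i) ρ = ρ i
  evalT zer ρ = zeroS
  evalT one ρ = oneS
  evalT (s ⊕ t) ρ = plusS (evalT s ρ) (evalT t ρ)
  evalT (neg t) ρ = negS (evalT t ρ)

  Sat : ∀ {k} → Formula k → Vector Carrier k → Set
  Sat (s ≐ t) ρ = evalT s ρ ≡ evalT t ρ
  Sat (s ≺ t) ρ = ltS (evalT s ρ) (evalT t ρ)
  Sat (cong n s t) ρ = congS n (evalT s ρ) (evalT t ρ)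
  Sat ⊥f ρ = ⊥
  Sat (φ ∧f ψ) ρ = Sat φ ρ × Sat ψ ρ
  Sat (φ ∨f ψ) ρ = Sat φ ρ ⊎ Sat ψ ρ
  Sat (φ ⇒f ψ) ρ = Sat φ ρ → Sat ψ ρ
  Sat (∀f φ) ρ = (a : Carrier) → Sat φ (a ∷ ρ)
  Sat (∃f φ) ρ = Σ Carrier λ a → Sat φ (a ∷ ρ)

  Models : Sentence → Set
  Models φ = Sat φ (λ ())

ℤ-structure : Structure
ℤ-structure = record
  { Carrier = ℤ
  ; zeroS = 0ℤ
  ; oneS = 1ℤ
  ; plusS = ℤ._+_
  ; negS = ℤ.-_
  ; ltS = ℤ._<_
  ; congS = λ n a b → (+ n) ℤDiv.∣ (a ℤ.- b)
  }

IsPresburgerModel : Structure → Set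
IsPresburgerModel M = (φ : Sentence) → Models ℤ-structure φ → Models M φ

module _ (M : Structure) where
  open Structure M

  _≈ᵗ_ : ∀ {n} → Vector Carrier n → Vector Carrier n → Set
  x ≈ᵗ y = ∀ i → x i ≡ y i

  DefMem : ∀ {n p} → Formula (n + p) → Vector Carrier p → Vector Carrier n → Set
  DefMem φ b x = Sat M φ (x ++ b)

  record DefinableGroup : Set₁ where
    field
      dim    : ℕ
      nPar   : ℕ
      par    : Vector Carrier nPar
      domF   : Formula (dim + nPar)
      graphF : Formula (((dim + dim) + dim) + nPar)
      op     : Vector Carrier dim → Vector Carrier dim → Vector Carrier dim
      e      : Vector Carrier dim

    InG : Vector Carrier dim → Set
    InG = DefMem domF par

    field
      op-closed : ∀ x y → InG x → InG y → InG (op x y)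
      graph-def : ∀ x y z → InG x → InG y → InG z →
                  (Sat M graphF (((x ++ y) ++ z) ++ par) ⇔ (z ≈ᵗ op x y))
      e-in      : InG e
      assoc     : ∀ x y z → InG x → InG y → InG z →
                  op (op x y) z ≈ᵗ op x (op y z)
      identityˡ : ∀ x → InG x → op e x ≈ᵗ x
      identityʳ : ∀ x → InG x → op x e ≈ᵗ x
      inverse   : ∀ x → InG x →
                  Σ (Vector Carrier dim) λ y → InG y × (op x y ≈ᵗ e) × (op y x ≈ᵗ e)

  DefinablyAbelianByFinite : DefinableGroup → Set
  DefinablyAbelianByFinite G =
    Σ ℕ λ q → Σ (Vector Carrier q) λ b → Σ (Formula (dim + q)) λ ψ →
      let InH = DefMem ψ b in
      (∀ x → InH x → InG x)
      × InH e
      × (∀ x y → InH x → InH y → InH (op x y))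
      × (∀ x y → InH x → InG y → op x y ≈ᵗ e → InH y)
      × (∀ x y → InH x → InH y → op x y ≈ᵗ op y x)
      × (Σ ℕ λ k → Σ (Fin k → Vector Carrier dim) λ g →
           (∀ i → InG (g i))
           × (∀ x → InG x → Σ (Fin k) λ i → Σ (Vector Carrier dim) λ h →
                InH h × (x ≈ᵗ op (g i) h)))
    where open DefinableGroup G

{-# OPTIONS --safe #-}
-- Fix the two formulas.  For suitable constants L and K, "whenever these formulas define a group from parameters b, there are
-- elements s₁, …, s_L whose centralizer has a centre covering the group by K translates" is a single sentence, so it is
-- enough to prove it in ℤ, where truth is decidable by quantifier elimination and one may argue classically.
--
-- In ℤ, products are computed by finitely many affine maps.  So the balls B_R = G ∩ [-R, R]ᴺ satisfy B_R B_R ⊆ B_{CR}, and as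
-- |B_R| grows polynomially, |B_{CR}| ≤ K |B_R| for arbitrarily large R, with K independent of b.  Classify x ∈ B_R by residues
-- and by the number of p ∈ B_{CR} satisfying each linear condition on (x, p); members of a popular class A satisfy the same
-- conditions at all but few p.  Hence each x x̄⁻¹ with x, x̄ ∈ A acts on most p ∈ B_R as an additive translation that depends only
-- on the affine map in force at p, and additive translations commute: the elements of A A⁻¹ commute with each other.
-- Boundedly many translates of A cover B_R, so G is abelian-by-bounded on every ball.
--
-- Consequently the set F of elements with at most κ conjugates covers G by boundedly many translates, and chains of
-- centralizers have bounded length.  So C(F) = C(s₁, …, s_L) for some sᵢ ∈ F; it has bounded index, and since F ∩ C(s) lies
-- in its centre, so has the centre.
module Submission where

open import Defs renaming (cong to congr; _∧f_ to infixr 5 _∧f_; _⇒f_ to infixr 4 _⇒f_)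
open import Level using (0ℓ)
open import Algebra.Bundles using (Group)
open import Algebra.Structures using (IsMonoid)
open import Algebra.Consequences.Setoid using (assoc∧id∧invʳ⇒invˡ-unique)
open import Data.Bool as Bool using (Bool; true; false)
open import Data.Empty using (⊥; ⊥-elim)
open import Data.Unit using (⊤; tt)
open import Data.Nat as ℕ using (ℕ; zero; suc)
import Data.Nat.Properties as ℕₚ
import Data.Nat.Divisibility as ℕᵈ
open import Data.Nat.DivMod using (m/n*n≤m; m<n*o⇒m/o<n; m%n<n; m≡m%n+[m/n]*n)
open import Data.Nat.ListAction using (sum; product)
open import Data.Nat.Induction using (<-wellFounded)
open import Data.Nat.Tactic.RingSolver as ℕ-Ring using ()
open import Data.Integer as ℤ using (ℤ; +_; -[1+_]; 0ℤ; 1ℤ; ∣_∣)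
open import Data.Integer.DivMod using (_%ℕ_; _/ℕ_; n%ℕd<d; a≡a%ℕn+[a/ℕn]*n)
import Data.Integer.Properties as ℤₚ
import Data.Integer.Divisibility as ℤᵘ
open import Data.Integer.Divisibility.Signed as ℤˢ using (divides; ∣ᵤ⇒∣; ∣⇒∣ᵤ)
open import Data.Integer.Tactic.RingSolver as ℤ-Ring using ()
open import Algebra.Properties.AbelianGroup ℤₚ.+-0-abelianGroup using () renaming (∙-cancelˡ to +-cancelˡ)
open import Data.Fin as Fin using (Fin; zero; suc; _↑ˡ_; _↑ʳ_; splitAt; combine; remQuot)
import Data.Fin.Properties as Finₚ
open import Data.Fin.Properties using (splitAt-↑ˡ; splitAt-↑ʳ; remQuot-combine)
open import Data.Vec.Functional using (Vector) renaming (_∷_ to _◂_; _++_ to _⧺_)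
open import Data.List as List using (List; []; _∷_; length)
import Data.List.Properties as Listₚ
open import Data.List.Membership.Propositional using (_∈_; find; lose)
open import Data.List.Membership.Propositional.Properties using (∈-lookup; ∈-allFin; ∈-upTo⁺; ∈-map⁺; ∈-map⁻; ∈-++⁺ˡ; ∈-++⁺ʳ; ∈-concatMap⁺; ∈-filter⁺; ∈-filter⁻; ∈-cartesianProduct⁺; ∈-cartesianProduct⁻)
open import Data.List.Relation.Unary.All as All using (All; []; _∷_)
import Data.List.Relation.Unary.All.Properties as Allₚ
open import Data.List.Relation.Unary.AllPairs as AllPairs using (AllPairs; []; _∷_)
import Data.List.Relation.Unary.AllPairs.Properties as AllPairsₚ
open import Data.List.Relation.Unary.Any as Any using (Any; here; there; any?)
import Data.List.Relation.Unary.Any.Properties as Anyₚ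
import Data.List.Relation.Unary.Unique.Propositional.Properties as Uniqueₚ
open import Data.List.Relation.Binary.Sublist.Propositional as Sublist using (_⊆_; []; _∷_; _∷ʳ_; ⊆-refl; ⊆-trans)
open import Data.List.Relation.Binary.Sublist.Propositional.Properties using (All-resp-⊆; filter-⊆)
open import Data.Product as Prod using (Σ; ∃; _×_; _,_; proj₁; proj₂; uncurry)
open import Data.Sum as Sum using (_⊎_; inj₁; inj₂; [_,_])
open import Function using (_∘_; id)
open import Function.Bundles using (_⇔_; mk⇔; Equivalence)
open import Induction.WellFounded using (Acc; acc)
open import Relation.Nullary using (¬_; Dec; yes; no)
open import Relation.Nullary.Decidable using (map′; _×-dec_; _⊎-dec_; _→-dec_; ¬?; decidable-stable)
open import Relation.Binary.PropositionalEquality as ≡ using (_≡_; _≢_; refl)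

-- Lists and their lengths

-- The class A depends on R, and the classes found for different R are unrelated, so no subgroup of
-- G arises from them directly. What passes from balls to G are bounds on lengths of finite lists:
-- finitely many group elements, with finitely many witnesses of their not commuting, lie in one
-- ball and are counted there. For this reason `FC`, the chains and the coset counts are all phrased
-- as such bounds.
--
-- Popularity is measured on B_R, but the points moved around lie in B_{CR}. The bound |B_{CR}| ≤ K
-- |B_R| comes first, so that the number E of buckets can then be taken large compared with K; only
-- then do the exceptional points, counted in B_{CR}, fail to exhaust B_R.
--
-- One sentence has to serve all parameters b. The affine maps, their slopes and moduli, and hence
-- C, K, E and κ, are read off from the two formulas. The parameters enter the growth estimates only
-- as an additive term β, which disappears once R ≥ β.

lookup-distinct : ∀ {A B : Set} (f : A → B) {xs} → AllPairs (λ x y → f x ≢ f y) xs →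
  ∀ i j → f (List.lookup xs i) ≡ f (List.lookup xs j) → i ≡ j
lookup-distinct f (x≢ ∷ d) zero    zero    eq = refl
lookup-distinct f (x≢ ∷ d) zero    (suc j) eq = ⊥-elim (All.lookup x≢ (∈-lookup j) eq)
lookup-distinct f (x≢ ∷ d) (suc i) zero    eq = ⊥-elim (All.lookup x≢ (∈-lookup i) (≡.sym eq))
lookup-distinct f (x≢ ∷ d) (suc i) (suc j) eq = ≡.cong suc (lookup-distinct f d i j eq)

length-distinct : ∀ {A : Set} {n} (f : A → Fin n) {xs} → AllPairs (λ x y → f x ≢ f y) xs → length xs ℕ.≤ n
length-distinct f {xs} distinct = Finₚ.injective⇒≤ {f = f ∘ List.lookup xs} λ {i} {j} → lookup-distinct f distinct i j

length-filter-split : ∀ {A : Set} {P : A → Set} (P? : ∀ x → Dec (P x)) xs →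
  length xs ≡ length (List.filter P? xs) ℕ.+ length (List.filter (¬? ∘ P?) xs)
length-filter-split P? []       = refl
length-filter-split P? (x ∷ xs) with P? x
... | yes _ = ≡.cong suc (length-filter-split P? xs)
... | no  _ = ≡.trans (≡.cong suc (length-filter-split P? xs)) (≡.sym (ℕₚ.+-suc _ _))

module _ {A : Set} {R E : A → A → Set} (E? : ∀ x y → Dec (E x y)) (euclidean : ∀ {x y z} → E x y → E x z → E y z) where

  private
    pairwise : ∀ {x xs} → All (E x) xs → AllPairs E xs
    pairwise []       = []
    pairwise (e ∷ es) = All.map (euclidean e) es ∷ pairwise es

  -- The head `x` and the elements related to it form a class of length at most `κ′`. The rest
  -- satisfies the hypotheses with `κ` lowered by one, since `x` can be put in front of any pairwise
  -- unrelated list of elements not related to it; this is why `P` varies in the induction. `R` is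
  -- carried along so that each class keeps what was known about pairs.
  length-classes : ∀ (P : A → Set) κ κ′ →
    (∀ ys → All P ys → AllPairs (λ x y → ¬ E x y) ys → length ys ℕ.≤ κ) →
    (∀ ys → All P ys → AllPairs R ys → AllPairs E ys → length ys ℕ.≤ κ′) →
    ∀ xs → All P xs → AllPairs R xs → length xs ℕ.≤ κ ℕ.* κ′
  length-classes P κ       κ′ anti homo []       _        _        = ℕ.z≤n
  length-classes P zero    κ′ anti homo (x ∷ xs) (p ∷ ps) (r ∷ rs) with () ← anti (x ∷ []) (p ∷ []) ([] ∷ [])
  length-classes P (suc κ) κ′ anti homo (x ∷ xs) (p ∷ ps) (r ∷ rs) = begin
    suc (length xs)               ≡⟨ ≡.cong suc (length-filter-split (E? x) xs) ⟩
    suc (length same) ℕ.+ length other ≤⟨ ℕₚ.+-mono-≤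
      (homo (x ∷ same) (p ∷ Allₚ.filter⁺ (E? x) ps) (Allₚ.filter⁺ (E? x) r ∷ AllPairsₚ.filter⁺ (E? x) rs)
        (Allₚ.all-filter (E? x) xs ∷ pairwise (Allₚ.all-filter (E? x) xs)))
      (length-classes (λ y → P y × ¬ E x y) κ κ′
        (λ ys qs a → ℕₚ.≤-pred (anti (x ∷ ys) (p ∷ All.map proj₁ qs) (All.map proj₂ qs ∷ a)))
        (λ ys qs → homo ys (All.map proj₁ qs))
        other (All.zip (Allₚ.filter⁺ (¬? ∘ E? x) ps , Allₚ.all-filter (¬? ∘ E? x) xs)) (AllPairsₚ.filter⁺ (¬? ∘ E? x) rs)) ⟩
    κ′ ℕ.+ κ ℕ.* κ′ ∎
    where
    open ℕₚ.≤-Reasoning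
    same other : List A
    same  = List.filter (E? x) xs
    other = List.filter (¬? ∘ E? x) xs

-- Double-negation shift, valid over a finite list: when the goal is stable, witnesses may be chosen
-- for all members at once.
¬¬-All : ∀ {A : Set} {P : A → Set} {xs} → All (λ x → ¬ ¬ P x) xs → ¬ ¬ All P xs
¬¬-All []       k = k []
¬¬-All (p ∷ ps) k = p λ p → ¬¬-All ps λ ps → k (p ∷ ps)

¬¬-AllPairs : ∀ {A : Set} {R : A → A → Set} {xs} → AllPairs (λ x y → ¬ ¬ R x y) xs → ¬ ¬ AllPairs R xs
¬¬-AllPairs []       k = k []
¬¬-AllPairs (p ∷ ps) k = ¬¬-All p λ p → ¬¬-AllPairs ps λ ps → k (p ∷ ps)

module Bounded {A : Set} (size : A → ℕ) where
  Below : ℕ → A → Set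
  Below R x = size x ℕ.≤ R

  bound : (xs : List A) → ∃ λ R → All (Below R) xs
  bound []       = 0 , []
  bound (x ∷ xs) = let R , bs = bound xs in size x ℕ.⊔ R ,
    ℕₚ.m≤m⊔n _ R ∷ All.map (λ b → ℕₚ.≤-trans b (ℕₚ.m≤n⊔m (size x) R)) bs

  module _ {B : Set} {W : B → List A → Set} where
    Upto : ℕ → B → Set
    Upto R b = ∃ λ xs → W b xs × All (Below R) xs

    Upto-mono : ∀ {R S} → R ℕ.≤ S → ∀ {b} → Upto R b → Upto S b
    Upto-mono le (xs , w , bs) = xs , w , All.map (λ b → ℕₚ.≤-trans b le) bs

    bound-All : ∀ {bs} → All (λ b → ∃ (W b)) bs → ∃ λ R → All (Upto R) bs
    bound-All []              = 0 , []
    bound-All ((xs , w) ∷ ws) with bound xs | bound-All ws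
    ... | R , us | S , vs = R ℕ.⊔ S , Upto-mono (ℕₚ.m≤m⊔n R S) (xs , w , us) ∷ All.map (Upto-mono (ℕₚ.m≤n⊔m R S)) vs

  -- Puts the witnesses attached to finitely many pairs into a single ball, where counting is
  -- available.
  bound-AllPairs : ∀ {B : Set} {W : B → B → List A → Set} {bs} → AllPairs (λ x y → ∃ (W x y)) bs →
    ∃ λ R → AllPairs (λ x y → ∃ λ xs → W x y xs × All (Below R) xs) bs
  bound-AllPairs []       = 0 , []
  bound-AllPairs {W = W} (w ∷ ws) with bound-All {W = W _} w | bound-AllPairs {W = W} ws
  ... | R , us | S , vs = R ℕ.⊔ S , All.map (Upto-mono {W = W _} (ℕₚ.m≤m⊔n R S)) us ∷
                                    AllPairs.map (λ {x} → Upto-mono {W = W x} (ℕₚ.m≤n⊔m R S)) vs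

-- A sentence has a fixed number of slots, whereas the lists found are only bounded in length. The
-- spare slots are filled with `d`, later the neutral element.
pad : ∀ {A : Set} L → A → List A → Fin L → A
pad L       d []       _       = d
pad (suc L) d (x ∷ xs) zero    = x
pad (suc L) d (x ∷ xs) (suc i) = pad L d xs i

pad-All : ∀ {A : Set} {P : A → Set} L {d xs} → P d → All P xs → ∀ i → P (pad L d xs i)
pad-All L       pd []       _       = pd
pad-All (suc L) pd (p ∷ ps) zero    = p
pad-All (suc L) pd (p ∷ ps) (suc i) = pad-All L pd ps i

All-pad : ∀ {A : Set} {P : A → Set} {L d} xs → length xs ℕ.≤ L → (∀ i → P (pad L d xs i)) → All P xs
All-pad []       _          h = []
All-pad (x ∷ xs) (ℕ.s≤s le) h = h zero ∷ All-pad xs le (h ∘ suc)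

Any-pad : ∀ {A : Set} {P : A → Set} {L d xs} → length xs ℕ.≤ L → Any P xs → ∃ λ i → P (pad L d xs i)
Any-pad (ℕ.s≤s le) (here p)  = zero , p
Any-pad (ℕ.s≤s le) (there q) = Prod.map suc id (Any-pad le q)

-- Centralizers

module GroupTheory (𝔾 : Group 0ℓ 0ℓ) where
  open Group 𝔾 public renaming (refl to refl≈)
  open import Algebra.Properties.Group 𝔾 public
  open import Relation.Binary.Reasoning.Setoid setoid

  Comm : Carrier → Carrier → Set
  Comm x y = x ∙ y ≈ y ∙ x

  comm-cong : ∀ {x x′ y y′} → x ≈ x′ → y ≈ y′ → Comm x y → Comm x′ y′
  comm-cong e f c = trans (∙-cong (sym e) (sym f)) (trans c (∙-cong f e))

  comm-ε : ∀ x → Comm x ε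
  comm-ε x = trans (identityʳ x) (sym (identityˡ x))

  comm-∙ : ∀ {h x y} → Comm h x → Comm h y → Comm h (x ∙ y)
  comm-∙ {h} {x} {y} p q = begin
    h ∙ (x ∙ y) ≈⟨ assoc h x y ⟨
    h ∙ x ∙ y   ≈⟨ ∙-congʳ p ⟩
    x ∙ h ∙ y   ≈⟨ assoc x h y ⟩
    x ∙ (h ∙ y) ≈⟨ ∙-congˡ q ⟩
    x ∙ (y ∙ h) ≈⟨ assoc x y h ⟨
    x ∙ y ∙ h   ∎

  comm-⁻¹ : ∀ {h x} → Comm h x → Comm h (x ⁻¹)
  comm-⁻¹ {h} {x} p = ∙-cancelˡ x _ _ (begin
    x ∙ (h ∙ x ⁻¹) ≈⟨ assoc x h (x ⁻¹) ⟨
    x ∙ h ∙ x ⁻¹   ≈⟨ ∙-congʳ p ⟨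
    h ∙ x ∙ x ⁻¹   ≈⟨ assoc h x (x ⁻¹) ⟩
    h ∙ (x ∙ x ⁻¹) ≈⟨ ∙-congˡ (inverseʳ x) ⟩
    h ∙ ε          ≈⟨ comm-ε h ⟩
    ε ∙ h          ≈⟨ ∙-congʳ (inverseʳ x) ⟨
    x ∙ x ⁻¹ ∙ h   ≈⟨ assoc x (x ⁻¹) h ⟩
    x ∙ (x ⁻¹ ∙ h) ∎)

  infixl 7 _⟍_
  -- Left division tells whether two elements lie in the same left coset of a subgroup. Being the
  -- solution `w` of `x ∙ w ≈ y`, it is also read off directly from the graph of the product.
  _⟍_ : Carrier → Carrier → Carrier
  x ⟍ y = x ⁻¹ ∙ y

  ⟍-∙ : ∀ x y → x ∙ (x ⟍ y) ≈ y
  ⟍-∙ x y = trans (sym (assoc x (x ⁻¹) y)) (trans (∙-congʳ (inverseʳ x)) (identityˡ y))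

  ∙-⟍ : ∀ x y → x ⟍ (x ∙ y) ≈ y
  ∙-⟍ x y = trans (sym (assoc (x ⁻¹) x y)) (trans (∙-congʳ (inverseˡ x)) (identityˡ y))

  ⟍-cancel : ∀ x y z → (x ⟍ y) ⟍ (x ⟍ z) ≈ y ⟍ z
  ⟍-cancel x y z = ∙-cancelˡ (x ⟍ y) _ _ (begin
    (x ⟍ y) ∙ ((x ⟍ y) ⟍ (x ⟍ z)) ≈⟨ ⟍-∙ (x ⟍ y) (x ⟍ z) ⟩
    x ⁻¹ ∙ z                      ≈⟨ ∙-congˡ (⟍-∙ y z) ⟨
    x ⁻¹ ∙ (y ∙ (y ⟍ z))          ≈⟨ assoc (x ⁻¹) y (y ⟍ z) ⟨
    (x ⟍ y) ∙ (y ⟍ z)             ∎)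

  comm-⟍ : ∀ {h x y} → Comm h x → Comm h y → Comm h (x ⟍ y)
  comm-⟍ p q = comm-∙ (comm-⁻¹ p) q

  comm-undo-⟍ : ∀ {h x y} → Comm h x → Comm h (x ⟍ y) → Comm h y
  comm-undo-⟍ {h} {x} {y} p q = comm-cong refl≈ (⟍-∙ x y) (comm-∙ p q)

  ⟍-inverse : ∀ x y → (x ⟍ y) ⁻¹ ≈ y ⟍ x
  ⟍-inverse x y = trans (⁻¹-anti-homo-∙ (x ⁻¹) y) (∙-congˡ (⁻¹-involutive x))

  module Bicenter {L : ℕ} (s : Fin L → Carrier) where
    Centralizes : Carrier → Set
    Centralizes x = ∀ i → Comm x (s i)

    -- This is the centre of the centralizer of `s`: abelian by construction, and defined from the
    -- finitely many `s i`.
    Bicentral : Carrier → Set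
    Bicentral x = Centralizes x × (∀ y → Centralizes y → Comm x y)

    bicentral-closed : (f : Carrier → Carrier → Carrier) →
      (∀ {h x y} → Comm h x → Comm h y → Comm h (f x y)) → ∀ {x y} → Bicentral x → Bicentral y → Bicentral (f x y)
    bicentral-closed f closed (p , p′) (q , q′) = (λ i → sym (closed (sym (p i)) (sym (q i)))) ,
                                                   λ z c → sym (closed (sym (p′ z c)) (sym (q′ z c)))

    bicentral-⟍ : ∀ {x y} → Bicentral x → Bicentral y → Bicentral (x ⟍ y)
    bicentral-⟍ = bicentral-closed _⟍_ comm-⟍

    bicentral-∙ : ∀ {x y} → Bicentral x → Bicentral y → Bicentral (x ∙ y)
    bicentral-∙ = bicentral-closed _∙_ comm-∙

    bicentral-ε : Bicentral ε
    bicentral-ε = (λ i → sym (comm-ε (s i))) , λ y _ → sym (comm-ε y)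

    bicentral-cong : ∀ {x y} → x ≈ y → Bicentral x → Bicentral y
    bicentral-cong e (p , p′) = (λ i → comm-cong e refl≈ (p i)) , λ z c → comm-cong e refl≈ (p′ z c)

    bicentral-comm : ∀ {x y} → Bicentral x → Bicentral y → Comm x y
    bicentral-comm {y = y} p q = proj₂ p y (proj₁ q)

  -- The number κ of colours is the same for all balls, but the colourings for different R need not
  -- be compatible.
  module LocallyAbelian (_≈?_ : ∀ x y → Dec (x ≈ y)) (size : Carrier → ℕ) (κ : ℕ)
    (local : ∀ R → Σ (Carrier → Fin κ) λ cl → ∀ {x x′ y y′} →
      size x ℕ.≤ R → size x′ ℕ.≤ R → size y ℕ.≤ R → size y′ ℕ.≤ R →
      cl x ≡ cl x′ → cl y ≡ cl y′ → Comm (x ⟍ x′) (y ⟍ y′)) where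

    open Bounded size

    comm? : ∀ x y → Dec (Comm x y)
    comm? x y = (x ∙ y) ≈? (y ∙ x)

    -- That is, h has at most κ conjugates.
    FC : Carrier → Set
    FC h = ∀ xs → AllPairs (λ x y → ¬ Comm h (x ⟍ y)) xs → length xs ℕ.≤ κ

    Separates : Carrier → Carrier → List Carrier → Set
    Separates x y zs = AllPairs (λ z w → ¬ Comm (x ⟍ y) (z ⟍ w)) zs × κ ℕ.< length zs

    ¬FC⇒separates : ∀ {x y} → ¬ FC (x ⟍ y) → ¬ ¬ ∃ (Separates x y)
    ¬FC⇒separates ¬fc k = ¬fc λ zs a → ℕₚ.≮⇒≥ λ lt → k (zs , a , lt)

    AllPairs-with : ∀ {A : Set} {P : A → Set} {R S : A → A → Set} → (∀ {x y} → P x → P y → R x y → S x y) →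
                    ∀ {xs} → All P xs → AllPairs R xs → AllPairs S xs
    AllPairs-with f []       []       = []
    AllPairs-with f (p ∷ ps) (r ∷ rs) = All.zipWith (λ (q , r) → f p q r) (ps , r) ∷ AllPairs-with f ps rs

    -- Each failure of `FC` comes with more than κ elements in distinct cosets of a centralizer. One
    -- ball contains `ys` and all these witnesses. Were two members x, y of `ys` equally coloured
    -- there, equally coloured witnesses z, w would make x ⟍ y commute with z ⟍ w; hence the
    -- witnesses for this pair would have distinct colours, and there are too many of them.
    length-¬FC : ∀ ys → AllPairs (λ x y → ¬ FC (x ⟍ y)) ys → length ys ℕ.≤ κ
    length-¬FC ys ¬fc = decidable-stable (length ys ℕ.≤? κ) λ k →
      ¬¬-AllPairs (AllPairs.map ¬FC⇒separates ¬fc) λ sep → k (bounded sep)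
      where
      bounded : AllPairs (λ x y → ∃ (Separates x y)) ys → length ys ℕ.≤ κ
      bounded sep with bound-AllPairs {W = Separates} sep | bound ys
      ... | R , sep′ | S , below with local (R ℕ.⊔ S)
      ... | cl , commute = length-distinct cl (AllPairs-with
        (λ {x} {y} bx by (zs , (apart , long) , bzs) same → ℕₚ.<⇒≱ long (length-distinct cl
          (AllPairs-with (λ bz bw ¬c same′ → ¬c (commute (up bx) (up by) bz bw same same′)) (All.map upˡ bzs) apart)))
        below sep′)
        where
        upˡ : ∀ {x} → Below R x → Below (R ℕ.⊔ S) x
        upˡ b = ℕₚ.≤-trans b (ℕₚ.m≤m⊔n R S)
        up : ∀ {x} → Below S x → Below (R ℕ.⊔ S) x
        up b = ℕₚ.≤-trans b (ℕₚ.m≤n⊔m R S)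

    -- A descending chain of centralizers, latest step first: t centralizes the earlier s′ but not s.
    Later : Carrier × Carrier → Carrier × Carrier → Set
    Later (s , t) (s′ , t′) = Comm t s′

    Strict : Carrier × Carrier → Set
    Strict (s , t) = ¬ Comm t s

    chainLength : ℕ
    chainLength = (κ ℕ.* κ) ℕ.* 2

    -- Steps are coloured by the colours of both components, with κ² possible values; three steps of
    -- one colour are impossible.
    length-chain : ∀ cs → All Strict cs → AllPairs Later cs → length cs ℕ.≤ chainLength
    length-chain cs strict later with bound (List.map proj₁ cs List.++ List.map proj₂ cs)
    ... | R , below with local R
    ... | cl , commute = length-classes {R = Later} {E = Same}
        (λ (s , t) (s′ , t′) → (cl s Fin.≟ cl s′) ×-dec (cl t Fin.≟ cl t′))
        (λ (p , q) (p′ , q′) → ≡.trans (≡.sym p) p′ , ≡.trans (≡.sym q) q′)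
        Good (κ ℕ.* κ) 2
        (λ ys _ a → length-distinct (λ (s , t) → combine (cl s) (cl t)) (AllPairs.map
          (λ ¬same eq → ¬same (Finₚ.combine-injective _ _ _ _ eq)) a))
        short cs (All.zip (strict , All.zip (Allₚ.map⁻ (Allₚ.++⁻ˡ (List.map proj₁ cs) below) , Allₚ.map⁻ (Allₚ.++⁻ʳ (List.map proj₁ cs) below)))) later
      where
      Same : Carrier × Carrier → Carrier × Carrier → Set
      Same (s , t) (s′ , t′) = cl s ≡ cl s′ × cl t ≡ cl t′
      Good : Carrier × Carrier → Set
      Good c = Strict c × Below R (proj₁ c) × Below R (proj₂ c)
      short : ∀ ys → All Good ys → AllPairs Later ys → AllPairs Same ys → length ys ℕ.≤ 2
      short []           _ _ _ = ℕ.z≤n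
      short (_ ∷ [])     _ _ _ = ℕ.s≤s ℕ.z≤n
      short (_ ∷ _ ∷ []) _ _ _ = ℕ.s≤s (ℕ.s≤s ℕ.z≤n)
      -- Equal colours make s₁ ⟍ s₂ commute with t₃ ⟍ t₂. It also commutes with t₃, because t₃
      -- centralizes s₁ and s₂; hence it commutes with t₂. As t₂ centralizes s₁, it then centralizes
      -- s₂, against strictness of the second step.
      short ((s₃ , t₃) ∷ (s₂ , t₂) ∷ (s₁ , t₁) ∷ _)
            ((_ , _ , b₃) ∷ (strict₂ , b₂ , b₂′) ∷ (_ , b₁ , _) ∷ _)
            ((t₃s₂ ∷ t₃s₁ ∷ _) ∷ (t₂s₁ ∷ _) ∷ _)
            (((_ , t₃~t₂) ∷ _) ∷ ((s₂~s₁ , _) ∷ _) ∷ _) = ⊥-elim (strict₂ (comm-undo-⟍ t₂s₁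
              (sym (comm-undo-⟍ (sym (comm-⟍ t₃s₁ t₃s₂)) (commute b₁ b₂ b₃ b₂′ (≡.sym s₂~s₁) t₃~t₂)))))

    Controls : List Carrier → Set
    Controls ss = ∀ c → All (Comm c) ss → ∀ h → FC h → Comm c h

    -- A failure of `Controls` is exactly a pair that prolongs the chain, so the bound on chains
    -- ends the search. Whether `Controls` holds is not decided, hence the double negation.
    controlling : ¬ ¬ ∃ λ ss → length ss ℕ.≤ chainLength × All FC ss × Controls ss
    controlling k = extend (suc chainLength) [] [] [] [] ℕₚ.≤-refl
      where
      extend : ∀ fuel cs → All Strict cs → AllPairs Later cs → All (FC ∘ proj₁) cs → chainLength ℕ.< length cs ℕ.+ fuel → ⊥
      extend zero       cs strict later fc lt = ℕₚ.<⇒≱ lt (ℕₚ.≤-trans (ℕₚ.≤-reflexive (ℕₚ.+-identityʳ _)) (length-chain cs strict later))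
      extend (suc fuel) cs strict later fc lt = k (List.map proj₁ cs ,
        ≡.subst (ℕ._≤ _) (≡.sym (Listₚ.length-map proj₁ cs)) (length-chain cs strict later) , Allₚ.map⁺ fc ,
        λ c cent h fch → decidable-stable (comm? c h) λ ¬ch →
          extend fuel ((h , c) ∷ cs) (¬ch ∷ strict) (Allₚ.map⁻ cent ∷ later) (fch ∷ fc)
            (≡.subst (chainLength ℕ.<_) (ℕₚ.+-suc (length cs) fuel) lt))

    -- By `FC s`, the relation of lying in one coset of the centralizer of `s` has at most κ
    -- classes. Elements surviving all these splittings lie in one coset of the common centralizer,
    -- where the last hypothesis applies; `R` accumulates the coset relations gained so far.
    length-centralizer-classes : ∀ ss → All FC ss → ∀ {R} ys → AllPairs R ys →
      (∀ zs → AllPairs R zs → AllPairs (λ x y → All (Comm (x ⟍ y)) ss) zs → length zs ℕ.≤ κ) →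
      length ys ℕ.≤ κ ℕ.^ length ss ℕ.* κ
    length-centralizer-classes [] [] ys r h = ℕₚ.≤-trans (h ys r (AllPairs.map (λ _ → []) r)) (ℕₚ.≤-reflexive (≡.sym (ℕₚ.*-identityˡ κ)))
    length-centralizer-classes (s ∷ ss) (fc ∷ fcs) {R} ys r h = ≡.subst (length ys ℕ.≤_) (≡.sym (ℕₚ.*-assoc κ (κ ℕ.^ length ss) κ))
      (length-classes {R = R} {E = λ x y → Comm s (x ⟍ y)} (λ x y → comm? s (x ⟍ y))
        (λ {x} {y} {z} p q → comm-cong refl≈ (⟍-cancel x y z) (comm-⟍ p q))
        (λ _ → ⊤) κ (κ ℕ.^ length ss ℕ.* κ)
        (λ zs _ → fc zs)
        (λ zs _ rs es → length-centralizer-classes ss fcs zs (AllPairs.zip (rs , es))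
          λ ws re cs → h ws (AllPairs.map proj₁ re) (AllPairs.zipWith (λ ((_ , e) , c) → sym e ∷ c) (re , cs)))
        ys (All.tabulate (λ _ → tt)) r)

    index : ℕ
    index = κ ℕ.^ chainLength ℕ.* κ

    κ≢0 : ℕ.NonZero κ
    κ≢0 = inhabited (proj₁ (local 0) ε)
      where
      inhabited : ∀ {n} → Fin n → ℕ.NonZero n
      inhabited zero    = _
      inhabited (suc _) = _

    open Bicenter

    -- Inside one coset of the centralizer of `ss`, quotients lie in that centralizer. If such a
    -- quotient is in `FC`, then `Controls` makes it central there. Thus elements apart modulo the
    -- bicenter have quotients outside `FC`, and `length-¬FC` bounds their number in each coset.
    bicenter-classes : ¬ ¬ Σ (Fin chainLength → Carrier) λ s →
      ∀ ys → AllPairs (λ x y → ¬ Bicentral s (x ⟍ y)) ys → length ys ℕ.≤ index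
    bicenter-classes k = controlling λ (ss , short , fcs , controls) → k (pad chainLength ε ss , λ ys apart →
      ℕₚ.≤-trans (length-centralizer-classes ss fcs ys apart λ zs apart′ cent → length-¬FC zs
          (AllPairs.zipWith (λ (¬b , c) fc → ¬b (pad-All chainLength (comm-ε _) c ,
            λ y cy → sym (controls y (All-pad ss short cy) _ fc))) (apart′ , cent)))
        (ℕₚ.*-monoˡ-≤ κ (ℕₚ.^-monoʳ-≤ κ {{κ≢0}} short)))

    bicenter-cover : (∀ (s : Fin chainLength → Carrier) x → Dec (Bicentral s x)) →
      ¬ ¬ Σ (Fin chainLength → Carrier) λ s → Σ (Fin index → Carrier) λ g → ∀ x → ∃ λ i → Bicentral s (g i ⟍ x)
    bicenter-cover bicentral? k = bicenter-classes λ (s , width) → extend s width (suc index) [] [] ℕₚ.≤-refl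
      where
      module _ (s : Fin chainLength → Carrier) (width : ∀ ys → AllPairs (λ x y → ¬ Bicentral s (x ⟍ y)) ys → length ys ℕ.≤ index) where
        extend : ∀ fuel gs → AllPairs (λ x y → ¬ Bicentral s (x ⟍ y)) gs → index ℕ.< length gs ℕ.+ fuel → ⊥
        extend zero       gs apart lt = ℕₚ.<⇒≱ lt (ℕₚ.≤-trans (ℕₚ.≤-reflexive (ℕₚ.+-identityʳ _)) (width gs apart))
        extend (suc fuel) gs apart lt = k (s , pad index ε gs , λ x → Any-pad (width gs apart)
          (decidable-stable (any? (λ g → bicentral? s (g ⟍ x)) gs) λ none →
            extend fuel (x ∷ gs) (All.map (λ {g} ¬b b → ¬b (flip b)) (Allₚ.¬Any⇒All¬ gs none) ∷ apart)
              (≡.subst (index ℕ.<_) (ℕₚ.+-suc (length gs) fuel) lt)))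
          where
          flip : ∀ {x g} → Bicentral s (x ⟍ g) → Bicentral s (g ⟍ x)
          flip {x} {g} b = bicentral-cong s (trans (identityʳ _) (⟍-inverse x g)) (bicentral-⟍ s b (bicentral-ε s))

-- Popular colours and exceptional sets

AllPairs-resp-⊆ : ∀ {A : Set} {R : A → A → Set} {xs ys} → xs ⊆ ys → AllPairs R ys → AllPairs R xs
AllPairs-resp-⊆ []         []       = []
AllPairs-resp-⊆ (_ ∷ʳ p)   (_ ∷ rs) = AllPairs-resp-⊆ p rs
AllPairs-resp-⊆ (refl ∷ p) (r ∷ rs) = All-resp-⊆ p r ∷ AllPairs-resp-⊆ p rs

-- No `y` is matched with two members of `xs`, so the positions of the matches in `ys` are distinct.
-- A relation in place of a function allows matching up to group equality.
length-matching : ∀ {A B : Set} (_~_ : A → B → Set) {xs ys} → AllPairs (λ x x′ → ∀ {y} → x ~ y → ¬ x′ ~ y) xs →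
  All (λ x → Any (x ~_) ys) xs → length xs ℕ.≤ length ys
length-matching _~_ {ys = ys} apart matches = ≡.subst (ℕ._≤ length ys) (length-positions matches) (length-distinct id (positions-distinct apart matches))
  where
  positions : ∀ {xs} → All (λ x → Any (x ~_) ys) xs → List (Fin (length ys))
  positions []       = []
  positions (m ∷ ms) = Any.index m ∷ positions ms
  length-positions : ∀ {xs} (ms : All (λ x → Any (x ~_) ys) xs) → length (positions ms) ≡ length xs
  length-positions []       = refl
  length-positions (m ∷ ms) = ≡.cong suc (length-positions ms)
  position-≢ : ∀ {x xs} (m : Any (x ~_) ys) → All (λ x′ → ∀ {y} → x ~ y → ¬ x′ ~ y) xs → (ms : All (λ x → Any (x ~_) ys) xs) →
               All (Any.index m ≢_) (positions ms)
  position-≢ m []       []        = []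
  position-≢ m (a ∷ as) (m′ ∷ ms) = (λ eq → a (Anyₚ.lookup-index m)
    (≡.subst (λ i → _ ~ List.lookup ys i) (≡.sym eq) (Anyₚ.lookup-index m′))) ∷ position-≢ m as ms
  positions-distinct : ∀ {xs} → AllPairs (λ x x′ → ∀ {y} → x ~ y → ¬ x′ ~ y) xs → (ms : All (λ x → Any (x ~_) ys) xs) →
                       AllPairs _≢_ (positions ms)
  positions-distinct []       []       = []
  positions-distinct (a ∷ as) (m ∷ ms) = position-≢ m a ms ∷ positions-distinct as ms

-- Pigeonhole: the colour class of `e` is compared with the class found among the other colours, and
-- the longer one is kept.
popular-colour : ∀ {A : Set} {E} (f : A → Fin E) (es : List (Fin E)) xs → All (λ x → f x ∈ es) xs →
  ∃ λ ys → ys ⊆ xs × length xs ℕ.≤ length es ℕ.* length ys × (∀ {x y} → x ∈ ys → y ∈ ys → f x ≡ f y)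
popular-colour f []       []      []       = [] , [] , ℕ.z≤n , λ ()
popular-colour f []       (x ∷ _) (() ∷ _)
popular-colour f (e ∷ es) xs      coloured = choose (popular-colour f es other (All.map drop
    (All.zip (Allₚ.all-filter (¬? ∘ is-e?) xs , Allₚ.filter⁺ (¬? ∘ is-e?) coloured))))
  where
  is-e? : ∀ x → Dec (f x ≡ e)
  is-e? x = f x Fin.≟ e
  same other : List _
  same  = List.filter is-e? xs
  other = List.filter (¬? ∘ is-e?) xs
  drop : ∀ {x} → f x ≢ e × f x ∈ e ∷ es → f x ∈ es
  drop (x≢e , here x≡e) = ⊥-elim (x≢e x≡e)
  drop (_ , there p)    = p
  colour-e : ∀ {x} → x ∈ same → f x ≡ e
  colour-e = All.lookup (Allₚ.all-filter is-e? xs)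
  open ℕₚ.≤-Reasoning
  choose : (∃ λ ys → ys ⊆ other × length other ℕ.≤ length es ℕ.* length ys × (∀ {x y} → x ∈ ys → y ∈ ys → f x ≡ f y)) →
           ∃ λ ys → ys ⊆ xs × length xs ℕ.≤ length (e ∷ es) ℕ.* length ys × (∀ {x y} → x ∈ ys → y ∈ ys → f x ≡ f y)
  choose (ys , ys⊆ , le , mono) with ℕₚ.≤-total (length ys) (length same)
  ... | inj₁ ys≤same = same , filter-⊆ is-e? xs , (begin
          length xs                                     ≡⟨ length-filter-split is-e? xs ⟩
          length same ℕ.+ length other                  ≤⟨ ℕₚ.+-monoʳ-≤ (length same) (ℕₚ.≤-trans le (ℕₚ.*-monoʳ-≤ (length es) ys≤same)) ⟩
          length same ℕ.+ length es ℕ.* length same     ∎) , λ p q → ≡.trans (colour-e p) (≡.sym (colour-e q))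
  ... | inj₂ same≤ys = ys , ⊆-trans ys⊆ (filter-⊆ (¬? ∘ is-e?) xs) , (begin
          length xs                                     ≡⟨ length-filter-split is-e? xs ⟩
          length same ℕ.+ length other                  ≤⟨ ℕₚ.+-mono-≤ same≤ys le ⟩
          length ys ℕ.+ length es ℕ.* length ys         ∎) , mono

popular-colours : ∀ {A : Set} {E} n (c : Fin n → A → Fin E) xs →
  ∃ λ ys → ys ⊆ xs × length xs ℕ.≤ E ℕ.^ n ℕ.* length ys × (∀ {x y} → x ∈ ys → y ∈ ys → ∀ i → c i x ≡ c i y)
popular-colours         zero    c xs = xs , ⊆-refl , ℕₚ.≤-reflexive (≡.sym (ℕₚ.*-identityˡ _)) , λ _ _ ()
popular-colours {E = E} (suc n) c xs with popular-colour (c zero) (List.allFin E) xs (All.tabulate λ {x} _ → ∈-allFin (c zero x))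
... | ys , ys⊆xs , le , mono with popular-colours n (c ∘ suc) ys
... | zs , zs⊆ys , le′ , mono′ = zs , ⊆-trans zs⊆ys ys⊆xs , (begin
      length xs                              ≤⟨ le ⟩
      length (List.allFin E) ℕ.* length ys   ≡⟨ ≡.cong (ℕ._* length ys) (Listₚ.length-tabulate {n = E} id) ⟩
      E ℕ.* length ys                        ≤⟨ ℕₚ.*-monoʳ-≤ E le′ ⟩
      E ℕ.* (E ℕ.^ n ℕ.* length zs)          ≡⟨ ℕₚ.*-assoc E (E ℕ.^ n) (length zs) ⟨
      E ℕ.^ suc n ℕ.* length zs              ∎) ,
      λ { p q zero → mono (Sublist.lookup zs⊆ys p) (Sublist.lookup zs⊆ys q) ; p q (suc i) → mono′ p q i }
  where open ℕₚ.≤-Reasoning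

length-filter-filter : ∀ {A : Set} {P Q : A → Set} (P? : ∀ x → Dec (P x)) (Q? : ∀ x → Dec (Q x)) xs →
  length (List.filter Q? (List.filter P? xs)) ℕ.≤ length (List.filter Q? xs)
length-filter-filter P? Q? [] = ℕ.z≤n
length-filter-filter P? Q? (x ∷ xs) with P? x
length-filter-filter P? Q? (x ∷ xs) | no _ with Q? x
... | yes _ = ℕₚ.m≤n⇒m≤1+n (length-filter-filter P? Q? xs)
... | no _  = length-filter-filter P? Q? xs
length-filter-filter P? Q? (x ∷ xs) | yes _ with Q? x
... | yes _ = ℕ.s≤s (length-filter-filter P? Q? xs)
... | no _  = length-filter-filter P? Q? xs

-- Union bound, obtained by removing the exceptions of one `k` at a time.
avoid-exceptions : ∀ {K A : Set} {Holds : K → A → Set} (Holds? : ∀ k x → Dec (Holds k x)) τ (ks : List K) (xs : List A) →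
  (∀ {k} → k ∈ ks → length (List.filter (¬? ∘ Holds? k) xs) ℕ.≤ τ) → length ks ℕ.* τ ℕ.< length xs →
  ∃ λ x → x ∈ xs × (∀ {k} → k ∈ ks → Holds k x)
avoid-exceptions Holds? τ []       (x ∷ xs) _     _  = x , here refl , λ ()
avoid-exceptions {Holds = Holds} Holds? τ (k ∷ ks) xs few lt
  with avoid-exceptions Holds? τ ks (List.filter (Holds? k) xs)
    (λ p → ℕₚ.≤-trans (length-filter-filter (Holds? k) (¬? ∘ Holds? _) xs) (few (there p)))
    (ℕₚ.+-cancelˡ-< τ _ _ (begin-strict
      τ ℕ.+ length ks ℕ.* τ <⟨ lt ⟩
      length xs ≡⟨ length-filter-split (Holds? k) xs ⟩
      length (List.filter (Holds? k) xs) ℕ.+ length (List.filter (¬? ∘ Holds? k) xs) ≤⟨ ℕₚ.+-monoʳ-≤ (length (List.filter (Holds? k) xs)) (few (here refl)) ⟩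
      length (List.filter (Holds? k) xs) ℕ.+ τ ≡⟨ ℕₚ.+-comm (length (List.filter (Holds? k) xs)) τ ⟩
      τ ℕ.+ length (List.filter (Holds? k) xs) ∎))
  where open ℕₚ.≤-Reasoning
... | x , x∈ , holds = x , Sublist.lookup (filter-⊆ (Holds? k) xs) x∈ , λ where
  (here refl) → All.lookup (Allₚ.all-filter (Holds? k) xs) x∈
  (there p)   → holds p

length-cartesianProduct : ∀ {A B : Set} (xs : List A) (ys : List B) → length (List.cartesianProduct xs ys) ≡ length xs ℕ.* length ys
length-cartesianProduct []       ys = refl
length-cartesianProduct (x ∷ xs) ys = ≡.trans (Listₚ.length-++ (List.map (x ,_) ys))
  (≡.cong₂ ℕ._+_ (Listₚ.length-map (x ,_) ys) (length-cartesianProduct xs ys))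

count : {A : Set} → (A → Bool) → List A → ℕ
count b xs = length (List.filter (λ x → b x Bool.≟ true) xs)

differ? : {A : Set} (b c : A → Bool) → ∀ x → Dec (b x ≢ c x)
differ? b c x = ¬? (b x Bool.≟ c x)

-- For nested predicates, disagreements are counted by the difference of the two counts. This is
-- what converts close ranks into few exceptional points.
count-mono : ∀ {A : Set} (b c : A → Bool) → (∀ x → b x ≡ true → c x ≡ true) → ∀ xs →
  count c xs ≡ count b xs ℕ.+ length (List.filter (differ? b c) xs)
count-mono b c h [] = refl
count-mono b c h (x ∷ xs) with b x | c x | h x
... | true  | true  | _ = ≡.cong suc (count-mono b c h xs)
... | true  | false | i with () ← i refl
... | false | true  | _ = ≡.trans (≡.cong suc (count-mono b c h xs)) (≡.sym (ℕₚ.+-suc _ _))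
... | false | false | _ = count-mono b c h xs

differ-comm : ∀ {A : Set} (b c : A → Bool) xs → length (List.filter (differ? b c) xs) ≡ length (List.filter (differ? c b) xs)
differ-comm b c [] = refl
differ-comm b c (x ∷ xs) with b x | c x
... | true  | true  = differ-comm b c xs
... | true  | false = ≡.cong suc (differ-comm b c xs)
... | false | true  = ≡.cong suc (differ-comm b c xs)
... | false | false = differ-comm b c xs

same-quotient : ∀ a b t → a ℕ./ suc t ≡ b ℕ./ suc t → a ℕ.≤ b ℕ.+ t
same-quotient a b t eq = begin
  a                                       ≡⟨ m≡m%n+[m/n]*n a (suc t) ⟩
  a ℕ.% suc t ℕ.+ a ℕ./ suc t ℕ.* suc t       ≤⟨ ℕₚ.+-monoˡ-≤ _ (ℕₚ.≤-pred (m%n<n a (suc t))) ⟩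
  t ℕ.+ a ℕ./ suc t ℕ.* suc t               ≡⟨ ≡.cong (λ q → t ℕ.+ q ℕ.* suc t) eq ⟩
  t ℕ.+ b ℕ./ suc t ℕ.* suc t               ≤⟨ ℕₚ.+-monoʳ-≤ t (m/n*n≤m b (suc t)) ⟩
  t ℕ.+ b                                 ≡⟨ ℕₚ.+-comm t b ⟩
  b ℕ.+ t                                 ∎
  where open ℕₚ.≤-Reasoning

quotient-bound : ∀ r b E .{{_ : ℕ.NonZero E}} → r ℕ.≤ b → r ℕ./ suc (b ℕ./ E) ℕ.< E
quotient-bound r b E le = m<n*o⇒m/o<n (begin-strict
  r                           ≤⟨ le ⟩
  b                           ≡⟨ m≡m%n+[m/n]*n b E ⟩
  b ℕ.% E ℕ.+ b ℕ./ E ℕ.* E       <⟨ ℕₚ.+-monoˡ-< (b ℕ./ E ℕ.* E) (m%n<n b E) ⟩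
  E ℕ.+ b ℕ./ E ℕ.* E           ≡⟨ ℕₚ.*-comm (suc (b ℕ./ E)) E ⟩
  E ℕ.* suc (b ℕ./ E)           ∎)
  where open ℕₚ.≤-Reasoning

-- Write τ for the quotient. If b ≤ a τ, then τ (a K + 1) ≤ b⁺ ≤ K b ≤ τ (a K), which forces τ = 0
-- and then b = 0.
few-exceptions : ∀ a K E .{{_ : ℕ.NonZero E}} b b⁺ → E ≡ suc (a ℕ.* K) → 0 ℕ.< b → b⁺ ℕ.≤ K ℕ.* b → a ℕ.* (b⁺ ℕ./ E) ℕ.< b
few-exceptions a K _ b b⁺ refl b>0 b⁺≤ = ℕₚ.≰⇒> λ le → ℕₚ.<⇒≱ b>0 (ℕₚ.≤-trans le (ℕₚ.≤-reflexive
  (≡.trans (≡.cong (a ℕ.*_) (τ≡0 le)) (ℕₚ.*-zeroʳ a))))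
  where
  open ℕₚ.≤-Reasoning
  τ : ℕ
  τ = b⁺ ℕ./ suc (a ℕ.* K)
  lemma : ∀ k a t → k ℕ.* (a ℕ.* t) ≡ t ℕ.* (a ℕ.* k)
  lemma = ℕ-Ring.solve-∀
  τ≡0 : b ℕ.≤ a ℕ.* τ → τ ≡ 0
  τ≡0 le = ℕₚ.n≤0⇒n≡0 (ℕₚ.+-cancelʳ-≤ (τ ℕ.* (a ℕ.* K)) τ 0 (begin
    τ ℕ.+ τ ℕ.* (a ℕ.* K) ≡⟨ ℕₚ.*-suc τ (a ℕ.* K) ⟨
    τ ℕ.* suc (a ℕ.* K)   ≤⟨ m/n*n≤m b⁺ (suc (a ℕ.* K)) ⟩
    b⁺                    ≤⟨ b⁺≤ ⟩
    K ℕ.* b               ≤⟨ ℕₚ.*-monoʳ-≤ K le ⟩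
    K ℕ.* (a ℕ.* τ)       ≡⟨ lemma K a τ ⟩
    τ ℕ.* (a ℕ.* K)       ∎))

n<2^n : ∀ n → n ℕ.< 2 ℕ.^ n
n<2^n zero    = ℕ.s≤s ℕ.z≤n
n<2^n (suc n) = begin-strict
  suc n                                 <⟨ ℕ.s≤s (n<2^n n) ⟩
  1 ℕ.+ 2 ℕ.^ n                         ≤⟨ ℕₚ.+-monoˡ-≤ _ (ℕₚ.m^n>0 2 n) ⟩
  2 ℕ.^ n ℕ.+ 2 ℕ.^ n                   ≡⟨ ≡.cong (2 ℕ.^ n ℕ.+_) (ℕₚ.+-identityʳ _) ⟨
  2 ℕ.^ suc n                           ∎
  where open ℕₚ.≤-Reasoning

^-distribʳ-* : ∀ a b n → (a ℕ.* b) ℕ.^ n ≡ a ℕ.^ n ℕ.* b ℕ.^ n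
^-distribʳ-* a b zero    = refl
^-distribʳ-* a b (suc n) = ≡.trans (≡.cong (a ℕ.* b ℕ.*_) (^-distribʳ-* a b n)) (lemma a b (a ℕ.^ n) (b ℕ.^ n))
  where
  lemma : ∀ a b x y → a ℕ.* b ℕ.* (x ℕ.* y) ≡ a ℕ.* x ℕ.* (b ℕ.* y)
  lemma = ℕ-Ring.solve-∀

-- Otherwise V (Cʲ R₀) ≥ (2 Cᴺ)ʲ for all j, which exceeds the polynomial bound on V.
doubling-scale : (V : ℕ → ℕ) (N C : ℕ) .{{_ : ℕ.NonZero C}} → ∀ R₀ → 0 ℕ.< V (suc R₀) → (∀ R → V R ℕ.≤ suc (R ℕ.+ R) ℕ.^ N) →
  ∃ λ R → R₀ ℕ.≤ R × V (C ℕ.* R) ℕ.≤ 2 ℕ.* C ℕ.^ N ℕ.* V R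
doubling-scale V N C R₀ V>0 V≤ = search steps 0 (suc R₀) refl (ℕₚ.n≤1+n R₀) V>0 (≡.sym (ℕₚ.*-identityˡ (suc R₀)))
  where
  K steps : ℕ
  K = 2 ℕ.* C ℕ.^ N
  -- The constant factor of the bound (3 Cʲ (R₀ + 1))ᴺ. The powers of Cᴺ cancel, and 2ʲ exceeds this
  -- factor already when j equals it.
  steps = (3 ℕ.* suc R₀) ℕ.^ N
  triple : ∀ R → R₀ ℕ.< R → suc (R ℕ.+ R) ℕ.≤ 3 ℕ.* R
  triple (suc R) _ = ℕₚ.≤-trans (ℕₚ.m≤m+n _ R) (ℕₚ.≤-reflexive (lemma R))
    where
    lemma : ∀ R → suc (suc R ℕ.+ suc R) ℕ.+ R ≡ 3 ℕ.* suc R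
    lemma = ℕ-Ring.solve-∀
  search : ∀ fuel j R → j ℕ.+ fuel ≡ steps → R₀ ℕ.≤ R → K ℕ.^ j ℕ.≤ V R → R ≡ C ℕ.^ j ℕ.* suc R₀ →
           ∃ λ R → R₀ ℕ.≤ R × V (C ℕ.* R) ℕ.≤ K ℕ.* V R
  search zero j R eq le big refl = ⊥-elim (ℕₚ.<-irrefl refl (begin-strict
    steps ℕ.* (C ℕ.^ N) ℕ.^ steps                <⟨ ℕₚ.*-monoˡ-< _ {{ℕₚ.m^n≢0 (C ℕ.^ N) steps {{ℕₚ.m^n≢0 C N}}}} (n<2^n steps) ⟩
    2 ℕ.^ steps ℕ.* (C ℕ.^ N) ℕ.^ steps          ≡⟨ ^-distribʳ-* 2 (C ℕ.^ N) steps ⟨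
    K ℕ.^ steps                                  ≡⟨ ≡.cong (K ℕ.^_) j≡ ⟨
    K ℕ.^ j                                      ≤⟨ big ⟩
    V (C ℕ.^ j ℕ.* suc R₀)                       ≤⟨ V≤ _ ⟩
    suc (C ℕ.^ j ℕ.* suc R₀ ℕ.+ C ℕ.^ j ℕ.* suc R₀) ℕ.^ N ≤⟨ ℕₚ.^-monoˡ-≤ N (triple _ (ℕₚ.m≤n*m (suc R₀) (C ℕ.^ j) {{ℕₚ.m^n≢0 C j}})) ⟩
    (3 ℕ.* (C ℕ.^ j ℕ.* suc R₀)) ℕ.^ N           ≡⟨ ≡.cong (ℕ._^ N) (lemma (C ℕ.^ j) (suc R₀)) ⟩
    (3 ℕ.* suc R₀ ℕ.* C ℕ.^ j) ℕ.^ N             ≡⟨ ^-distribʳ-* (3 ℕ.* suc R₀) (C ℕ.^ j) N ⟩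
    steps ℕ.* (C ℕ.^ j) ℕ.^ N                    ≡⟨ ≡.cong (steps ℕ.*_) (≡.trans (ℕₚ.^-*-assoc C j N) (≡.trans (≡.cong (C ℕ.^_) (ℕₚ.*-comm j N)) (≡.sym (ℕₚ.^-*-assoc C N j)))) ⟩
    steps ℕ.* (C ℕ.^ N) ℕ.^ j                    ≡⟨ ≡.cong (λ j → steps ℕ.* (C ℕ.^ N) ℕ.^ j) j≡ ⟩
    steps ℕ.* (C ℕ.^ N) ℕ.^ steps                ∎))
    where
    open ℕₚ.≤-Reasoning
    j≡ : j ≡ steps
    j≡ = ≡.trans (≡.sym (ℕₚ.+-identityʳ j)) eq
    lemma : ∀ a b → 3 ℕ.* (a ℕ.* b) ≡ 3 ℕ.* b ℕ.* a
    lemma = ℕ-Ring.solve-∀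
  search (suc fuel) j R eq le big R≡ with V (C ℕ.* R) ℕ.≤? K ℕ.* V R
  ... | yes done = R , le , done
  ... | no ¬done = search fuel (suc j) (C ℕ.* R) (≡.trans (≡.sym (ℕₚ.+-suc j fuel)) eq)
        (ℕₚ.≤-trans le (ℕₚ.m≤n*m R C))
        (ℕₚ.≤-trans (ℕₚ.*-monoʳ-≤ K big) (ℕₚ.≰⇒≥ ¬done))
        (≡.trans (≡.cong (C ℕ.*_) R≡) (≡.sym (ℕₚ.*-assoc C (C ℕ.^ j) (suc R₀))))

-- Groups of polynomial growth

-- What is used of a group definable in ℤ: each coordinate of a product is given by one of finitely many affine maps,
-- and which of them apply depends only on residues of x and on truth values U j x p that are monotone in an integer α j x.
record AffineGroup (N J m C₀ : ℕ) : Set₁ where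
  field
    𝔾 : Group 0ℓ 0ℓ
  open GroupTheory 𝔾 public
  field
    coords       : Carrier → Fin N → ℤ
    coords-cong  : ∀ {x y} → x ≈ y → ∀ t → coords x t ≡ coords y t
    coords-injective : ∀ {x y} → (∀ t → coords x t ≡ coords y t) → x ≈ y
    size         : Carrier → ℕ
    ball         : ℕ → List Carrier
    ball-unique  : ∀ R → AllPairs _≉_ (ball R)
    ball-sound   : ∀ R → All (λ x → size x ℕ.≤ R) (ball R)
    ball-complete : ∀ R {x} → size x ℕ.≤ R → Any (x ≈_) (ball R)
    ball-length  : ∀ R → length (ball R) ℕ.≤ suc (R ℕ.+ R) ℕ.^ N
    β            : ℕ
    size-∙       : ∀ x y → size (x ∙ y) ℕ.≤ C₀ ℕ.* (size x ℕ.+ size y ℕ.+ β)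
    size-⟍       : ∀ x y → size (x ⟍ y) ℕ.≤ C₀ ℕ.* (size x ℕ.+ size y ℕ.+ β)
    size-ε       : size ε ℕ.≤ β
    α            : Fin J → Carrier → ℤ
    U            : Fin J → Carrier → Carrier → Bool
    U-mono       : ∀ j {x x′} → α j x ℤ.≤ α j x′ → ∀ p → U j x p ≡ true → U j x′ p ≡ true
    U-cong       : ∀ j x {p q} → p ≈ q → U j x p ≡ U j x q
    residue      : Fin N → Carrier → Fin m
    I            : Fin N → Set
    slope        : ∀ t → I t → ℤ
    slope≢0      : ∀ t i → slope t i ≢ 0ℤ
    lin rest     : ∀ t → I t → Carrier → ℤ
    rest-cong    : ∀ t i {p q} → p ≈ q → rest t i p ≡ rest t i q

  SameResidues : Carrier → Carrier → Set
  SameResidues x x′ = ∀ t → residue t x ≡ residue t x′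

  Agree : Carrier → Carrier → Carrier → Set
  Agree x x′ p = ∀ j → U j x p ≡ U j x′ p

  -- The equation is separated into a part in `x` and a part in `y`. Two left factors applied to the
  -- same `y` share `rest`, so their products differ by an amount depending only on the factors and
  -- on `i`.
  Solves : ∀ t → I t → Carrier → Carrier → Set
  Solves t i x y = slope t i ℤ.* coords (x ∙ y) t ℤ.+ (lin t i x ℤ.+ rest t i y) ≡ 0ℤ

  field
    solves       : ∀ t x y → ∃ λ i → Solves t i x y
    agree-∙      : ∀ t i {x x′ p} → SameResidues x x′ → Agree x x′ p → Solves t i x p → Solves t i x′ p
    agree-⟍      : ∀ t i {x x′ p} → SameResidues x x′ → Agree x x′ p → Solves t i x (x ⟍ p) → Solves t i x′ (x′ ⟍ p)

module Constants (N J m C₀ : ℕ) where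
  -- One product or quotient raises the level by one, provided R absorbs β. The longest expression
  -- to be controlled is x (x̄ ⟍ (w (w̄ ⟍ p))), with four operations, which is why `C` is `level 4`.
  level : ℕ → ℕ
  level zero    = 1
  level (suc s) = suc C₀ ℕ.* (level s ℕ.+ level s ℕ.+ 1)

  level-suc : ∀ s → level s ℕ.≤ level (suc s)
  level-suc s = ℕₚ.≤-trans (ℕₚ.m≤m+n (level s) (level s)) (ℕₚ.≤-trans (ℕₚ.m≤m+n _ 1) (ℕₚ.m≤n*m _ (suc C₀)))

  level≢0 : ∀ s → ℕ.NonZero (level s)
  level≢0 zero    = _
  level≢0 (suc s) = ℕ.>-nonZero (ℕₚ.<-≤-trans (ℕ.>-nonZero⁻¹ _ {{level≢0 s}}) (level-suc s))

  -- The 12 in E: two elements commute as soon as four shifts are tame, each of them under three conditions.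
  opaque
    C K E : ℕ
    C = level 4
    K = 2 ℕ.* C ℕ.^ N
    E = suc (12 ℕ.* J ℕ.* K)

    C≡ : C ≡ level 4
    C≡ = refl

    K≡ : K ≡ 2 ℕ.* C ℕ.^ N
    K≡ = refl

    E≡ : E ≡ suc (12 ℕ.* J ℕ.* K)
    E≡ = refl

  instance
    C≢0 : ℕ.NonZero C
    C≢0 = ≡.subst ℕ.NonZero (≡.sym C≡) (level≢0 4)

    E≢0 : ℕ.NonZero E
    E≢0 = ≡.subst ℕ.NonZero (≡.sym E≡) _

  κ : ℕ
  κ = K ℕ.* (E ℕ.^ J ℕ.* m ℕ.^ N)

module Counting {N J m C₀ : ℕ} (𝒢 : AffineGroup N J m (suc C₀)) where
  open AffineGroup 𝒢
  open Constants N J m C₀ public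

  _≈?_ : ∀ x y → Dec (x ≈ y)
  x ≈? y with Finₚ.all? (λ t → coords x t ℤ.≟ coords y t)
  ... | yes eq = yes (coords-injective eq)
  ... | no neq = no (neq ∘ coords-cong)

  act : Carrier → Carrier → Carrier → Carrier
  act x x̄ p = x ∙ (x̄ ⟍ p)

  act≈ : ∀ x x̄ p → act x x̄ p ≈ (x ∙ x̄ ⁻¹) ∙ p
  act≈ x x̄ p = sym (assoc x (x̄ ⁻¹) p)

  module Shift (x₀ : Carrier) where
    -- The route of an affine equation: `before` passes from x₀ to x̄ at p, `middle` exchanges the
    -- left factor x̄ for x, and `after` returns from x to x₀ at the new point.
    record Shifts (x x̄ p : Carrier) : Set where
      constructor shifts
      field
        before : Agree x̄ x₀ p
        middle : Agree x x̄ (x̄ ⟍ p)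
        after  : Agree x x₀ (act x x̄ p)

    -- Where x x̄⁻¹ is tame, it preserves the affine map that computes p = x₀ (x₀⁻¹ p), and translates p by an amount that
    -- depends only on this map.
    shift : ∀ {x x̄ p} → SameResidues x x₀ → SameResidues x̄ x₀ → Shifts x x̄ p → ∀ t i → Solves t i x₀ (x₀ ⟍ p) →
      Solves t i x₀ (x₀ ⟍ act x x̄ p) ×
      slope t i ℤ.* coords (act x x̄ p) t ≡ slope t i ℤ.* coords p t ℤ.+ (lin t i x̄ ℤ.- lin t i x)
    shift {x} {x̄} {p} rx rx̄ (shifts before middle after) t i s₀ =
      agree-⟍ t i rx after (≡.subst (λ z → z) (≡.cong₂ (λ c r → slope t i ℤ.* c ℤ.+ (lin t i x ℤ.+ r) ≡ 0ℤ)
          (coords-cong (∙-congˡ (sym cancel)) t) (rest-cong t i (sym cancel))) s₂) ,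
      solve-difference (slope t i ℤ.* coords p t) (slope t i ℤ.* coords (act x x̄ p) t) (lin t i x̄) (lin t i x) (rest t i (x̄ ⟍ p)) s₁′ s₂
      where
      cancel : x ⟍ act x x̄ p ≈ x̄ ⟍ p
      cancel = ∙-⟍ x (x̄ ⟍ p)
      s₁ : Solves t i x̄ (x̄ ⟍ p)
      s₁ = agree-⟍ t i (λ t → ≡.sym (rx̄ t)) (λ j → ≡.sym (before j)) s₀
      s₁′ : slope t i ℤ.* coords p t ℤ.+ (lin t i x̄ ℤ.+ rest t i (x̄ ⟍ p)) ≡ 0ℤ
      s₁′ = ≡.subst (λ c → slope t i ℤ.* c ℤ.+ (lin t i x̄ ℤ.+ rest t i (x̄ ⟍ p)) ≡ 0ℤ) (coords-cong (⟍-∙ x̄ p) t) s₁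
      s₂ : Solves t i x (x̄ ⟍ p)
      s₂ = agree-∙ t i (λ t → ≡.trans (rx̄ t) (≡.sym (rx t))) (λ j → ≡.sym (middle j)) s₁
      solve-difference : ∀ a b u v r → a ℤ.+ (u ℤ.+ r) ≡ 0ℤ → b ℤ.+ (v ℤ.+ r) ≡ 0ℤ → b ≡ a ℤ.+ (u ℤ.- v)
      solve-difference a b u v r e f = ≡.trans (left b v r) (≡.trans (≡.cong (ℤ._- (v ℤ.+ r)) (≡.trans f (≡.sym e))) (right a u v r))
        where
        left : ∀ b v r → b ≡ b ℤ.+ (v ℤ.+ r) ℤ.- (v ℤ.+ r)
        left = ℤ-Ring.solve-∀
        right : ∀ a u v r → a ℤ.+ (u ℤ.+ r) ℤ.- (v ℤ.+ r) ≡ a ℤ.+ (u ℤ.- v)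
        right = ℤ-Ring.solve-∀

    -- An equation `i` in force at p survives either move, so all four shifts use the same `i`, and
    -- both orders add the same two amounts to `slope t i * coords p t`. Nonzero slopes cancel.
    -- Agreement at the single point p is enough, because p cancels in the group.
    shifts-commute : ∀ {x x̄ w w̄ p} → SameResidues x x₀ → SameResidues x̄ x₀ → SameResidues w x₀ → SameResidues w̄ x₀ →
      Shifts x x̄ p → Shifts w w̄ p → Shifts w w̄ (act x x̄ p) → Shifts x x̄ (act w w̄ p) →
      Comm (x ∙ x̄ ⁻¹) (w ∙ w̄ ⁻¹)
    shifts-commute {x} {x̄} {w} {w̄} {p} rx rx̄ rw rw̄ xp wp wxp xwp = ∙-cancelʳ p _ _ (begin
      (x ∙ x̄ ⁻¹) ∙ (w ∙ w̄ ⁻¹) ∙ p   ≈⟨ assoc _ _ p ⟩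
      (x ∙ x̄ ⁻¹) ∙ ((w ∙ w̄ ⁻¹) ∙ p) ≈⟨ ∙-congˡ (act≈ w w̄ p) ⟨
      (x ∙ x̄ ⁻¹) ∙ act w w̄ p        ≈⟨ act≈ x x̄ _ ⟨
      act x x̄ (act w w̄ p)           ≈⟨ coords-injective coords≡ ⟩
      act w w̄ (act x x̄ p)           ≈⟨ act≈ w w̄ _ ⟩
      (w ∙ w̄ ⁻¹) ∙ act x x̄ p        ≈⟨ ∙-congˡ (act≈ x x̄ p) ⟩
      (w ∙ w̄ ⁻¹) ∙ ((x ∙ x̄ ⁻¹) ∙ p) ≈⟨ assoc _ _ p ⟨
      (w ∙ w̄ ⁻¹) ∙ (x ∙ x̄ ⁻¹) ∙ p   ∎)
      where
      open import Relation.Binary.Reasoning.Setoid setoid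
      swap : ∀ a u v → a ℤ.+ u ℤ.+ v ≡ a ℤ.+ v ℤ.+ u
      swap = ℤ-Ring.solve-∀
      coords≡ : ∀ t → coords (act x x̄ (act w w̄ p)) t ≡ coords (act w w̄ (act x x̄ p)) t
      coords≡ t with solves t x₀ (x₀ ⟍ p)
      ... | i , s with shift rx rx̄ xp t i s | shift rw rw̄ wp t i s
      ... | sx , ex | sw , ew with shift rw rw̄ wxp t i sx | shift rx rx̄ xwp t i sw
      ... | _ , ewx | _ , exw = ℤₚ.*-cancelˡ-≡ (slope t i) _ _ {{ℤ.≢-nonZero (slope≢0 t i)}} (≡.trans exw
            (≡.trans (≡.cong (ℤ._+ (lin t i x̄ ℤ.- lin t i x)) ew)
            (≡.trans (swap (slope t i ℤ.* coords p t) (lin t i w̄ ℤ.- lin t i w) (lin t i x̄ ℤ.- lin t i x))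
            (≡.sym (≡.trans ewx (≡.cong (ℤ._+ (lin t i w̄ ℤ.- lin t i w)) ex))))))

  module Scale (R : ℕ) (β≤R : β ℕ.≤ R) (doubling : length (ball (C ℕ.* R)) ℕ.≤ K ℕ.* length (ball R)) where

    B B⁺ : List Carrier
    B  = ball R
    B⁺ = ball (C ℕ.* R)

    Level : ℕ → Carrier → Set
    Level s x = size x ℕ.≤ level s ℕ.* R

    level-up : ∀ s {x} → Level s x → Level (suc s) x
    level-up s le = ℕₚ.≤-trans le (ℕₚ.*-monoˡ-≤ R (level-suc s))

    private
      grow : ∀ s {z a b} → z ℕ.≤ suc C₀ ℕ.* (a ℕ.+ b ℕ.+ β) → a ℕ.≤ level s ℕ.* R → b ℕ.≤ level s ℕ.* R → z ℕ.≤ level (suc s) ℕ.* R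
      grow s {z} {a} {b} h p q = begin
        z ≤⟨ h ⟩
        suc C₀ ℕ.* (a ℕ.+ b ℕ.+ β) ≤⟨ ℕₚ.*-monoʳ-≤ (suc C₀) (ℕₚ.+-mono-≤ (ℕₚ.+-mono-≤ p q) β≤R) ⟩
        suc C₀ ℕ.* (level s ℕ.* R ℕ.+ level s ℕ.* R ℕ.+ R) ≡⟨ lemma (suc C₀) (level s) R ⟩
        level (suc s) ℕ.* R ∎
        where
        open ℕₚ.≤-Reasoning
        lemma : ∀ c l r → c ℕ.* (l ℕ.* r ℕ.+ l ℕ.* r ℕ.+ r) ≡ c ℕ.* (l ℕ.+ l ℕ.+ 1) ℕ.* r
        lemma = ℕ-Ring.solve-∀

    level-∙ : ∀ s {x y} → Level s x → Level s y → Level (suc s) (x ∙ y)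
    level-∙ s = grow s (size-∙ _ _)

    level-⟍ : ∀ s {x y} → Level s x → Level s y → Level (suc s) (x ⟍ y)
    level-⟍ s = grow s (size-⟍ _ _)

    level-ball : ∀ {x} → x ∈ B → Level 0 x
    level-ball x∈ = ℕₚ.≤-trans (All.lookup (ball-sound R) x∈) (ℕₚ.≤-reflexive (≡.sym (ℕₚ.*-identityˡ R)))

    level₁₂₃₄ : ∀ {x} → Level 0 x → Level 1 x × Level 2 x × Level 3 x × Level 4 x
    level₁₂₃₄ l = let l₁ = level-up 0 l; l₂ = level-up 1 l₁; l₃ = level-up 2 l₂ in l₁ , l₂ , l₃ , level-up 3 l₃

    B-inhabited : 0 ℕ.< length B
    B-inhabited = inhabited (ball-complete R (ℕₚ.≤-trans size-ε β≤R))
      where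
      inhabited : ∀ {xs} → Any (ε ≈_) xs → 0 ℕ.< length xs
      inhabited (here _)  = ℕ.s≤s ℕ.z≤n
      inhabited (there _) = ℕ.s≤s ℕ.z≤n

    -- Ranks are at most the length of `B⁺`, so buckets of width `suc τ` number at most `E`; and `E`
    -- is large enough for `12 * J * τ` to stay below the length of `B`.
    τ : ℕ
    τ = length B⁺ ℕ./ E

    -- U j x grows with α j x, so elements of nearly equal rank disagree at few points.
    rank : Fin J → Carrier → ℕ
    rank j x = count (U j x) B⁺

    rank<E : ∀ j x → rank j x ℕ./ suc τ ℕ.< E
    rank<E j x = quotient-bound (rank j x) (length B⁺) E (Listₚ.length-filter (λ p → U j x p Bool.≟ true) B⁺)

    bucket : Fin J → Carrier → Fin E
    bucket j x = Fin.fromℕ< (rank<E j x)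

    same-bucket : ∀ j {x x′} → bucket j x ≡ bucket j x′ → length (List.filter (differ? (U j x) (U j x′)) B⁺) ℕ.≤ τ
    same-bucket j {x} {x′} eq with ℤₚ.≤-total (α j x) (α j x′)
    ... | inj₁ le = same-bucket-≤ x x′ le eq
      where
      same-bucket-≤ : ∀ x x′ → α j x ℤ.≤ α j x′ → bucket j x ≡ bucket j x′ → length (List.filter (differ? (U j x) (U j x′)) B⁺) ℕ.≤ τ
      same-bucket-≤ x x′ le eq = ℕₚ.+-cancelˡ-≤ (rank j x) _ _ (ℕₚ.≤-trans
        (ℕₚ.≤-reflexive (≡.sym (count-mono (U j x) (U j x′) (U-mono j le) B⁺)))
        (same-quotient (rank j x′) (rank j x) τ (≡.sym (Finₚ.fromℕ<-injective _ _ (rank<E j x) (rank<E j x′) eq))))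
    ... | inj₂ le = ℕₚ.≤-trans (ℕₚ.≤-reflexive (differ-comm (U j x) (U j x′) B⁺)) (ℕₚ.+-cancelˡ-≤ (rank j x′) _ _ (ℕₚ.≤-trans
        (ℕₚ.≤-reflexive (≡.sym (count-mono (U j x′) (U j x) (U-mono j le) B⁺)))
        (same-quotient (rank j x) (rank j x′) τ (Finₚ.fromℕ<-injective _ _ (rank<E j x) (rank<E j x′) eq))))

    ball⁺-complete : ∀ {x} → Level 4 x → Any (x ≈_) B⁺
    ball⁺-complete {x} l = ball-complete (C ℕ.* R) (≡.subst (λ c → size x ℕ.≤ c ℕ.* R) (≡.sym C≡) l)

    private
      popular₁ = popular-colours J bucket B
      popular₂ = popular-colours N residue (proj₁ popular₁)

    A : List Carrier
    A = proj₁ popular₂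

    A⊆B : A ⊆ B
    A⊆B = ⊆-trans (proj₁ (proj₂ popular₂)) (proj₁ (proj₂ popular₁))

    length-A : length B ℕ.≤ E ℕ.^ J ℕ.* m ℕ.^ N ℕ.* length A
    length-A = ℕₚ.≤-trans (proj₁ (proj₂ (proj₂ popular₁))) (ℕₚ.≤-trans (ℕₚ.*-monoʳ-≤ (E ℕ.^ J) (proj₁ (proj₂ (proj₂ popular₂))))
      (ℕₚ.≤-reflexive (≡.sym (ℕₚ.*-assoc (E ℕ.^ J) (m ℕ.^ N) (length A)))))

    A-bucket : ∀ {x x′} → x ∈ A → x′ ∈ A → ∀ j → bucket j x ≡ bucket j x′
    A-bucket p q = proj₂ (proj₂ (proj₂ popular₁)) (Sublist.lookup (proj₁ (proj₂ popular₂)) p) (Sublist.lookup (proj₁ (proj₂ popular₂)) q)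

    A-residue : ∀ {x x′} → x ∈ A → x′ ∈ A → SameResidues x x′
    A-residue p q = proj₂ (proj₂ (proj₂ popular₂)) p q

    level-A : ∀ {x} → x ∈ A → Level 0 x
    level-A p = level-ball (Sublist.lookup A⊆B p)

    -- The map `φ` sends the exceptional points of `B` injectively to points of `B⁺` at which
    -- `U j u` and `U j v` disagree. Since u and v share their buckets, there are at most `τ` of
    -- those.
    record Condition : Set where
      constructor condition
      field
        {u v} : Carrier
        u∈A   : u ∈ A
        v∈A   : v ∈ A
        φ     : Carrier → Carrier
        φ-injective : ∀ {p q} → φ p ≈ φ q → p ≈ q
        φ-level     : ∀ {p} → Level 0 p → Level 4 (φ p)

      Holds : Fin J → Carrier → Set
      Holds j p = U j u (φ p) ≡ U j v (φ p)

      exceptions : ∀ j → length (List.filter (λ p → ¬? (U j u (φ p) Bool.≟ U j v (φ p))) B) ℕ.≤ τ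
      exceptions j = ℕₚ.≤-trans (length-matching (λ p y → φ p ≈ y)
          (AllPairsₚ.filter⁺ exception? (AllPairs.map (λ x≉y {_} e f → x≉y (φ-injective (trans e (sym f)))) (ball-unique R)))
          (All.tabulate λ {p} p∈ → meets p∈))
        (same-bucket j (A-bucket u∈A v∈A j))
        where
        exception? : ∀ p → Dec (U j u (φ p) ≢ U j v (φ p))
        exception? p = ¬? (U j u (φ p) Bool.≟ U j v (φ p))
        meets : ∀ {p} → p ∈ List.filter exception? B → Any (φ p ≈_) (List.filter (differ? (U j u) (U j v)) B⁺)
        meets {p} p∈ with find (ball⁺-complete (φ-level (level-ball (Sublist.lookup (filter-⊆ exception? B) p∈))))
        ... | y , y∈ , φp≈y = lose (∈-filter⁺ (differ? (U j u) (U j v)) y∈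
              (≡.subst₂ _≢_ (U-cong j u φp≈y) (U-cong j v φp≈y) (All.lookup (Allₚ.all-filter exception? B) p∈))) φp≈y

    open Condition

    all-hold : (cs : List Condition) → length cs ℕ.≤ 12 → ∃ λ p → p ∈ B × (∀ {c} → c ∈ cs → ∀ j → Holds c j p)
    all-hold cs le with avoid-exceptions {Holds = λ (c , j) → Holds c j} (λ (c , j) p → U j (u c) (φ c p) Bool.≟ U j (v c) (φ c p)) τ
      (List.cartesianProduct cs (List.allFin J)) B (λ {(c , j)} _ → exceptions c j)
      (ℕₚ.≤-<-trans (ℕₚ.*-monoˡ-≤ τ (ℕₚ.≤-trans (ℕₚ.≤-reflexive (≡.trans (length-cartesianProduct cs (List.allFin J))
          (≡.cong (length cs ℕ.*_) (Listₚ.length-tabulate {n = J} id)))) (ℕₚ.*-monoˡ-≤ J le))) (few-exceptions (12 ℕ.* J) K E (length B) (length B⁺) E≡ B-inhabited doubling))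
    ... | p , p∈ , holds = p , p∈ , λ c∈ j → holds (∈-cartesianProduct⁺ c∈ (∈-allFin j))

    ∙-injective : ∀ x {p q} → x ∙ p ≈ x ∙ q → p ≈ q
    ∙-injective x = ∙-cancelˡ x _ _

    module _ {x x̄ x₀} (x∈ : x ∈ A) (x̄∈ : x̄ ∈ A) (x₀∈ : x₀ ∈ A) (ψ : Carrier → Carrier)
             (inj : ∀ {p q} → ψ p ≈ ψ q → p ≈ q) (lev : ∀ {p} → Level 0 p → Level 2 (ψ p)) where
      private
        level-middle : ∀ {p} → Level 0 p → Level 3 (x̄ ⟍ ψ p)
        level-middle l = level-⟍ 2 (proj₁ (proj₂ (level₁₂₃₄ (level-A x̄∈)))) (lev l)

      before middle after : Condition
      before = condition x̄∈ x₀∈ ψ inj (λ l → level-up 3 (level-up 2 (lev l)))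
      middle = condition x∈ x̄∈ (λ p → x̄ ⟍ ψ p) (λ e → inj (∙-injective _ e)) (λ l → level-up 3 (level-middle l))
      after  = condition x∈ x₀∈ (λ p → act x x̄ (ψ p)) (λ e → inj (∙-injective _ (∙-injective _ e)))
                 (λ l → level-∙ 3 (proj₁ (proj₂ (proj₂ (level₁₂₃₄ (level-A x∈))))) (level-middle l))

      conditions : List Condition
      conditions = before ∷ middle ∷ after ∷ []

      conditions⇒shifts : ∀ {p} → (∀ {c} → c ∈ conditions → ∀ j → Holds c j p) → Shift.Shifts x₀ x x̄ (ψ p)
      conditions⇒shifts holds = Shift.shifts (holds {before} (here refl)) (holds {middle} (there (here refl))) (holds {after} (there (there (here refl))))

    act-injective : ∀ x x̄ {p q} → act x x̄ p ≈ act x x̄ q → p ≈ q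
    act-injective x x̄ e = ∙-injective (x̄ ⁻¹) (∙-injective x e)

    level-act : ∀ {x x̄ p} → x ∈ A → x̄ ∈ A → Level 0 p → Level 2 (act x x̄ p)
    level-act x∈ x̄∈ l = level-∙ 1 (proj₁ (level₁₂₃₄ (level-A x∈))) (level-⟍ 0 (level-A x̄∈) l)

    level₂ : ∀ {p} → Level 0 p → Level 2 p
    level₂ l = proj₁ (proj₂ (level₁₂₃₄ l))

    differences-commute : ∀ {x x̄ w w̄} → x ∈ A → x̄ ∈ A → w ∈ A → w̄ ∈ A → Comm (x ∙ x̄ ⁻¹) (w ∙ w̄ ⁻¹)
    differences-commute {x} {x̄} {w} {w̄} x∈ x̄∈ w∈ w̄∈ = conclude (all-hold (cs₁ List.++ cs₂ List.++ cs₃ List.++ cs₄) ℕₚ.≤-refl)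
      where
      cs₁ cs₂ cs₃ cs₄ : List Condition
      -- Any member of A can be the reference x₀; here it is `w`. Each move is required at p and
      -- again at the image of p under the other move.
      cs₁ = conditions x∈ x̄∈ w∈ id id level₂
      cs₂ = conditions w∈ w̄∈ w∈ id id level₂
      cs₃ = conditions w∈ w̄∈ w∈ (act x x̄) (act-injective x x̄) (level-act x∈ x̄∈)
      cs₄ = conditions x∈ x̄∈ w∈ (act w w̄) (act-injective w w̄) (level-act w∈ w̄∈)
      conclude : (∃ λ p → p ∈ B × (∀ {c} → c ∈ cs₁ List.++ cs₂ List.++ cs₃ List.++ cs₄ → ∀ j → Holds c j p)) → Comm (x ∙ x̄ ⁻¹) (w ∙ w̄ ⁻¹)
      conclude (p , _ , holds) = Shift.shifts-commute w (A-residue x∈ w∈) (A-residue x̄∈ w∈) (A-residue w∈ w∈) (A-residue w̄∈ w∈)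
        (conditions⇒shifts x∈ x̄∈ w∈ id id level₂ λ c∈ → holds (∈-++⁺ˡ c∈))
        (conditions⇒shifts w∈ w̄∈ w∈ id id level₂ λ c∈ → holds (∈-++⁺ʳ cs₁ (∈-++⁺ˡ c∈)))
        (conditions⇒shifts w∈ w̄∈ w∈ (act x x̄) (act-injective x x̄) (level-act x∈ x̄∈) λ c∈ → holds (∈-++⁺ʳ cs₁ (∈-++⁺ʳ cs₂ (∈-++⁺ˡ c∈))))
        (conditions⇒shifts x∈ x̄∈ w∈ (act w w̄) (act-injective w w̄) (level-act w∈ w̄∈) λ c∈ → holds (∈-++⁺ʳ cs₁ (∈-++⁺ʳ cs₂ (∈-++⁺ʳ cs₃ c∈))))

    Meet : Carrier → Carrier → Set
    Meet x y = Any (λ a → Any (λ b → x ∙ a ≈ y ∙ b) A) A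

    meet? : ∀ x y → Dec (Meet x y)
    meet? x y = any? (λ a → any? (λ b → (x ∙ a) ≈? (y ∙ b)) A) A

    A-inhabited : 0 ℕ.< length A
    A-inhabited with length A in eq
    ... | suc _ = ℕ.s≤s ℕ.z≤n
    ... | zero  = ⊥-elim (ℕₚ.<⇒≱ B-inhabited (ℕₚ.≤-trans length-A (ℕₚ.≤-reflexive (≡.trans (≡.cong (E ℕ.^ J ℕ.* m ℕ.^ N ℕ.*_) eq) (ℕₚ.*-zeroʳ (E ℕ.^ J ℕ.* m ℕ.^ N))))))

    meet-refl : ∀ x → Meet x x
    meet-refl x = self A A-inhabited
      where
      self : ∀ as → 0 ℕ.< length as → Any (λ a → Any (λ b → x ∙ a ≈ x ∙ b) as) as
      self (a ∷ as) _ = here (here refl≈)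

    meet-cong : ∀ {x x′ y} → x ≈ x′ → Meet x′ y → Meet x y
    meet-cong e = Any.map (Any.map (trans (∙-congʳ e)))

    -- Ruzsa's covering argument: in a maximal family of disjoint translates of A, every further
    -- translate meets a member. The family is short because its members all lie in `B⁺`.
    disjoint-translates : ∀ xs → xs ⊆ B → ∃ λ gs → gs ⊆ xs × AllPairs (λ x y → ¬ Meet x y) gs × All (λ x → Any (Meet x) gs) xs
    disjoint-translates []       _  = [] , [] , [] , []
    disjoint-translates (x ∷ xs) ⊆B with disjoint-translates xs (⊆-trans (x ∷ʳ ⊆-refl) ⊆B)
    ... | gs , gs⊆ , apart , covers with any? (meet? x) gs
    ...   | yes meets = gs , x ∷ʳ gs⊆ , apart , meets ∷ covers
    ...   | no none   = x ∷ gs , refl ∷ gs⊆ , Allₚ.¬Any⇒All¬ gs none ∷ apart , here (meet-refl x) ∷ All.map there covers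

    private
      translates = disjoint-translates B ⊆-refl

    gs : List Carrier
    gs = proj₁ translates

    gs⊆B : gs ⊆ B
    gs⊆B = proj₁ (proj₂ translates)

    products : ∀ gs → gs ⊆ B → AllPairs (λ x y → ¬ Meet x y) gs → length gs ℕ.* length A ℕ.≤ length B⁺
    products gs gs⊆ apart = ≡.subst (ℕ._≤ length B⁺) (length-cartesianProduct gs A)
      (length-matching (λ (g , a) y → g ∙ a ≈ y) (distinct gs apart)
        (All.tabulate λ {(g , a)} p → let g∈ , a∈ = ∈-cartesianProduct⁻ gs A p in
          ball⁺-complete (level-up 3 (level-up 2 (level-up 1 (level-∙ 0 (level-ball (Sublist.lookup gs⊆ g∈)) (level-A a∈)))))))
      where
      Apart : Carrier × Carrier → Carrier × Carrier → Set
      Apart (g , a) (h , b) = ∀ {y} → g ∙ a ≈ y → ¬ h ∙ b ≈ y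
      A-unique : AllPairs _≉_ A
      A-unique = AllPairs-resp-⊆ A⊆B (ball-unique R)
      distinct : ∀ gs → AllPairs (λ x y → ¬ Meet x y) gs → AllPairs Apart (List.cartesianProduct gs A)
      distinct []       _              = []
      distinct (g ∷ gs) (none ∷ apart) = AllPairsₚ.++⁺
        (AllPairsₚ.map⁺ (AllPairs.map (λ a≉b {_} e f → a≉b (∙-injective g (trans e (sym f)))) A-unique))
        (distinct gs apart)
        (All.tabulate λ p → All.tabulate λ q → across p q)
        where
        across : ∀ {c d} → c ∈ List.map (g ,_) A → d ∈ List.cartesianProduct gs A → Apart c d
        across {c} {h , b} c∈ d∈ with ∈-map⁻ (g ,_) c∈ | ∈-cartesianProduct⁻ gs A d∈
        ... | a , a∈ , refl | h∈ , b∈ = λ e f → All.lookup none h∈ (lose a∈ (lose b∈ (trans e (sym f))))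

    length-gs : length gs ℕ.≤ κ
    length-gs = ℕₚ.*-cancelʳ-≤ (length gs) κ (length A) {{ℕ.>-nonZero A-inhabited}} (begin
      length gs ℕ.* length A                        ≤⟨ products gs gs⊆B (proj₁ (proj₂ (proj₂ translates))) ⟩
      length B⁺                                     ≤⟨ doubling ⟩
      K ℕ.* length B                                ≤⟨ ℕₚ.*-monoʳ-≤ K length-A ⟩
      K ℕ.* (E ℕ.^ J ℕ.* m ℕ.^ N ℕ.* length A)      ≡⟨ ℕₚ.*-assoc K (E ℕ.^ J ℕ.* m ℕ.^ N) (length A) ⟨
      κ ℕ.* length A                                ∎)
      where open ℕₚ.≤-Reasoning

    covered : ∀ {x} → size x ℕ.≤ R → Any (Meet x) gs
    covered le with find (ball-complete R le)
    ... | y , y∈ , x≈y = Any.map (meet-cong x≈y) (All.lookup (proj₂ (proj₂ (proj₂ translates))) y∈)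

    private
      default : Any (Meet ε) gs
      default = covered (ℕₚ.≤-trans size-ε β≤R)

    -- Elements whose translate meets none of the family lie outside the ball, where any value will
    -- do. The translate that meets A itself supplies one, since the ball contains the neutral
    -- element.
    class : Carrier → Fin κ
    class x with any? (meet? x) gs
    ... | yes meets = Fin.inject≤ (Any.index meets) length-gs
    ... | no _      = Fin.inject≤ (Any.index default) length-gs

    class-representative : ∀ {x y} → size x ℕ.≤ R → size y ℕ.≤ R → class x ≡ class y → ∃ λ g → Meet x g × Meet y g
    class-representative {x} {y} bx by eq with any? (meet? x) gs | any? (meet? y) gs
    ... | no none   | _         = ⊥-elim (none (covered bx))
    ... | yes _     | no none   = ⊥-elim (none (covered by))
    ... | yes mx    | yes my    = List.lookup gs (Any.index mx) , Anyₚ.lookup-index mx ,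
      ≡.subst (λ i → Meet y (List.lookup gs i)) (≡.sym (Finₚ.inject≤-injective length-gs length-gs _ _ eq)) (Anyₚ.lookup-index my)

    Difference : Carrier → Set
    Difference d = ∃ λ a → ∃ λ b → a ∈ A × b ∈ A × d ≈ a ∙ b ⁻¹

    meet-difference : ∀ {x g} → Meet x g → Difference (x ⟍ g)
    meet-difference {x} {g} mt with find mt
    ... | a , a∈ , mt′ with find mt′
    ... | b , b∈ , xa≈gb = a , b , a∈ , b∈ , (begin
          x ⁻¹ ∙ g                   ≈⟨ ∙-congˡ (x≈z//y g b (x ∙ a) (sym xa≈gb)) ⟩
          x ⁻¹ ∙ (x ∙ a ∙ b ⁻¹)      ≈⟨ ∙-congˡ (assoc x a (b ⁻¹)) ⟩
          x ⁻¹ ∙ (x ∙ (a ∙ b ⁻¹))    ≈⟨ assoc (x ⁻¹) x _ ⟨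
          x ⁻¹ ∙ x ∙ (a ∙ b ⁻¹)      ≈⟨ ∙-congʳ (inverseˡ x) ⟩
          ε ∙ (a ∙ b ⁻¹)             ≈⟨ identityˡ _ ⟩
          a ∙ b ⁻¹                   ∎)
      where open import Relation.Binary.Reasoning.Setoid setoid

    -- The quotient x ⟍ x′ is x ⟍ g times the inverse of x′ ⟍ g, and both of these have the form a
    -- b⁻¹.
    commute-with-quotient : ∀ {h x x′ g} → (∀ {d} → Difference d → Comm h d) → Meet x g → Meet x′ g → Comm h (x ⟍ x′)
    commute-with-quotient {h} {x} {x′} {g} central mx mx′ = comm-cong refl≈
      (trans (∙-congˡ (⟍-inverse x′ g)) (trans (assoc (x ⁻¹) g (g ⟍ x′)) (∙-congˡ (⟍-∙ g x′))))
      (comm-∙ (central (meet-difference mx)) (comm-⁻¹ (central (meet-difference mx′))))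

    class-commute : ∀ {x x′ y y′} → size x ℕ.≤ R → size x′ ℕ.≤ R → size y ℕ.≤ R → size y′ ℕ.≤ R →
      class x ≡ class x′ → class y ≡ class y′ → Comm (x ⟍ x′) (y ⟍ y′)
    class-commute bx bx′ by by′ ex ey with class-representative bx bx′ ex | class-representative by by′ ey
    ... | g , mx , mx′ | h , my , my′ = commute-with-quotient (λ dy → sym (commute-with-quotient (λ dx → differences dy dx) mx mx′)) my my′
      where
      differences : ∀ {d d′} → Difference d → Difference d′ → Comm d d′
      differences (a , b , a∈ , b∈ , d≈) (a′ , b′ , a′∈ , b′∈ , d′≈) =
        comm-cong (sym d≈) (sym d′≈) (differences-commute a∈ b∈ a′∈ b′∈)

  -- The radius with small doubling may be far larger than the given one, but its colouring serves
  -- the smaller ball too. Asking also for R ≥ β keeps the parameters out of κ.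
  local : ∀ R → Σ (Carrier → Fin κ) λ cl → ∀ {x x′ y y′} →
      size x ℕ.≤ R → size x′ ℕ.≤ R → size y ℕ.≤ R → size y′ ℕ.≤ R →
      cl x ≡ cl x′ → cl y ≡ cl y′ → Comm (x ⟍ x′) (y ⟍ y′)
  local R₀ with doubling-scale (length ∘ ball) N C (R₀ ℕ.⊔ β)
    (inhabited (ball-complete _ (ℕₚ.≤-trans size-ε (ℕₚ.m≤n⇒m≤1+n (ℕₚ.m≤n⊔m R₀ β))))) ball-length
    where
    inhabited : ∀ {x xs} → Any (x ≈_) xs → 0 ℕ.< length xs
    inhabited (here _)  = ℕ.s≤s ℕ.z≤n
    inhabited (there _) = ℕ.s≤s ℕ.z≤n
  ... | R , le , doubling = class , λ bx bx′ by by′ → class-commute (up bx) (up bx′) (up by) (up by′)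
    where
    open Scale R (ℕₚ.≤-trans (ℕₚ.m≤n⊔m R₀ β) le) (≡.subst (λ k → length (ball (C ℕ.* R)) ℕ.≤ k ℕ.* length (ball R)) (≡.sym K≡) doubling)
    up : ∀ {x} → size x ℕ.≤ R₀ → size x ℕ.≤ R
    up b = ℕₚ.≤-trans b (ℕₚ.≤-trans (ℕₚ.m≤m⊔n R₀ β) le)

open ≡ using (sym; trans; cong; cong₂; subst; subst₂; module ≡-Reasoning)
open import Data.Integer using (_+_; _*_; -_; _-_; _<_; _≤_; +<+)
open ℤ-Ring using (solve-∀)

-- Quantifier elimination over ℤ

isPos : ℤ → Bool
isPos (+ suc _)  = true
isPos (+ zero)   = false
isPos (-[1+ _ ]) = false

isPos-+ : ∀ u d → ∣ d ∣ ℕ.< ∣ u ∣ → isPos (u + d) ≡ isPos u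
isPos-+ (+ suc u)  (+ d)      _ = refl
isPos-+ (+ suc u)  -[1+ d ]   (ℕ.s≤s d<u) = by-shape (ℕₚ.m<n⇒0<n∸m d<u) (ℤₚ.⊖-≥ (ℕ.s≤s (ℕₚ.<⇒≤ d<u)))
  where
  by-shape : ∀ {k z} → 0 ℕ.< k → z ≡ + k → isPos z ≡ true
  by-shape (ℕ.s≤s _) refl = refl
isPos-+ (+ zero)   d          ()
isPos-+ -[1+ u ]   (+ zero)   _ = refl
isPos-+ -[1+ u ]   (+ suc d)  (ℕ.s≤s d<u) = by-shape (ℤₚ.⊖-≤ (ℕ.s≤s (ℕₚ.<⇒≤ d<u)))
  where
  by-shape : ∀ {k z} → z ≡ - (+ k) → isPos z ≡ false
  by-shape {zero}  refl = refl
  by-shape {suc k} refl = refl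
isPos-+ -[1+ u ]   -[1+ d ]   _ = refl

shrink : ∀ u c → 0 ℕ.< ∣ c ∣ → ∣ c ∣ ℕ.< ∣ u ∣ → (∣ u + c ∣ ℕ.< ∣ u ∣) ⊎ (∣ u - c ∣ ℕ.< ∣ u ∣)
shrink u (+ zero) () _
shrink (+ suc u) (+ suc c) _ (ℕ.s≤s c<u) = inj₂ (subst (λ z → ∣ z ∣ ℕ.< suc u) (sym (ℤₚ.⊖-≥ (ℕ.s≤s (ℕₚ.<⇒≤ c<u)))) (ℕ.s≤s (ℕₚ.m∸n≤m u c)))
shrink (+ suc u) -[1+ c ] _ (ℕ.s≤s c<u) = inj₁ (subst (λ z → ∣ z ∣ ℕ.< suc u) (sym (ℤₚ.⊖-≥ (ℕ.s≤s (ℕₚ.<⇒≤ c<u)))) (ℕ.s≤s (ℕₚ.m∸n≤m u c)))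
shrink -[1+ u ] (+ suc c) _ (ℕ.s≤s c<u) = inj₁ (subst (λ z → ∣ z ∣ ℕ.< suc u) (sym (ℤₚ.⊖-≤ (ℕ.s≤s (ℕₚ.<⇒≤ c<u))))
  (subst (ℕ._< suc u) (sym (ℤₚ.∣-i∣≡∣i∣ (+ (u ℕ.∸ c)))) (ℕ.s≤s (ℕₚ.m∸n≤m u c))))
shrink -[1+ u ] -[1+ c ] _ (ℕ.s≤s c<u) = inj₂ (subst (λ z → ∣ z ∣ ℕ.< suc u) (sym (ℤₚ.⊖-≤ (ℕ.s≤s (ℕₚ.<⇒≤ c<u))))
  (subst (ℕ._< suc u) (sym (ℤₚ.∣-i∣≡∣i∣ (+ (u ℕ.∸ c)))) (ℕ.s≤s (ℕₚ.m∸n≤m u c))))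

isPos-square-* : ∀ a u → a ≢ 0ℤ → isPos (a * a * u) ≡ isPos u
isPos-square-* (+ zero) u a≢0 = ⊥-elim (a≢0 refl)
isPos-square-* (+ suc a) (+ zero) _ = cong isPos (ℤₚ.*-zeroʳ (+ suc a * + suc a))
isPos-square-* (+ suc a) (+ suc u) _ = refl
isPos-square-* (+ suc a) -[1+ u ] _ = refl
isPos-square-* -[1+ a ] (+ zero) _ = cong isPos (ℤₚ.*-zeroʳ (-[1+ a ] * -[1+ a ]))
isPos-square-* -[1+ a ] (+ suc u) _ = refl
isPos-square-* -[1+ a ] -[1+ u ] _ = refl

Form : ℕ → Set
Form zero    = ℤ
Form (suc k) = ℤ × Form k

eval : ∀ {k} → Form k → Vector ℤ k → ℤ
eval {zero}  c       v = c
eval {suc k} (a , l) v = a * v zero + eval l (v ∘ suc)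

const : ∀ k → ℤ → Form k
const zero    c = c
const (suc k) c = 0ℤ , const k c

coord : ∀ {k} → Fin k → Form k
coord {suc k} zero    = 1ℤ , const k 0ℤ
coord {suc k} (suc i) = 0ℤ , coord i

infixl 6 _⊞_
infixl 7 _⊡_

_⊞_ : ∀ {k} → Form k → Form k → Form k
_⊞_ {zero}  c       d       = c + d
_⊞_ {suc k} (a , l) (b , r) = a + b , l ⊞ r

_⊡_ : ∀ {k} → ℤ → Form k → Form k
_⊡_ {zero}  c d       = c * d
_⊡_ {suc k} c (b , r) = c * b , c ⊡ r

eval-cong : ∀ {k} (l : Form k) {v w} → (∀ i → v i ≡ w i) → eval l v ≡ eval l w
eval-cong {zero}  l       e = refl
eval-cong {suc k} (a , l) e = cong₂ _+_ (cong (a *_) (e zero)) (eval-cong l (e ∘ suc))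

eval-const : ∀ k c v → eval (const k c) v ≡ c
eval-const zero    c v = refl
eval-const (suc k) c v = trans (cong₂ _+_ (ℤₚ.*-zeroˡ (v zero)) (eval-const k c (v ∘ suc))) (ℤₚ.+-identityˡ c)

eval-coord : ∀ {k} (i : Fin k) v → eval (coord i) v ≡ v i
eval-coord {suc k} zero    v = trans (cong₂ _+_ (ℤₚ.*-identityˡ (v zero)) (eval-const k 0ℤ (v ∘ suc))) (ℤₚ.+-identityʳ _)
eval-coord {suc k} (suc i) v = trans (cong₂ _+_ (ℤₚ.*-zeroˡ (v zero)) (eval-coord i (v ∘ suc))) (ℤₚ.+-identityˡ _)

eval-⊞ : ∀ {k} (l r : Form k) v → eval (l ⊞ r) v ≡ eval l v + eval r v
eval-⊞ {zero}  l r v = refl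
eval-⊞ {suc k} (a , l) (b , r) v = trans (cong (λ z → (a + b) * v zero + z) (eval-⊞ l r (v ∘ suc)))
  (lemma a b (v zero) (eval l (v ∘ suc)) (eval r (v ∘ suc)))
  where
  lemma : ∀ a b x s t → (a + b) * x + (s + t) ≡ a * x + s + (b * x + t)
  lemma = solve-∀

eval-⊡ : ∀ {k} c (l : Form k) v → eval (c ⊡ l) v ≡ c * eval l v
eval-⊡ {zero}  c l v = refl
eval-⊡ {suc k} c (a , l) v = trans (cong (λ z → c * a * v zero + z) (eval-⊡ c l (v ∘ suc)))
  (lemma c a (v zero) (eval l (v ∘ suc)))
  where
  lemma : ∀ c a x s → c * a * x + c * s ≡ c * (a * x + s)
  lemma = solve-∀

eval-cong-mod : ∀ {k} d (l : Form k) v w → (∀ i → d ℤˢ.∣ (v i - w i)) → d ℤˢ.∣ (eval l v - eval l w)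
eval-cong-mod {zero} d l v w _ = divides 0ℤ (trans (ℤₚ.+-inverseʳ l) (sym (ℤₚ.*-zeroˡ d)))
eval-cong-mod {suc k} d (a , l) v w h = subst (d ℤˢ.∣_) (lemma a (v zero) (w zero) (eval l (v ∘ suc)) (eval l (w ∘ suc)))
  (ℤˢ.∣m∣n⇒∣m+n (ℤˢ.∣n⇒∣m*n a (h zero)) (eval-cong-mod d l (v ∘ suc) (w ∘ suc) (h ∘ suc)))
  where
  lemma : ∀ a x y s t → a * (x - y) + (s - t) ≡ a * x + s - (a * y + t)
  lemma = solve-∀

-- Only strict positivity of a form is recorded. Where vanishing matters, as for equations, the form
-- and its negative are both listed.
record SameCell {k} (Λ : List (Form k)) (m : ℕ) (v w : Vector ℤ k) : Set where
  constructor cell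
  field
    signs    : ∀ {l} → l ∈ Λ → isPos (eval l v) ≡ isPos (eval l w)
    residues : ∀ i → (+ m) ℤˢ.∣ (v i - w i)

open SameCell

SameCell-sym : ∀ {k Λ m} {v w : Vector ℤ k} → SameCell Λ m v w → SameCell Λ m w v
SameCell-sym {v = v} {w} (cell s r) = cell (λ p → sym (s p)) λ i → subst (_ ℤˢ.∣_) (lemma (v i) (w i)) (ℤˢ.∣m⇒∣-m (r i))
  where
  lemma : ∀ x y → - (x - y) ≡ y - x
  lemma = solve-∀

SameCell-trans : ∀ {k Λ m} {u v w : Vector ℤ k} → SameCell Λ m u v → SameCell Λ m v w → SameCell Λ m u w
SameCell-trans {u = u} {v} {w} (cell s r) (cell s′ r′) = cell (λ p → trans (s p) (s′ p))
  λ i → subst (_ ℤˢ.∣_) (lemma (u i) (v i) (w i)) (ℤˢ.∣m∣n⇒∣m+n (r i) (r′ i))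
  where
  lemma : ∀ x y z → x - y + (y - z) ≡ x - z
  lemma = solve-∀

private
  ∣-self : ∀ (m : ℤ) x → m ℤˢ.∣ (x - x)
  ∣-self m x = divides 0ℤ (trans (ℤₚ.+-inverseʳ x) (sym (ℤₚ.*-zeroˡ m)))

SameCell-refl : ∀ {k Λ m} {v w : Vector ℤ k} → (∀ i → v i ≡ w i) → SameCell Λ m v w
SameCell-refl {w = w} e = cell (λ {l} _ → cong isPos (eval-cong l e))
  λ i → subst (λ z → _ ℤˢ.∣ (z - w i)) (sym (e i)) (∣-self _ (w i))

-- Multiplied out by the leading coefficient, this says that the first coordinate is within m of the
-- root of `l` in that coordinate.
NearRoot : ∀ {k} → ℕ → Form (suc k) → Vector ℤ (suc k) → Set
NearRoot m l v = proj₁ l ≢ 0ℤ × ∣ eval l v ∣ ℕ.≤ ∣ proj₁ l ∣ ℕ.* m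

nearRoot? : ∀ {k} m (l : Form (suc k)) v → Dec (NearRoot m l v)
nearRoot? m l v = ¬? (proj₁ l ℤₚ.≟ 0ℤ) ×-dec (∣ eval l v ∣ ℕ.≤? ∣ proj₁ l ∣ ℕ.* m)

abs≢0 : ∀ {a} → a ≢ 0ℤ → 0 ℕ.< ∣ a ∣
abs≢0 {+ zero}   h = ⊥-elim (h refl)
abs≢0 {+ suc a}  h = ℕ.s≤s ℕ.z≤n
abs≢0 { -[1+ a ]} h = ℕ.s≤s ℕ.z≤n

private
  -- A move by m changes a form with leading coefficient a by ∣a∣ m, too little to alter its sign
  -- unless a root is near; residues modulo m stay the same.
  step : ∀ {k} (Λ : List (Form (suc k))) m (v : Vector ℤ k) x (d : ℤ) → ∣ d ∣ ≡ m →
         ¬ Any (λ l → NearRoot m l (x ◂ v)) Λ → SameCell Λ m (x ◂ v) (x + d ◂ v)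
  step Λ m v x d ∣d∣≡m ¬near = cell signs′ residues′
    where
    assoc′ : ∀ a x d e → a * x + e + a * d ≡ a * (x + d) + e
    assoc′ = solve-∀
    signs′ : ∀ {l} → l ∈ Λ → isPos (eval l (x ◂ v)) ≡ isPos (eval l (x + d ◂ v))
    signs′ {a , l} l∈Λ with a ℤₚ.≟ 0ℤ
    ... | yes refl = cong isPos (cong (_+ eval l v) (trans (ℤₚ.*-zeroˡ x) (sym (ℤₚ.*-zeroˡ (x + d)))))
    ... | no a≢0 = sym (trans (cong isPos (sym (assoc′ a x d (eval l v))))
        (isPos-+ (a * x + eval l v) (a * d) (subst (ℕ._< ∣ a * x + eval l v ∣) (sym (trans (ℤₚ.abs-* a d) (cong (∣ a ∣ ℕ.*_) ∣d∣≡m)))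
           (ℕₚ.≰⇒> λ le → ¬near (lose l∈Λ (a≢0 , le))))))
    cancel : ∀ x d → x - (x + d) ≡ - d
    cancel = solve-∀
    residues′ : ∀ i → (+ m) ℤˢ.∣ ((x ◂ v) i - (x + d ◂ v) i)
    residues′ zero = subst ((+ m) ℤˢ.∣_) (sym (cancel x d)) (ℤˢ.∣m⇒∣-m (∣ᵤ⇒∣ (ℕᵈ.∣-reflexive (sym ∣d∣≡m))))
    residues′ (suc i) = ∣-self (+ m) (v i)

-- Walk from x towards the root of l in steps of m: nothing changes before the root of some form is near.
approach : ∀ {k} (Λ : List (Form (suc k))) m .{{_ : ℕ.NonZero m}} (v : Vector ℤ k) {l} → l ∈ Λ → proj₁ l ≢ 0ℤ → ∀ x →
           ∃ λ x′ → SameCell Λ m (x ◂ v) (x′ ◂ v) × Any (λ l → NearRoot m l (x′ ◂ v)) Λ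
approach Λ m v {a , l} l∈Λ a≢0 x = go x (<-wellFounded ∣ eval (a , l) (x ◂ v) ∣)
  where
  f : ℤ → ℤ
  f x = a * x + eval l v
  c≡ : ∣ a * + m ∣ ≡ ∣ a ∣ ℕ.* m
  c≡ = ℤₚ.abs-* a (+ m)
  plus : ∀ a x m e → a * x + e + a * m ≡ a * (x + m) + e
  plus = solve-∀
  minus : ∀ a x m e → a * x + e - a * m ≡ a * (x + - m) + e
  minus = solve-∀
  go : ∀ x → Acc ℕ._<_ ∣ f x ∣ →
       ∃ λ x′ → SameCell Λ m (x ◂ v) (x′ ◂ v) × Any (λ l → NearRoot m l (x′ ◂ v)) Λ
  go x (acc rec) with any? (λ l → nearRoot? m l (x ◂ v)) Λ
  ... | yes near = x , SameCell-refl (λ _ → refl) , near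
  ... | no ¬near with shrink (f x) (a * + m) (subst (0 ℕ.<_) (sym c≡) (ℕₚ.*-mono-< (abs≢0 a≢0) (ℕ.>-nonZero⁻¹ m)))
                        (subst (ℕ._< ∣ f x ∣) (sym c≡) (ℕₚ.≰⇒> λ le → ¬near (lose l∈Λ (a≢0 , le))))
  ... | inj₁ lt with go (x + + m) (rec (subst (λ z → ∣ z ∣ ℕ.< ∣ f x ∣) (plus a x (+ m) (eval l v)) lt))
  ...   | x′ , same , near = x′ , SameCell-trans (step Λ m v x (+ m) refl ¬near) same , near
  go x (acc rec) | no ¬near | inj₂ lt with go (x + - (+ m)) (rec (subst (λ z → ∣ z ∣ ℕ.< ∣ f x ∣) (minus a x (+ m) (eval l v)) lt))
  ...   | x′ , same , near = x′ , SameCell-trans (step Λ m v x (- (+ m)) (ℤₚ.∣-i∣≡∣i∣ (+ m)) ¬near) same , near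

range : ℕ → List ℤ
range n = List.map +_ (List.upTo (suc n)) List.++ List.map (-_ ∘ +_) (List.upTo (suc n))

∈-range : ∀ {n} z → ∣ z ∣ ℕ.≤ n → z ∈ range n
∈-range (+ i) le = ∈-++⁺ˡ (∈-map⁺ +_ (∈-upTo⁺ (ℕ.s≤s le)))
∈-range {n} -[1+ i ] le = ∈-++⁺ʳ (List.map +_ (List.upTo (suc n))) (∈-map⁺ (-_ ∘ +_) (∈-upTo⁺ (ℕ.s≤s le)))

∈⇒≤sum : ∀ {A : Set} (f : A → ℕ) {x xs} → x ∈ xs → f x ℕ.≤ sum (List.map f xs)
∈⇒≤sum f (here refl) = ℕₚ.m≤m+n _ _
∈⇒≤sum f (there p)   = ℕₚ.≤-trans (∈⇒≤sum f p) (ℕₚ.m≤n+m _ _)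

-- Zero coefficients count as 1, so that the product over all forms is nonzero and still divisible
-- by every nonzero leading coefficient.
headWeight : ∀ {k} → Form (suc k) → ℕ
headWeight (+ zero , _) = 1
headWeight (a      , _) = ∣ a ∣

headWeight-abs : ∀ {k} (l : Form (suc k)) → proj₁ l ≢ 0ℤ → headWeight l ≡ ∣ proj₁ l ∣
headWeight-abs (+ zero , _)   a≢0 = ⊥-elim (a≢0 refl)
headWeight-abs (+ suc a , _)  a≢0 = refl
headWeight-abs (-[1+ a ] , _) a≢0 = refl

product-nonZero : ∀ {k} (Λ : List (Form (suc k))) → ℕ.NonZero (product (List.map headWeight Λ))
product-nonZero []                  = _
product-nonZero ((+ zero , l) ∷ Λ)   = ℕₚ.m*n≢0 1 _ {{_}} {{product-nonZero Λ}}
product-nonZero ((+ suc a , l) ∷ Λ)  = ℕₚ.m*n≢0 (suc a) _ {{_}} {{product-nonZero Λ}}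
product-nonZero ((-[1+ a ] , l) ∷ Λ) = ℕₚ.m*n≢0 (suc a) _ {{_}} {{product-nonZero Λ}}

∈⇒∣product-map : ∀ {A : Set} (f : A → ℕ) {x xs} → x ∈ xs → f x ℕᵈ.∣ product (List.map f xs)
∈⇒∣product-map f {xs = _ ∷ xs} (here refl) = ℕᵈ.m∣m*n (product (List.map f xs))
∈⇒∣product-map f {xs = y ∷ _} (there p) = ℕᵈ.∣n⇒∣m*n (f y) (∈⇒∣product-map f p)

-- Congruence to this modulus makes the tail of each sloped form agree modulo a m, so a root can be
-- moved along with the parameters by a multiple of m.
projModulus : ∀ {k} → List (Form (suc k)) → ℕ → ℕ
projModulus Λ m = product (List.map headWeight Λ) ℕ.* m

-- a² (b x + r) rewritten along a x + l = e; the square does not affect the sign.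
cross : ∀ {k} → Form (suc k) → ℤ → Form (suc k) → Form k
cross {k} (a , l) e (b , r) = a ⊡ (a ⊡ r ⊞ (- b) ⊡ l ⊞ const k (b * e))

eval-cross : ∀ {k} ((a , l) : Form (suc k)) e ((b , r) : Form (suc k)) x v → eval (a , l) (x ◂ v) ≡ e →
             eval (cross (a , l) e (b , r)) v ≡ a * a * eval (b , r) (x ◂ v)
eval-cross {k} (a , l) e (b , r) x v refl = begin
  eval (a ⊡ (a ⊡ r ⊞ (- b) ⊡ l ⊞ const k (b * e))) v
    ≡⟨ eval-⊡ a (a ⊡ r ⊞ (- b) ⊡ l ⊞ const k (b * e)) v ⟩
  a * eval (a ⊡ r ⊞ (- b) ⊡ l ⊞ const k (b * e)) v
    ≡⟨ cong (a *_) (trans (eval-⊞ (a ⊡ r ⊞ (- b) ⊡ l) (const k (b * e)) v)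
         (cong₂ _+_ (trans (eval-⊞ (a ⊡ r) ((- b) ⊡ l) v) (cong₂ _+_ (eval-⊡ a r v) (eval-⊡ (- b) l v))) (eval-const k (b * e) v))) ⟩
  a * (a * eval r v + (- b) * eval l v + b * (a * x + eval l v))
    ≡⟨ lemma a b x (eval l v) (eval r v) ⟩
  a * a * (b * x + eval r v) ∎
  where
  open ≡-Reasoning
  lemma : ∀ a b x s t → a * (a * t + (- b) * s + b * (a * x + s)) ≡ a * a * (b * x + t)
  lemma = solve-∀

-- The tails serve the forms that do not involve the eliminated variable. The cross forms give the
-- signs of all forms at the test points, the solutions of l = e for the finitely many values e that
-- occur near a root of l.
projForms : ∀ {k} → List (Form (suc k)) → ℕ → List (Form k)
projForms Λ m = List.map proj₂ Λ List.++
  List.concatMap (λ l → List.concatMap (λ e → List.map (cross l e) Λ) (range (∣ proj₁ l ∣ ℕ.* m))) Λ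

∈-tail : ∀ {k} {Λ : List (Form (suc k))} {m l} → l ∈ Λ → proj₂ l ∈ projForms Λ m
∈-tail l∈Λ = ∈-++⁺ˡ (∈-map⁺ proj₂ l∈Λ)

∈-cross : ∀ {k} {Λ : List (Form (suc k))} {m l r e} → l ∈ Λ → r ∈ Λ → ∣ e ∣ ℕ.≤ ∣ proj₁ l ∣ ℕ.* m → cross l e r ∈ projForms Λ m
∈-cross {Λ = Λ} {m} {l} {r} {e} l∈Λ r∈Λ le = ∈-++⁺ʳ (List.map proj₂ Λ)
  (∈-concatMap⁺ (λ l → List.concatMap (λ e → List.map (cross l e) Λ) (range (∣ proj₁ l ∣ ℕ.* m)))
    (lose l∈Λ (∈-concatMap⁺ (λ e → List.map (cross l e) Λ) (lose (∈-range e le) (∈-map⁺ (cross l e) r∈Λ)))))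

-- Without sloped forms `x` itself works. Otherwise `x` is first moved, inside its cell, to a point
-- x′ near a root of some l. With e the value of l there, y is the point at which l takes the value
-- e over `w`; it is an integer congruent to x′ modulo m by the choice of modulus. The cross forms
-- then compare all the signs.
back-and-forth : ∀ {k} (Λ : List (Form (suc k))) m .{{_ : ℕ.NonZero m}} {v w} →
                 SameCell (projForms Λ m) (projModulus Λ m) v w → ∀ x → ∃ λ y → SameCell Λ m (x ◂ v) (y ◂ w)
back-and-forth Λ m {v} {w} same x with any? (λ l → ¬? (proj₁ l ℤₚ.≟ 0ℤ)) Λ
... | no flat = x , cell signs′ residues′
  where
  signs′ : ∀ {l} → l ∈ Λ → isPos (eval l (x ◂ v)) ≡ isPos (eval l (x ◂ w))
  signs′ {a , l} l∈Λ with a ℤₚ.≟ 0ℤ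
  ... | no a≢0 = ⊥-elim (flat (lose l∈Λ a≢0))
  ... | yes refl = trans (cong isPos (drop (eval l v))) (trans (signs same (∈-tail l∈Λ)) (sym (cong isPos (drop (eval l w)))))
    where
    drop : ∀ z → 0ℤ * x + z ≡ z
    drop z = trans (cong (_+ z) (ℤₚ.*-zeroˡ x)) (ℤₚ.+-identityˡ z)
  residues′ : ∀ i → (+ m) ℤˢ.∣ ((x ◂ v) i - (x ◂ w) i)
  residues′ zero    = ∣-self (+ m) x
  residues′ (suc i) = ℤˢ.∣-trans (∣ᵤ⇒∣ (ℕᵈ.n∣m*n (product (List.map headWeight Λ)))) (residues same i)
... | yes sloped with find sloped
... | l₀ , l₀∈Λ , a₀≢0 with approach Λ m v l₀∈Λ a₀≢0 x
... | x′ , x~x′ , near with find near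
... | (a , l) , l∈Λ , a≢0 , le = y , SameCell-trans x~x′ (cell signs′ residues′)
  where
  e : ℤ
  e = a * x′ + eval l v
  am∣ : (a * + m) ℤˢ.∣ (eval l v - eval l w)
  am∣ = eval-cong-mod (a * + m) l v w λ i → ℤˢ.∣-trans (∣ᵤ⇒∣ (subst₂ ℕᵈ._∣_
      (trans (cong (ℕ._* m) (headWeight-abs (a , l) a≢0)) (sym (ℤₚ.abs-* a (+ m)))) refl
      (ℕᵈ.*-monoˡ-∣ m (∈⇒∣product-map headWeight l∈Λ)))) (residues same i)
  q y : ℤ
  q = ℤˢ._∣_.quotient am∣
  y = x′ + q * + m
  e≡ : eval (a , l) (y ◂ w) ≡ e
  e≡ = begin
    a * (x′ + q * + m) + eval l w       ≡⟨ lemma a x′ q (+ m) (eval l w) ⟩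
    a * x′ + (q * (a * + m) + eval l w) ≡⟨ cong (λ z → a * x′ + (z + eval l w)) (sym (ℤˢ._∣_.equality am∣)) ⟩
    a * x′ + (eval l v - eval l w + eval l w) ≡⟨ cong (λ z → a * x′ + z) (lemma₂ (eval l v) (eval l w)) ⟩
    e ∎
    where
    open ≡-Reasoning
    lemma : ∀ a x q m s → a * (x + q * m) + s ≡ a * x + (q * (a * m) + s)
    lemma = solve-∀
    lemma₂ : ∀ s t → s - t + t ≡ s
    lemma₂ = solve-∀
  signs′ : ∀ {r} → r ∈ Λ → isPos (eval r (x′ ◂ v)) ≡ isPos (eval r (y ◂ w))
  signs′ {r} r∈Λ = begin
    isPos (eval r (x′ ◂ v))             ≡⟨ isPos-square-* a _ a≢0 ⟨
    isPos (a * a * eval r (x′ ◂ v))     ≡⟨ cong isPos (eval-cross (a , l) e r x′ v refl) ⟨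
    isPos (eval (cross (a , l) e r) v)  ≡⟨ signs same (∈-cross l∈Λ r∈Λ le) ⟩
    isPos (eval (cross (a , l) e r) w)  ≡⟨ cong isPos (eval-cross (a , l) e r y w e≡) ⟩
    isPos (a * a * eval r (y ◂ w))      ≡⟨ isPos-square-* a _ a≢0 ⟩
    isPos (eval r (y ◂ w))              ∎
    where open ≡-Reasoning
  residues′ : ∀ i → (+ m) ℤˢ.∣ ((x′ ◂ v) i - (y ◂ w) i)
  residues′ zero    = divides (- q) (lemma x′ q (+ m))
    where
    lemma : ∀ x q m → x - (x + q * m) ≡ - q * m
    lemma = solve-∀
  residues′ (suc i) = ℤˢ.∣-trans (∣ᵤ⇒∣ (ℕᵈ.n∣m*n (product (List.map headWeight Λ)))) (residues same i)

searchBound : ∀ {k} → List (Form (suc k)) → ℕ → Vector ℤ k → ℕ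
searchBound Λ m v = m ℕ.+ sum (List.map (λ l → ∣ proj₁ l ∣ ℕ.* m ℕ.+ ∣ eval (proj₂ l) v ∣) Λ)

-- The point near a root reached by `approach` is bounded in terms of `v`, so quantifiers over ℤ are
-- decided by a finite search.
representative : ∀ {k} (Λ : List (Form (suc k))) m .{{_ : ℕ.NonZero m}} v x →
                 ∃ λ x′ → ∣ x′ ∣ ℕ.≤ searchBound Λ m v × SameCell Λ m (x ◂ v) (x′ ◂ v)
representative Λ m v x with any? (λ l → ¬? (proj₁ l ℤₚ.≟ 0ℤ)) Λ
... | no flat = + (x %ℕ m) , ℕₚ.≤-trans (ℕₚ.<⇒≤ (n%ℕd<d x m)) (ℕₚ.m≤m+n m _) , cell signs′ residues′
  where
  signs′ : ∀ {l} → l ∈ Λ → isPos (eval l (x ◂ v)) ≡ isPos (eval l (+ (x %ℕ m) ◂ v))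
  signs′ {a , l} l∈Λ with a ℤₚ.≟ 0ℤ
  ... | no a≢0 = ⊥-elim (flat (lose l∈Λ a≢0))
  ... | yes refl = cong (λ z → isPos (z + eval l v)) (trans (ℤₚ.*-zeroˡ x) (sym (ℤₚ.*-zeroˡ (+ (x %ℕ m)))))
  residues′ : ∀ i → (+ m) ℤˢ.∣ ((x ◂ v) i - (+ (x %ℕ m) ◂ v) i)
  residues′ zero    = divides (x /ℕ m) (trans (cong (_- + (x %ℕ m)) (a≡a%ℕn+[a/ℕn]*n x m)) (lemma (+ (x %ℕ m)) (x /ℕ m * + m)))
    where
    lemma : ∀ s t → s + t - s ≡ t
    lemma = solve-∀
  residues′ (suc i) = ∣-self (+ m) (v i)
... | yes sloped with find sloped
... | l₀ , l₀∈Λ , a₀≢0 with approach Λ m v l₀∈Λ a₀≢0 x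
... | x′ , x~x′ , near with find near
... | (a , l) , l∈Λ , a≢0 , le = x′ , bound , x~x′
  where
  open ℕₚ.≤-Reasoning
  lemma : ∀ s t → s + t - t ≡ s
  lemma = solve-∀
  bound : ∣ x′ ∣ ℕ.≤ searchBound Λ m v
  bound = begin
    ∣ x′ ∣             ≤⟨ ℕₚ.m≤n*m ∣ x′ ∣ ∣ a ∣ {{ℕ.>-nonZero (abs≢0 a≢0)}} ⟩
    ∣ a ∣ ℕ.* ∣ x′ ∣    ≡⟨ ℤₚ.abs-* a x′ ⟨
    ∣ a * x′ ∣          ≡⟨ cong ∣_∣ (lemma (a * x′) (eval l v)) ⟨
    ∣ a * x′ + eval l v - eval l v ∣ ≤⟨ ℤₚ.∣i-j∣≤∣i∣+∣j∣ (a * x′ + eval l v) (eval l v) ⟩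
    ∣ a * x′ + eval l v ∣ ℕ.+ ∣ eval l v ∣ ≤⟨ ℕₚ.+-monoˡ-≤ _ le ⟩
    ∣ a ∣ ℕ.* m ℕ.+ ∣ eval l v ∣ ≤⟨ ∈⇒≤sum _ l∈Λ ⟩
    sum (List.map (λ l → ∣ proj₁ l ∣ ℕ.* m ℕ.+ ∣ eval (proj₂ l) v ∣) Λ) ≤⟨ ℕₚ.m≤n+m _ m ⟩
    searchBound Λ m v ∎

-- The outcome of quantifier elimination, stated semantically: P is a decidable union of cells.
record Presburger {k} (P : Vector ℤ k → Set) : Set where
  field
    forms       : List (Form k)
    modulus     : ℕ
    modulus≢0   : ℕ.NonZero modulus
    invariant   : ∀ {v w} → SameCell forms modulus v w → P v → P w
    decide      : ∀ v → Dec (P v)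

open Presburger

SameCell-weaken : ∀ {k} {Λ Λ′ : List (Form k)} {m m′ v w} → (∀ {l} → l ∈ Λ → l ∈ Λ′) → m ℕᵈ.∣ m′ →
                  SameCell Λ′ m′ v w → SameCell Λ m v w
SameCell-weaken sub m∣m′ (cell s r) = cell (s ∘ sub) λ i → ℤˢ.∣-trans (∣ᵤ⇒∣ m∣m′) (r i)

module _ {k} {P Q : Vector ℤ k → Set} (𝒫 : Presburger P) (𝒬 : Presburger Q) where
  private
    Λ = forms 𝒫 List.++ forms 𝒬
    m = modulus 𝒫 ℕ.* modulus 𝒬
    left : ∀ {v w} → SameCell Λ m v w → SameCell (forms 𝒫) (modulus 𝒫) v w
    left = SameCell-weaken ∈-++⁺ˡ (ℕᵈ.m∣m*n (modulus 𝒬))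
    right : ∀ {v w} → SameCell Λ m v w → SameCell (forms 𝒬) (modulus 𝒬) v w
    right = SameCell-weaken (∈-++⁺ʳ (forms 𝒫)) (ℕᵈ.n∣m*n (modulus 𝒫))
    connective : {R : Vector ℤ k → Set} → (∀ {v w} → SameCell Λ m v w → R v → R w) → (∀ v → Dec (R v)) → Presburger R
    connective inv dec = record
      { forms = Λ ; modulus = m ; modulus≢0 = ℕₚ.m*n≢0 _ _ {{modulus≢0 𝒫}} {{modulus≢0 𝒬}}
      ; invariant = inv ; decide = dec }

  and-presburger : Presburger (λ v → P v × Q v)
  and-presburger = connective (λ s (p , q) → invariant 𝒫 (left s) p , invariant 𝒬 (right s) q)
    λ v → decide 𝒫 v ×-dec decide 𝒬 v

  or-presburger : Presburger (λ v → P v ⊎ Q v)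
  or-presburger = connective (λ s → Sum.map (invariant 𝒫 (left s)) (invariant 𝒬 (right s)))
    λ v → decide 𝒫 v ⊎-dec decide 𝒬 v

  implies-presburger : Presburger (λ v → P v → Q v)
  implies-presburger = connective
    (λ s f p → invariant 𝒬 (right s) (f (invariant 𝒫 (left (SameCell-sym s)) p)))
    λ v → decide 𝒫 v →-dec decide 𝒬 v

module _ {k} {P : Vector ℤ (suc k) → Set} (𝒫 : Presburger P) where
  private
    instance
      _ = modulus≢0 𝒫
    candidates : Vector ℤ k → List ℤ
    candidates v = range (searchBound (forms 𝒫) (modulus 𝒫) v)
    project : {R : Vector ℤ k → Set} →
      (∀ {v w} → (∀ x → ∃ λ y → SameCell (forms 𝒫) (modulus 𝒫) (x ◂ v) (y ◂ w)) →
                 (∀ x → ∃ λ y → SameCell (forms 𝒫) (modulus 𝒫) (x ◂ w) (y ◂ v)) → R v → R w) →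
      (∀ v → Dec (R v)) → Presburger R
    project inv dec = record
      { forms = projForms (forms 𝒫) (modulus 𝒫)
      ; modulus = projModulus (forms 𝒫) (modulus 𝒫)
      ; modulus≢0 = ℕₚ.m*n≢0 _ _ {{product-nonZero (forms 𝒫)}}
      ; invariant = λ s → inv (back-and-forth (forms 𝒫) (modulus 𝒫) s) (back-and-forth (forms 𝒫) (modulus 𝒫) (SameCell-sym s))
      ; decide = dec }

  ∃-presburger : Presburger (λ v → ∃ λ x → P (x ◂ v))
  ∃-presburger = project (λ forth _ (x , p) → proj₁ (forth x) , invariant 𝒫 (proj₂ (forth x)) p)
    λ v → map′ (λ p → let x , _ , px = find p in x , px)
               (λ (x , p) → let x′ , le , s = representative (forms 𝒫) (modulus 𝒫) v x in
                  lose (∈-range x′ le) (invariant 𝒫 s p))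
               (any? (λ x → decide 𝒫 (x ◂ v)) (candidates v))

  ∀-presburger : Presburger (λ v → ∀ x → P (x ◂ v))
  ∀-presburger = project (λ _ back f y → invariant 𝒫 (SameCell-sym (proj₂ (back y))) (f (proj₁ (back y))))
    λ v → map′ (λ f x → let x′ , le , s = representative (forms 𝒫) (modulus 𝒫) v x in
                  invariant 𝒫 (SameCell-sym s) (All.lookup f (∈-range x′ le)))
               (λ f → All.tabulate λ {x} _ → f x)
               (All.all? (λ x → decide 𝒫 (x ◂ v)) (candidates v))

formOf : ∀ {k} → Term k → Form k
formOf (var i)      = coord i
formOf {k} zer      = const k 0ℤ
formOf {k} one      = const k 1ℤ
formOf (s ⊕ t)      = formOf s ⊞ formOf t
formOf (neg t)      = (- 1ℤ) ⊡ formOf t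

eval-formOf : ∀ {k} (t : Term k) v → eval (formOf t) v ≡ evalT ℤ-structure t v
eval-formOf (var i) v = eval-coord i v
eval-formOf {k} zer v = eval-const k 0ℤ v
eval-formOf {k} one v = eval-const k 1ℤ v
eval-formOf (s ⊕ t) v = trans (eval-⊞ (formOf s) (formOf t) v) (cong₂ _+_ (eval-formOf s v) (eval-formOf t v))
eval-formOf (neg t) v = trans (eval-⊡ (- 1ℤ) (formOf t) v) (trans (ℤₚ.-1*i≡-i _) (cong -_ (eval-formOf t v)))

0<⇒isPos : ∀ {z} → 0ℤ < z → isPos z ≡ true
0<⇒isPos (+<+ (ℕ.s≤s _)) = refl

isPos⇒0< : ∀ z → isPos z ≡ true → 0ℤ < z
isPos⇒0< (+ suc n) _ = +<+ (ℕ.s≤s ℕ.z≤n)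

non-positive : ∀ z → isPos z ≡ false → isPos (- z) ≡ false → z ≡ 0ℤ
non-positive (+ zero) _ _ = refl

difference : ∀ {k} → Term k → Term k → Form k
difference s t = formOf s ⊞ (- 1ℤ) ⊡ formOf t

eval-difference : ∀ {k} (s t : Term k) v → eval (difference s t) v ≡ evalT ℤ-structure s v - evalT ℤ-structure t v
eval-difference s t v = trans (eval-⊞ (formOf s) ((- 1ℤ) ⊡ formOf t) v) (cong₂ _+_ (eval-formOf s v) (eval-formOf (neg t) v))

equality-presburger : ∀ {k} (s t : Term k) → Presburger (λ v → evalT ℤ-structure s v ≡ evalT ℤ-structure t v)
equality-presburger s t = record
  { forms = difference s t ∷ difference t s ∷ []
  ; modulus = 1
  ; modulus≢0 = _
  ; invariant = inv
  ; decide = λ v → evalT ℤ-structure s v ℤₚ.≟ evalT ℤ-structure t v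
  }
  where
  vanish : ∀ s t v → evalT ℤ-structure s v ≡ evalT ℤ-structure t v → isPos (eval (difference s t) v) ≡ false
  vanish s t v eq = cong isPos (trans (eval-difference s t v) (ℤₚ.i≡j⇒i-j≡0 eq))
  flip-sub : ∀ x y → y - x ≡ - (x - y)
  flip-sub = solve-∀
  inv : ∀ {v w} → SameCell (difference s t ∷ difference t s ∷ []) 1 v w →
        evalT ℤ-structure s v ≡ evalT ℤ-structure t v → evalT ℤ-structure s w ≡ evalT ℤ-structure t w
  inv {v} {w} same eq = ℤₚ.i-j≡0⇒i≡j _ _ (non-positive _
    (trans (cong isPos (sym (eval-difference s t w))) (trans (sym (signs same (here refl))) (vanish s t v eq)))
    (trans (cong isPos (sym (trans (eval-difference t s w) (flip-sub (evalT ℤ-structure s w) (evalT ℤ-structure t w)))))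
      (trans (sym (signs same (there (here refl)))) (vanish t s v (sym eq)))))

0<j-i⇒i<j : ∀ i j → 0ℤ < j - i → i < j
0<j-i⇒i<j i j lt = subst₂ _<_ (ℤₚ.+-identityˡ i) (lemma j i) (ℤₚ.+-monoˡ-< i lt)
  where
  lemma : ∀ x y → x - y + y ≡ x
  lemma = solve-∀

i<j⇒0<j-i : ∀ i j → i < j → 0ℤ < j - i
i<j⇒0<j-i i j lt = subst (_< j - i) (ℤₚ.+-inverseʳ i) (ℤₚ.+-monoˡ-< (- i) lt)

order-presburger : ∀ {k} (s t : Term k) → Presburger (λ v → evalT ℤ-structure s v < evalT ℤ-structure t v)
order-presburger s t = record
  { forms = difference t s ∷ []
  ; modulus = 1
  ; modulus≢0 = _
  ; invariant = λ {v} {w} same lt → 0<j-i⇒i<j _ _ (isPos⇒0< _ (trans (cong isPos (sym (eval-difference t s w)))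
      (trans (sym (signs same (here refl))) (trans (cong isPos (eval-difference t s v)) (0<⇒isPos (i<j⇒0<j-i _ _ lt))))))
  ; decide = λ v → evalT ℤ-structure s v ℤₚ.<? evalT ℤ-structure t v
  }

congruence-presburger : ∀ {k} n (s t : Term k) →
  Presburger (λ v → (+ n) ℤᵘ.∣ (evalT ℤ-structure s v - evalT ℤ-structure t v))
-- Cells require a nonzero modulus, so congruence modulo 0 is treated as the equality that it is.
congruence-presburger zero s t = record
  { forms = forms 𝒫 ; modulus = modulus 𝒫 ; modulus≢0 = modulus≢0 𝒫
  ; invariant = λ {v} {w} same d → from w (invariant 𝒫 same (to v d))
  ; decide = λ v → map′ (from v) (to v) (decide 𝒫 v) }
  where
  𝒫 = equality-presburger s t
  from : ∀ v → evalT ℤ-structure s v ≡ evalT ℤ-structure t v → (+ 0) ℤᵘ.∣ (evalT ℤ-structure s v - evalT ℤ-structure t v)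
  from v eq = ∣⇒∣ᵤ (subst ((+ 0) ℤˢ.∣_) (sym (ℤₚ.i≡j⇒i-j≡0 eq)) ℤˢ.∣-refl)
  to : ∀ v → (+ 0) ℤᵘ.∣ (evalT ℤ-structure s v - evalT ℤ-structure t v) → evalT ℤ-structure s v ≡ evalT ℤ-structure t v
  to v d = ℤₚ.i-j≡0⇒i≡j _ _ (ℤˢ.0∣⇒≡0 (∣ᵤ⇒∣ d))
congruence-presburger (suc n) s t = record
  { forms = []
  ; modulus = suc n
  ; modulus≢0 = _
  ; invariant = λ {v} {w} same d → ∣⇒∣ᵤ (subst ((+ suc n) ℤˢ.∣_)
      (trans (lemma (eval (difference s t) v) (eval (difference s t) w)) (eval-difference s t w))
      (ℤˢ.∣m∣n⇒∣m-n (subst ((+ suc n) ℤˢ.∣_) (sym (eval-difference s t v)) (∣ᵤ⇒∣ d)) (eval-cong-mod (+ suc n) (difference s t) v w (residues same))))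
  ; decide = λ v → suc n ℕᵈ.∣? ∣ evalT ℤ-structure s v - evalT ℤ-structure t v ∣
  }
  where
  lemma : ∀ x y → x - (x - y) ≡ y
  lemma = solve-∀

presburger : ∀ {k} (φ : Formula k) → Presburger (Sat ℤ-structure φ)
presburger (s ≐ t)       = equality-presburger s t
presburger (s ≺ t)       = order-presburger s t
presburger (congr n s t) = congruence-presburger n s t
presburger ⊥f            = record { forms = [] ; modulus = 1 ; modulus≢0 = _ ; invariant = λ _ () ; decide = λ _ → no λ () }
presburger (φ ∧f ψ)      = and-presburger (presburger φ) (presburger ψ)
presburger (φ ∨f ψ)      = or-presburger (presburger φ) (presburger ψ)
presburger (φ ⇒f ψ)      = implies-presburger (presburger φ) (presburger ψ)
presburger (∀f φ)        = ∀-presburger (presburger φ)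
presburger (∃f φ)        = ∃-presburger (presburger φ)

-- Near a root, a form takes one of finitely many values e. Subtracting e from its constant term
-- turns a point near the root into an exact zero.
near-forms solution-forms : ∀ {k} {P : Vector ℤ (suc k) → Set} → Presburger P → List (Form (suc k))
near-forms {k} 𝒫 = List.concatMap
  (λ l → List.map (λ e → proj₁ l , proj₂ l ⊞ const k (- e)) (range (∣ proj₁ l ∣ ℕ.* modulus 𝒫))) (forms 𝒫)
solution-forms 𝒫 = List.filter (λ l → ¬? (proj₁ l ℤₚ.≟ 0ℤ)) (near-forms 𝒫)

solution-forms-slope : ∀ {k} {P : Vector ℤ (suc k) → Set} (𝒫 : Presburger P) {l} → l ∈ solution-forms 𝒫 → proj₁ l ≢ 0ℤ
solution-forms-slope 𝒫 l∈ = proj₂ (∈-filter⁻ (λ l → ¬? (proj₁ l ℤₚ.≟ 0ℤ)) {xs = near-forms 𝒫} l∈)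

-- Away from all roots, z + modulus would be a second solution.
unique-solution : ∀ {k} {P : Vector ℤ (suc k) → Set} (𝒫 : Presburger P) z v →
  P (z ◂ v) → (∀ z′ → P (z′ ◂ v) → z′ ≡ z) → ∃ λ l → l ∈ solution-forms 𝒫 × eval l (z ◂ v) ≡ 0ℤ
unique-solution {k} 𝒫 z v p unique with any? (λ l → ¬? (proj₁ l ℤₚ.≟ 0ℤ)) (forms 𝒫)
... | no flat = ⊥-elim (ℕ.≢-nonZero⁻¹ (modulus 𝒫) {{modulus≢0 𝒫}} (ℤₚ.+-injective
      (+-cancelˡ z _ _ (trans (unique _ (invariant 𝒫 same p)) (sym (ℤₚ.+-identityʳ z))))))
  where
  same : SameCell (forms 𝒫) (modulus 𝒫) (z ◂ v) (z + + modulus 𝒫 ◂ v)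
  same = step (forms 𝒫) (modulus 𝒫) v z (+ modulus 𝒫) refl λ near →
    let _ , l∈ , a≢0 , _ = find near in flat (lose l∈ a≢0)
... | yes sloped with find sloped
... | l₀ , l₀∈ , a₀≢0 with approach (forms 𝒫) (modulus 𝒫) {{modulus≢0 𝒫}} v l₀∈ a₀≢0 z
... | z′ , same , near with unique z′ (invariant 𝒫 same p) | find near
... | refl | (a , l) , l∈ , a≢0 , le = _ ,
  ∈-filter⁺ (λ l → ¬? (proj₁ l ℤₚ.≟ 0ℤ)) (∈-concatMap⁺ (λ l → List.map (λ e → proj₁ l , proj₂ l ⊞ const k (- e)) (range (∣ proj₁ l ∣ ℕ.* modulus 𝒫))) (lose l∈
    (∈-map⁺ (λ e → a , l ⊞ const k (- e)) (∈-range (a * z + eval l v) le)))) a≢0 ,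
  trans (cong (λ u → a * z + u) (trans (eval-⊞ l (const k (- (a * z + eval l v))) v)
      (cong (λ u → eval l v + u) (eval-const k (- (a * z + eval l v)) v)))) (lemma (a * z) (eval l v))
  where
  lemma : ∀ x y → x + (y + - (x + y)) ≡ 0ℤ
  lemma = solve-∀

open Equivalence using (to; from)

-- Formulas with blocks of variables

lift : ∀ {k l} → (Fin k → Fin l) → Fin (suc k) → Fin (suc l)
lift σ zero    = zero
lift σ (suc i) = suc (σ i)

renameT : ∀ {k l} → (Fin k → Fin l) → Term k → Term l
renameT σ (var i) = var (σ i)
renameT σ zer     = zer
renameT σ one     = one
renameT σ (s ⊕ t) = renameT σ s ⊕ renameT σ t
renameT σ (neg t) = neg (renameT σ t)

rename : ∀ {k l} → (Fin k → Fin l) → Formula k → Formula l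
rename σ (s ≐ t)       = renameT σ s ≐ renameT σ t
rename σ (s ≺ t)       = renameT σ s ≺ renameT σ t
rename σ (congr n s t) = congr n (renameT σ s) (renameT σ t)
rename σ ⊥f            = ⊥f
rename σ (φ ∧f ψ)      = rename σ φ ∧f rename σ ψ
rename σ (φ ∨f ψ)      = rename σ φ ∨f rename σ ψ
rename σ (φ ⇒f ψ)      = rename σ φ ⇒f rename σ ψ
rename σ (∀f φ)        = ∀f (rename (lift σ) φ)
rename σ (∃f φ)        = ∃f (rename (lift σ) φ)

-- The positions of an n-tuple among k variables. Formulas about tuples are obtained by renaming
-- along concatenated blocks.
Block : ℕ → ℕ → Set
Block k n = Fin n → Fin k

fresh : ∀ {n k} → Block (n ℕ.+ k) n
fresh {n} {k} i = i ↑ˡ k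

wk : ∀ m {k n} → Block k n → Block (m ℕ.+ k) n
wk m σ i = m ↑ʳ σ i

infix 4 _≗ᵇ_
_≗ᵇ_ : ∀ {A : Set} {n} → Vector A n → Vector A n → Set
x ≗ᵇ y = ∀ i → x i ≡ y i

◂-cong : ∀ {A : Set} {n} (a : A) {x y : Vector A n} → x ≗ᵇ y → (a ◂ x) ≗ᵇ (a ◂ y)
◂-cong a e zero    = refl
◂-cong a e (suc i) = e i

⧺-cong : ∀ {A : Set} {m n} {x x′ : Vector A m} {y y′ : Vector A n} → x ≗ᵇ x′ → y ≗ᵇ y′ → (x ⧺ y) ≗ᵇ (x′ ⧺ y′)
⧺-cong {m = m} e f i with splitAt m i
... | inj₁ j = e j
... | inj₂ j = f j

⧺-∘ : ∀ {A B : Set} {m n} (f : A → B) (x : Vector A m) (y : Vector A n) → f ∘ (x ⧺ y) ≗ᵇ (f ∘ x) ⧺ (f ∘ y)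
⧺-∘ {m = m} f x y i with splitAt m i
... | inj₁ j = refl
... | inj₂ j = refl

⧺-◂ : ∀ {A : Set} {m n} (x : Vector A (suc m)) (y : Vector A n) → (x ⧺ y) ≗ᵇ (x zero ◂ (x ∘ suc ⧺ y))
⧺-◂         x y zero    = refl
⧺-◂ {m = m} x y (suc i) with splitAt m i
... | inj₁ j = refl
... | inj₂ j = refl

∀ⁿ ∃ⁿ : ∀ n {k} → Formula (n ℕ.+ k) → Formula k
∀ⁿ zero    φ = φ
∀ⁿ (suc n) φ = ∀ⁿ n (∀f φ)
∃ⁿ zero    φ = φ
∃ⁿ (suc n) φ = ∃ⁿ n (∃f φ)

⋀ ⋁ : ∀ {m k} → (Fin m → Formula k) → Formula k
⋀ {zero}  φ = ⊥f ⇒f ⊥f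
⋀ {suc m} φ = φ zero ∧f ⋀ (φ ∘ suc)
⋁ {zero}  φ = ⊥f
⋁ {suc m} φ = φ zero ∨f ⋁ (φ ∘ suc)

module Semantics (M : Structure) where
  open Structure M

  -- A record rather than a function type, so that ρ, σ and x can be inferred from it.
  infix 4 _⊢_⇝_
  record _⊢_⇝_ {k n} (ρ : Vector Carrier k) (σ : Block k n) (x : Vector Carrier n) : Set where
    constructor reads
    field at : ∀ i → ρ (σ i) ≡ x i

  open _⊢_⇝_ public

  evalT-rename : ∀ {k l} (σ : Fin k → Fin l) (t : Term k) {ρ ρ′} → ρ ⊢ σ ⇝ ρ′ → evalT M (renameT σ t) ρ ≡ evalT M t ρ′
  evalT-rename σ (var i) e = at e i
  evalT-rename σ zer     e = refl
  evalT-rename σ one     e = refl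
  evalT-rename σ (s ⊕ t) e = cong₂ plusS (evalT-rename σ s e) (evalT-rename σ t e)
  evalT-rename σ (neg t) e = cong negS (evalT-rename σ t e)

  lift-⇝ : ∀ {k l} {σ : Fin k → Fin l} {ρ ρ′} a → ρ ⊢ σ ⇝ ρ′ → (a ◂ ρ) ⊢ lift σ ⇝ (a ◂ ρ′)
  lift-⇝ a e = reads λ { zero → refl ; (suc i) → at e i }

  Sat-rename : ∀ {k l} (φ : Formula k) {σ : Fin k → Fin l} {ρ ρ′} → ρ ⊢ σ ⇝ ρ′ → Sat M (rename σ φ) ρ ⇔ Sat M φ ρ′
  Sat-rename (s ≐ t) {σ} e       = mk⇔ (subst₂ _≡_ (evalT-rename σ s e) (evalT-rename σ t e))
                                       (subst₂ _≡_ (sym (evalT-rename σ s e)) (sym (evalT-rename σ t e)))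
  Sat-rename (s ≺ t) {σ} e       = mk⇔ (subst₂ ltS (evalT-rename σ s e) (evalT-rename σ t e))
                                       (subst₂ ltS (sym (evalT-rename σ s e)) (sym (evalT-rename σ t e)))
  Sat-rename (congr n s t) {σ} e = mk⇔ (subst₂ (congS n) (evalT-rename σ s e) (evalT-rename σ t e))
                                       (subst₂ (congS n) (sym (evalT-rename σ s e)) (sym (evalT-rename σ t e)))
  Sat-rename ⊥f e                = mk⇔ id id
  Sat-rename (φ ∧f ψ) e          = mk⇔ (Prod.map (to (Sat-rename φ e)) (to (Sat-rename ψ e)))
                                       (Prod.map (from (Sat-rename φ e)) (from (Sat-rename ψ e)))
  Sat-rename (φ ∨f ψ) e          = mk⇔ (Sum.map (to (Sat-rename φ e)) (to (Sat-rename ψ e)))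
                                       (Sum.map (from (Sat-rename φ e)) (from (Sat-rename ψ e)))
  Sat-rename (φ ⇒f ψ) e          = mk⇔ (λ f p → to (Sat-rename ψ e) (f (from (Sat-rename φ e) p)))
                                       (λ f p → from (Sat-rename ψ e) (f (to (Sat-rename φ e) p)))
  Sat-rename (∀f φ) e            = mk⇔ (λ f a → to (Sat-rename φ (lift-⇝ a e)) (f a))
                                       (λ f a → from (Sat-rename φ (lift-⇝ a e)) (f a))
  Sat-rename (∃f φ) e            = mk⇔ (λ (a , p) → a , to (Sat-rename φ (lift-⇝ a e)) p)
                                       (λ (a , p) → a , from (Sat-rename φ (lift-⇝ a e)) p)

  -- Pointwise equal environments need not be identified. Both are compared with the single formula
  -- `rename id φ` at ρ, which reads as φ at ρ and also as φ at ρ′.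
  Sat-cong : ∀ {k} (φ : Formula k) {ρ ρ′} → ρ ≗ᵇ ρ′ → Sat M φ ρ → Sat M φ ρ′
  Sat-cong φ e p = to (Sat-rename φ {id} (reads e)) (from (Sat-rename φ {id} (reads λ _ → refl)) p)

  infix 3 _/_⟺_
  -- Such statements compose along the syntax, so the meaning of a long formula is assembled by a
  -- term that mirrors the formula.
  record _/_⟺_ {k} (φ : Formula k) (ρ : Vector Carrier k) (P : Set) : Set where
    constructor sem
    field
      out  : Sat M φ ρ → P
      into : P → Sat M φ ρ

  open _/_⟺_ public

  ∀ⁿ-sem : ∀ n {k} {φ : Formula (n ℕ.+ k)} {ρ} {P : Vector Carrier n → Set} →
           (∀ x → φ / (x ⧺ ρ) ⟺ P x) → (∀ⁿ n φ) / ρ ⟺ (∀ x → P x)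
  ∀ⁿ-sem n {φ = φ} {ρ} {P} h = sem (λ f x → out (h x) (to (go n φ) f x)) (λ f → from (go n φ) λ x → into (h x) (f x))
    where
    go : ∀ n (φ : Formula (n ℕ.+ _)) → Sat M (∀ⁿ n φ) ρ ⇔ (∀ x → Sat M φ (x ⧺ ρ))
    go zero    φ = mk⇔ (λ p _ → p) (λ f → f λ ())
    go (suc n) φ = mk⇔ (λ f x → Sat-cong φ (λ i → sym (⧺-◂ x ρ i)) (to (go n (∀f φ)) f (x ∘ suc) (x zero)))
                       (λ f → from (go n (∀f φ)) λ x a → Sat-cong φ (⧺-◂ (a ◂ x) ρ) (f (a ◂ x)))

  ∃ⁿ-sem : ∀ n {k} {φ : Formula (n ℕ.+ k)} {ρ} {P : Vector Carrier n → Set} →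
           (∀ x → φ / (x ⧺ ρ) ⟺ P x) → (∃ⁿ n φ) / ρ ⟺ (∃ λ x → P x)
  ∃ⁿ-sem n {φ = φ} {ρ} {P} h = sem (λ p → let x , q = to (go n φ) p in x , out (h x) q)
                                   (λ (x , q) → from (go n φ) (x , into (h x) q))
    where
    go : ∀ n (φ : Formula (n ℕ.+ _)) → Sat M (∃ⁿ n φ) ρ ⇔ (∃ λ x → Sat M φ (x ⧺ ρ))
    go zero    φ = mk⇔ (λ p → (λ ()) , p) proj₂
    go (suc n) φ = mk⇔ (λ p → let x , a , q = to (go n (∃f φ)) p in (a ◂ x) , Sat-cong φ (λ i → sym (⧺-◂ (a ◂ x) ρ i)) q)
                       (λ (x , q) → from (go n (∃f φ)) (x ∘ suc , x zero , Sat-cong φ (⧺-◂ x ρ) q))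

  ⋀-sem : ∀ {m k} {φ : Fin m → Formula k} {ρ} {P : Fin m → Set} → (∀ i → (φ i) / ρ ⟺ P i) → (⋀ φ) / ρ ⟺ (∀ i → P i)
  ⋀-sem {zero}  h = sem (λ _ ()) (λ _ ())
  ⋀-sem {suc m} h = sem (λ { (p , q) zero → out (h zero) p ; (p , q) (suc i) → out (⋀-sem (h ∘ suc)) q i })
                        (λ f → into (h zero) (f zero) , into (⋀-sem (h ∘ suc)) (f ∘ suc))

  ⋁-sem : ∀ {m k} {φ : Fin m → Formula k} {ρ} {P : Fin m → Set} → (∀ i → (φ i) / ρ ⟺ P i) → (⋁ φ) / ρ ⟺ (∃ λ i → P i)
  ⋁-sem {zero}  h = sem (λ ()) (λ ())
  ⋁-sem {suc m} h = sem (λ { (inj₁ p) → zero , out (h zero) p ; (inj₂ p) → let i , q = out (⋁-sem (h ∘ suc)) p in suc i , q })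
                        (λ { (zero , p) → inj₁ (into (h zero) p) ; (suc i , p) → inj₂ (into (⋁-sem (h ∘ suc)) (i , p)) })

  rename-sem : ∀ {k l} (φ : Formula k) {σ : Fin k → Fin l} {ρ ρ′} → ρ ⊢ σ ⇝ ρ′ → rename σ φ / ρ ⟺ Sat M φ ρ′
  rename-sem φ e = sem (to (Sat-rename φ e)) (from (Sat-rename φ e))

  infixr 4 _×-sem_
  infixr 3 _→-sem_
  _×-sem_ : ∀ {k} {φ ψ : Formula k} {ρ} {P Q : Set} → φ / ρ ⟺ P → ψ / ρ ⟺ Q → (φ ∧f ψ) / ρ ⟺ (P × Q)
  p ×-sem q = sem (Prod.map (out p) (out q)) (Prod.map (into p) (into q))

  _→-sem_ : ∀ {k} {φ ψ : Formula k} {ρ} {P Q : Set} → φ / ρ ⟺ P → ψ / ρ ⟺ Q → (φ ⇒f ψ) / ρ ⟺ (P → Q)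
  p →-sem q = sem (λ f x → out q (f (into p x))) (λ f x → into q (f (out p x)))

  fresh-⇝ : ∀ {n k} {x : Vector Carrier n} {ρ : Vector Carrier k} → (x ⧺ ρ) ⊢ fresh ⇝ x
  fresh-⇝ {n} {k} {x} {ρ} = reads λ i → cong [ x , ρ ] (splitAt-↑ˡ n i k)

  wk-⇝ : ∀ m {k n} {σ : Block k n} {y} {x : Vector Carrier m} {ρ : Vector Carrier k} → ρ ⊢ σ ⇝ y → (x ⧺ ρ) ⊢ wk m σ ⇝ y
  wk-⇝ m {k} {σ = σ} {x = x} {ρ} e = reads λ i → trans (cong [ x , ρ ] (splitAt-↑ʳ m k (σ i))) (at e i)

  ⧺-⇝ : ∀ {k m n} {σ : Block k m} {τ : Block k n} {ρ x y} → ρ ⊢ σ ⇝ x → ρ ⊢ τ ⇝ y → ρ ⊢ σ ⧺ τ ⇝ (x ⧺ y)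
  ⧺-⇝ {σ = σ} {τ} {ρ} e f = reads λ i → trans (⧺-∘ ρ σ τ i) (⧺-cong (at e) (at f) i)

-- The sentence saying that a definable group has a bicenter of bounded index

module GroupFormulas (N q : ℕ) (domF : Formula (N ℕ.+ q)) (graphF : Formula (((N ℕ.+ N) ℕ.+ N) ℕ.+ q)) where

  module _ {k} (β : Block k q) where
    inG : Block k N → Formula k
    inG x = rename (x ⧺ β) domF

    mul : (x y z : Block k N) → Formula k
    mul x y z = rename (((x ⧺ y) ⧺ z) ⧺ β) graphF

  ∀G ∃G : ∀ {k} → Block k q → Formula (N ℕ.+ k) → Formula k
  ∀G β φ = ∀ⁿ N (inG (wk N β) fresh ⇒f φ)
  ∃G β φ = ∃ⁿ N (inG (wk N β) fresh ∧f φ)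

  sameB : ∀ {k} (x y : Block k N) → Formula k
  sameB x y = ⋀ λ i → var (x i) ≐ var (y i)

  module _ {k} (β : Block k q) where
    private
      β₁ : Block (N ℕ.+ k) q
      β₁ = wk N β
      β₂ : Block (N ℕ.+ (N ℕ.+ k)) q
      β₂ = wk N β₁
      β₃ : Block (N ℕ.+ (N ℕ.+ (N ℕ.+ k))) q
      β₃ = wk N β₂

    com : (x y : Block k N) → Formula k
    com x y = ∃G β (mul β₁ (wk N x) (wk N y) fresh ∧f mul β₁ (wk N y) (wk N x) fresh)

    totalF functionalF assocF unitF groupF : Formula k
    totalF = ∀G β (∀G β₁ (∃G β₂ (mul β₃ (wk N (wk N fresh)) (wk N fresh) fresh)))
    functionalF = ∀G β (∀G β₁ (∀G β₂ (∀G β₃ (let β₄ = wk N β₃; x = wk N (wk N (wk N fresh)); y = wk N (wk N fresh); z = wk N fresh; w = fresh in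
      mul β₄ x y z ⇒f mul β₄ x y w ⇒f sameB z w))))
    assocF = ∀G β (∀G β₁ (∀G β₂ (∀G β₃ (∀G (wk N β₃) (∀G (wk N (wk N β₃))
      (let γ = wk N (wk N (wk N β₃)); x = wk N (wk N (wk N (wk N (wk N fresh)))); y = wk N (wk N (wk N (wk N fresh))); z = wk N (wk N (wk N fresh))
           u = wk N (wk N fresh); v = wk N fresh; w = fresh in
       mul γ x y u ⇒f mul γ u z w ⇒f mul γ y z v ⇒f mul γ x v w))))))
    unitF = ∃G β (∀G β₁ (let e = wk N fresh; x = fresh in
      mul β₂ e x x ∧f mul β₂ x e x ∧f ∃G β₂ (mul β₃ (wk N x) fresh (wk N e) ∧f mul β₃ fresh (wk N x) (wk N e))))
    groupF = totalF ∧f functionalF ∧f assocF ∧f unitF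

  centralizesF : ∀ {k L} → Block k q → (Fin L → Block k N) → Block k N → Formula k
  centralizesF β s x = ⋀ λ i → com β x (s i)

  bicenterF : ∀ {k L} → Block k q → (Fin L → Block k N) → Block k N → Formula k
  bicenterF β s x = centralizesF β s x ∧f ∀G β (centralizesF (wk N β) (λ i → wk N (s i)) fresh ⇒f com (wk N β) (wk N x) fresh)

  blocks : ∀ {k} L → Fin L → Block ((L ℕ.* N) ℕ.+ k) N
  blocks {k} L i j = combine i j ↑ˡ k

  -- Finite index is not visibly first-order, but a cover by K translates is: the disjunction over
  -- `j` and the numbers of existential quantifiers are built from K and L. So both bounds must be
  -- known before the sentence is written.
  coverF : ∀ {k} (L K : ℕ) → Block k q → Formula k
  coverF L K β = ∃ⁿ (L ℕ.* N) ((⋀ λ i → inG β₁ (blocks L i)) ∧f ∃ⁿ (K ℕ.* N) ((⋀ λ j → inG β₂ (blocks K j)) ∧f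
      ∀G β₂ (⋁ λ j → ∃G (wk N β₂) (bicenterF (wk N (wk N β₂)) (λ i → wk N (wk N (wk (K ℕ.* N) (blocks L i)))) fresh
        ∧f mul (wk N (wk N β₂)) (wk N (wk N (blocks K j))) fresh (wk N fresh)))))
    where
    β₁ : Block ((L ℕ.* N) ℕ.+ _) q
    β₁ = wk (L ℕ.* N) β
    β₂ : Block ((K ℕ.* N) ℕ.+ ((L ℕ.* N) ℕ.+ _)) q
    β₂ = wk (K ℕ.* N) β₁

  abelianByFiniteF : ∀ L K → Sentence
  abelianByFiniteF L K = ∀ⁿ q (groupF fresh ⇒f coverF L K fresh)

  module GroupSemantics (M : Structure) where
    open Structure M
    open Semantics M

    Vec′ : Set
    Vec′ = Vector Carrier N

    old : ∀ {k n} {σ : Block k n} {y} {x : Vec′} {ρ : Vector Carrier k} → ρ ⊢ σ ⇝ y → (x ⧺ ρ) ⊢ wk N σ ⇝ y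
    old = wk-⇝ N

    module Relations (b : Vector Carrier q) where
      G : Vec′ → Set
      G x = Sat M domF (x ⧺ b)

      Mul : Vec′ → Vec′ → Vec′ → Set
      Mul x y z = Sat M graphF (((x ⧺ y) ⧺ z) ⧺ b)

      Com : Vec′ → Vec′ → Set
      Com x y = ∃ λ z → G z × Mul x y z × Mul y x z

      Centralizes : ∀ {L} → (Fin L → Vec′) → Vec′ → Set
      Centralizes s x = ∀ i → Com x (s i)

      Bicenter : ∀ {L} → (Fin L → Vec′) → Vec′ → Set
      Bicenter s x = Centralizes s x × (∀ y → G y → Centralizes s y → Com x y)

      record GroupLaws : Set where
        constructor laws
        field
          total      : ∀ x → G x → ∀ y → G y → ∃ λ z → G z × Mul x y z
          functional : ∀ x → G x → ∀ y → G y → ∀ z → G z → ∀ w → G w → Mul x y z → Mul x y w → z ≗ᵇ w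
          associative : ∀ x → G x → ∀ y → G y → ∀ z → G z → ∀ u → G u → ∀ v → G v → ∀ w → G w →
                        Mul x y u → Mul u z w → Mul y z v → Mul x v w
          unital     : ∃ λ e → G e × (∀ x → G x → Mul e x x × Mul x e x × ∃ λ y → G y × Mul x y e × Mul y x e)

      split : ∀ L → Vector Carrier (L ℕ.* N) → Fin L → Vec′
      split L S i j = S (combine i j)

      Cover : ℕ → ℕ → Set
      Cover L K = ∃ λ S → (∀ i → G (split L S i)) × ∃ λ T → (∀ j → G (split K T j)) ×
        (∀ x → G x → ∃ λ j → ∃ λ h → G h × Bicenter (split L S) h × Mul (split K T j) h x)

      module _ {k} {β : Block k q} {ρ} (β⇝ : ρ ⊢ β ⇝ b) where
        inG-sem : ∀ {σ x} → ρ ⊢ σ ⇝ x → (inG β σ) / ρ ⟺ G x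
        inG-sem e = rename-sem domF (⧺-⇝ e β⇝)

        mul-sem : ∀ {σ τ υ x y z} → ρ ⊢ σ ⇝ x → ρ ⊢ τ ⇝ y → ρ ⊢ υ ⇝ z → (mul β σ τ υ) / ρ ⟺ Mul x y z
        mul-sem e f g = rename-sem graphF (⧺-⇝ (⧺-⇝ (⧺-⇝ e f) g) β⇝)

      sameB-sem : ∀ {k} {ρ : Vector Carrier k} {σ τ x y} → ρ ⊢ σ ⇝ x → ρ ⊢ τ ⇝ y → (sameB σ τ) / ρ ⟺ x ≗ᵇ y
      sameB-sem e f = ⋀-sem λ i → sem (subst₂ _≡_ (at e i) (at f i)) (subst₂ _≡_ (sym (at e i)) (sym (at f i)))

      module _ {k} {β : Block k q} {ρ} (β⇝ : ρ ⊢ β ⇝ b) {φ : Formula (N ℕ.+ k)} {P : Vec′ → Set} where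
        ∀G-sem : (∀ x → φ / (x ⧺ ρ) ⟺ P x) → (∀G β φ) / ρ ⟺ (∀ x → G x → P x)
        ∀G-sem h = ∀ⁿ-sem N λ x → inG-sem (old β⇝) fresh-⇝ →-sem h x

        ∃G-sem : (∀ x → φ / (x ⧺ ρ) ⟺ P x) → (∃G β φ) / ρ ⟺ (∃ λ x → G x × P x)
        ∃G-sem h = ∃ⁿ-sem N λ x → inG-sem (old β⇝) fresh-⇝ ×-sem h x

      com-sem : ∀ {k} {β : Block k q} {ρ} → ρ ⊢ β ⇝ b → ∀ {σ τ x y} → ρ ⊢ σ ⇝ x → ρ ⊢ τ ⇝ y → (com β σ τ) / ρ ⟺ Com x y
      com-sem β⇝ e f = ∃G-sem β⇝ λ z → mul-sem (old β⇝) (old e) (old f) fresh-⇝ ×-sem mul-sem (old β⇝) (old f) (old e) fresh-⇝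

      groupF-sem : ∀ {k} {β : Block k q} {ρ} → ρ ⊢ β ⇝ b → (groupF β) / ρ ⟺ GroupLaws
      groupF-sem {β = β} {ρ} β⇝ = sem (λ p → let t , f , a , u = out meaning p in laws t f a u) (λ (laws t f a u) → into meaning (t , f , a , u))
        where
        meaning = (∀G-sem β⇝ λ x → ∀G-sem (old β⇝) λ y → ∃G-sem (old (old β⇝)) λ z →
                 mul-sem (old (old (old β⇝))) (old (old fresh-⇝)) (old fresh-⇝) fresh-⇝)
          ×-sem (∀G-sem β⇝ λ x → ∀G-sem (old β⇝) λ y → ∀G-sem (old (old β⇝)) λ z → ∀G-sem (old (old (old β⇝))) λ w →
                 let γ = old (old (old (old β⇝))) in
                 mul-sem γ (old (old (old fresh-⇝))) (old (old fresh-⇝)) (old fresh-⇝)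
                 →-sem mul-sem γ (old (old (old fresh-⇝))) (old (old fresh-⇝)) fresh-⇝
                 →-sem sameB-sem (old fresh-⇝) fresh-⇝)
          ×-sem (∀G-sem β⇝ λ x → ∀G-sem (old β⇝) λ y → ∀G-sem (old (old β⇝)) λ z → ∀G-sem (old (old (old β⇝))) λ u →
                 ∀G-sem (old (old (old (old β⇝)))) λ v → ∀G-sem (old (old (old (old (old β⇝))))) λ w →
                 let γ = old (old (old (old (old (old β⇝))))) in
                 mul-sem γ (old (old (old (old (old fresh-⇝))))) (old (old (old (old fresh-⇝)))) (old (old fresh-⇝))
                 →-sem mul-sem γ (old (old fresh-⇝)) (old (old (old fresh-⇝))) fresh-⇝
                 →-sem mul-sem γ (old (old (old (old fresh-⇝)))) (old (old (old fresh-⇝))) (old fresh-⇝)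
                 →-sem mul-sem γ (old (old (old (old (old fresh-⇝))))) (old fresh-⇝) fresh-⇝)
          ×-sem (∃G-sem β⇝ λ e → ∀G-sem (old β⇝) λ x →
                 mul-sem (old (old β⇝)) (old fresh-⇝) fresh-⇝ fresh-⇝
                 ×-sem mul-sem (old (old β⇝)) fresh-⇝ (old fresh-⇝) fresh-⇝
                 ×-sem ∃G-sem (old (old β⇝)) λ y →
                   mul-sem (old (old (old β⇝))) (old fresh-⇝) fresh-⇝ (old (old fresh-⇝))
                   ×-sem mul-sem (old (old (old β⇝))) fresh-⇝ (old fresh-⇝) (old (old fresh-⇝)))

      centralizesF-sem : ∀ {k L} {β : Block k q} {ρ} → ρ ⊢ β ⇝ b → ∀ {σs : Fin L → Block k N} {σ ss x} →
        (∀ i → ρ ⊢ σs i ⇝ ss i) → ρ ⊢ σ ⇝ x → (centralizesF β σs σ) / ρ ⟺ Centralizes ss x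
      centralizesF-sem β⇝ es e = ⋀-sem λ i → com-sem β⇝ e (es i)

      bicenterF-sem : ∀ {k L} {β : Block k q} {ρ} → ρ ⊢ β ⇝ b → ∀ {σs : Fin L → Block k N} {σ ss x} →
        (∀ i → ρ ⊢ σs i ⇝ ss i) → ρ ⊢ σ ⇝ x → (bicenterF β σs σ) / ρ ⟺ Bicenter ss x
      bicenterF-sem β⇝ es e = centralizesF-sem β⇝ es e ×-sem ∀G-sem β⇝ λ y →
        centralizesF-sem (old β⇝) (λ i → old (es i)) fresh-⇝ →-sem com-sem (old β⇝) (old e) fresh-⇝

      blocks-⇝ : ∀ {k} L (S : Vector Carrier (L ℕ.* N)) {ρ : Vector Carrier k} i → (S ⧺ ρ) ⊢ blocks L i ⇝ split L S i
      blocks-⇝ L S i = reads λ j → at fresh-⇝ (combine i j)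

      coverF-sem : ∀ {k} {β : Block k q} {ρ} L K → ρ ⊢ β ⇝ b → (coverF L K β) / ρ ⟺ Cover L K
      coverF-sem {k} {β} {ρ} L K β⇝ =
        ∃ⁿ-sem (L ℕ.* N) λ S → let β₁ = wk-⇝ (L ℕ.* N) β⇝ in
          (⋀-sem λ i → inG-sem β₁ (blocks-⇝ L S i)) ×-sem
        ∃ⁿ-sem (K ℕ.* N) λ T → let β₂ = wk-⇝ (K ℕ.* N) β₁ in
          (⋀-sem λ j → inG-sem β₂ (blocks-⇝ K T j)) ×-sem
        ∀G-sem β₂ λ x → ⋁-sem λ j → ∃G-sem (old β₂) λ h →
          bicenterF-sem (old (old β₂)) (λ i → old (old (wk-⇝ (K ℕ.* N) (blocks-⇝ L S i)))) fresh-⇝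
          ×-sem mul-sem (old (old β₂)) (old (old (blocks-⇝ K T j))) fresh-⇝ (old fresh-⇝)

    abelianByFiniteF-sem : ∀ L K → abelianByFiniteF L K / (λ ()) ⟺ (∀ b → Relations.GroupLaws b → Relations.Cover b L K)
    abelianByFiniteF-sem L K = ∀ⁿ-sem q λ b → Relations.groupF-sem b fresh-⇝ →-sem Relations.coverF-sem b L K fresh-⇝

-- Abstract groups from the relational group laws

module Laws (N q : ℕ) (domF : Formula (N ℕ.+ q)) (graphF : Formula (((N ℕ.+ N) ℕ.+ N) ℕ.+ q)) (M : Structure) where
  open Structure M using (Carrier)
  open GroupFormulas N q domF graphF
  open GroupSemantics M
  open Semantics M

  module _ (b : Vector Carrier q) where
    open Relations b

    G-cong : ∀ {x x′} → x ≗ᵇ x′ → G x → G x′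
    G-cong e = Sat-cong domF (⧺-cong e λ _ → refl)

    Mul-cong : ∀ {x x′ y y′ z z′} → x ≗ᵇ x′ → y ≗ᵇ y′ → z ≗ᵇ z′ → Mul x y z → Mul x′ y′ z′
    Mul-cong e f g = Sat-cong graphF (⧺-cong (⧺-cong (⧺-cong e f) g) λ _ → refl)

    ≗-sym : ∀ {x y : Vec′} → x ≗ᵇ y → y ≗ᵇ x
    ≗-sym e i = sym (e i)

    join : ∀ {L} → (Fin L → Vec′) → Vector Carrier (L ℕ.* N)
    join s k = uncurry s (remQuot N k)

    split-join : ∀ {L} (s : Fin L → Vec′) i → split L (join s) i ≗ᵇ s i
    split-join s i j = cong (uncurry s) (remQuot-combine i j)

    module FromLaws (laws : GroupLaws) where
      open GroupLaws laws

      private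
        Element : Set
        Element = Σ Vec′ G

        _≈_ : Element → Element → Set
        (x , _) ≈ (y , _) = x ≗ᵇ y

        _∙_ : Element → Element → Element
        (x , gx) ∙ (y , gy) = let z , gz , _ = total x gx y gy in z , gz

        mul-∙ : ∀ ((x , gx) (y , gy) : Element) → Mul x y (proj₁ ((x , gx) ∙ (y , gy)))
        mul-∙ (x , gx) (y , gy) = proj₂ (proj₂ (total x gx y gy))

        ∙-unique : ∀ ((x , gx) (y , gy) (z , gz) : Element) → Mul x y z → ((x , gx) ∙ (y , gy)) ≈ (z , gz)
        ∙-unique x y z m = functional _ (proj₂ x) _ (proj₂ y) _ (proj₂ (x ∙ y)) _ (proj₂ z) (mul-∙ x y) m

        ε : Element
        ε = proj₁ unital , proj₁ (proj₂ unital)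

        _⁻¹ : Element → Element
        (x , gx) ⁻¹ = let y , gy , _ = proj₂ (proj₂ (proj₂ (proj₂ unital) x gx)) in y , gy

        inverseˡ : ∀ x → ((x ⁻¹) ∙ x) ≈ ε
        inverseˡ x = ∙-unique (x ⁻¹) x ε (proj₂ (proj₂ (proj₂ (proj₂ (proj₂ (proj₂ (proj₂ unital) _ (proj₂ x)))))))

        inverseʳ : ∀ x → (x ∙ (x ⁻¹)) ≈ ε
        inverseʳ x = ∙-unique x (x ⁻¹) ε (proj₁ (proj₂ (proj₂ (proj₂ (proj₂ (proj₂ (proj₂ unital) _ (proj₂ x)))))))

        isMonoid : IsMonoid _≈_ _∙_ ε
        isMonoid = record
          { isSemigroup = record
            { isMagma = record
              { isEquivalence = record
                { refl = λ _ → refl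
                ; sym = λ e i → sym (e i)
                ; trans = λ e f i → trans (e i) (f i) }
              ; ∙-cong = λ {x} {x′} {y} {y′} e f → ∙-unique x y (x′ ∙ y′)
                  (Mul-cong (≗-sym e) (≗-sym f) (λ _ → refl) (mul-∙ x′ y′)) }
            ; assoc = λ x y z → ≗-sym (∙-unique x (y ∙ z) ((x ∙ y) ∙ z)
                (associative _ (proj₂ x) _ (proj₂ y) _ (proj₂ z) _ (proj₂ (x ∙ y)) _ (proj₂ (y ∙ z)) _ (proj₂ ((x ∙ y) ∙ z))
                  (mul-∙ x y) (mul-∙ (x ∙ y) z) (mul-∙ y z))) }
          ; identity = (λ x → ∙-unique ε x x (proj₁ (proj₂ (proj₂ unital) _ (proj₂ x))))
                     , (λ x → ∙-unique x ε x (proj₁ (proj₂ (proj₂ (proj₂ unital) _ (proj₂ x))))) }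

        open IsMonoid isMonoid using (∙-congˡ; assoc; identity; ∙-cong)

      group : Group 0ℓ 0ℓ
      group = record
        { isGroup = record
          { isMonoid = isMonoid
          ; inverse = inverseˡ , inverseʳ
          ; ⁻¹-cong = λ {x} {y} e → assoc∧id∧invʳ⇒invˡ-unique (IsMonoid.setoid isMonoid) (λ {x} {x′} {y} {y′} → ∙-cong {x} {x′} {y} {y′}) assoc identity inverseʳ (x ⁻¹) y
              (IsMonoid.trans isMonoid {(x ⁻¹) ∙ y} {(x ⁻¹) ∙ x} {ε} (∙-congˡ {x ⁻¹} {y} {x} (≗-sym e)) (inverseˡ x)) } }

      private module 𝔾 = GroupTheory group

      Mul⇔∙ : ∀ x y z → Mul (proj₁ x) (proj₁ y) (proj₁ z) ⇔ (x ∙ y) ≈ z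
      Mul⇔∙ x y z = mk⇔ (∙-unique x y z) λ e → Mul-cong (λ _ → refl) (λ _ → refl) e (mul-∙ x y)

      -- The second argument is free up to pointwise equality because `split` recovers the tuples
      -- packed by `join` only up to pointwise equality.
      Com⇔Comm : ∀ x y {y′} → y′ ≗ᵇ proj₁ y → Com (proj₁ x) y′ ⇔ 𝔾.Comm x y
      Com⇔Comm x y e = mk⇔
        (λ (z , gz , m , m′) i → trans (∙-unique x y (z , gz) (Mul-cong (λ _ → refl) e (λ _ → refl) m) i)
                                       (sym (∙-unique y x (z , gz) (Mul-cong e (λ _ → refl) (λ _ → refl) m′) i)))
        (λ c → let z , gz = x ∙ y in z , gz , Mul-cong (λ _ → refl) (≗-sym e) (λ _ → refl) (mul-∙ x y) ,
                                              Mul-cong (≗-sym e) (λ _ → refl) (≗-sym c) (mul-∙ y x))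

      module _ {L} (s : Fin L → Element) {s′ : Fin L → Vec′} (e : ∀ i → s′ i ≗ᵇ proj₁ (s i)) where
        open 𝔾.Bicenter s

        Bicenter⇔Bicentral : ∀ x → Bicenter s′ (proj₁ x) ⇔ Bicentral x
        Bicenter⇔Bicentral x = mk⇔
          (λ (c , d) → (λ i → to (Com⇔Comm x (s i) (e i)) (c i)) ,
            λ y cy → to (Com⇔Comm x y (λ _ → refl)) (d (proj₁ y) (proj₂ y) λ i → from (Com⇔Comm y (s i) (e i)) (cy i)))
          (λ (c , d) → (λ i → from (Com⇔Comm x (s i) (e i)) (c i)) ,
            λ y gy cy → from (Com⇔Comm x (y , gy) (λ _ → refl)) (d (y , gy) λ i → to (Com⇔Comm (y , gy) (s i) (e i)) (cy i)))

-- The definable subgroup in the given model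

module Transfer (M : Structure) (𝒢 : DefinableGroup M) where
  open Structure M using (Carrier)
  open DefinableGroup 𝒢 renaming (dim to N; nPar to q)
  open GroupFormulas N q domF graphF
  open GroupSemantics M
  open Semantics M
  open Relations par
  open Laws N q domF graphF M

  private
    op-mul : ∀ x y → G x → G y → Mul x y (op x y)
    op-mul x y gx gy = from (graph-def x y (op x y) gx gy (op-closed x y gx gy)) λ _ → refl

    mul-op : ∀ x y z → G x → G y → G z → Mul x y z → z ≗ᵇ op x y
    mul-op x y z gx gy gz = to (graph-def x y z gx gy gz)

    -- The operation is not assumed to respect pointwise equality; on the group this follows from
    -- its graph being defined by a formula.
    op-cong : ∀ {x x′ y y′} → G x → G x′ → G y → G y′ → x ≗ᵇ x′ → y ≗ᵇ y′ → op x y ≗ᵇ op x′ y′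
    op-cong {x} {x′} {y} {y′} gx gx′ gy gy′ e f = mul-op x′ y′ (op x y) gx′ gy′ (op-closed x y gx gy)
      (Mul-cong par e f (λ _ → refl) (op-mul x y gx gy))

  groupLaws : GroupLaws
  groupLaws = record
    { total = λ x gx y gy → op x y , op-closed x y gx gy , op-mul x y gx gy
    ; functional = λ x gx y gy z gz w gw m m′ i → trans (mul-op x y z gx gy gz m i) (sym (mul-op x y w gx gy gw m′ i))
    ; associative = λ x gx y gy z gz u gu v gv w gw xy≡u uz≡w yz≡v →
        from (graph-def x v w gx gv gw) λ i →
          trans (mul-op u z w gu gz gw uz≡w i)
          (trans (op-cong gu (op-closed x y gx gy) gz gz (mul-op x y u gx gy gu xy≡u) (λ _ → refl) i)
          (trans (assoc x y z gx gy gz i)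
          (sym (op-cong gx gx gv (op-closed y z gy gz) (λ _ → refl) (mul-op y z v gy gz gv yz≡v) i))))
    ; unital = e , e-in , λ x gx →
        from (graph-def e x x e-in gx gx) (λ i → sym (identityˡ x gx i)) ,
        from (graph-def x e x gx e-in gx) (λ i → sym (identityʳ x gx i)) ,
        (let y , gy , xy≡e , yx≡e = inverse x gx in
          y , gy , from (graph-def x y e gx gy e-in) (λ i → sym (xy≡e i)) , from (graph-def y x e gy gx e-in) (λ i → sym (yx≡e i)))
    }

  open FromLaws par groupLaws
  private module 𝔾 = GroupTheory group

  cover⇒abelianByFinite : ∀ L K → Cover L K → DefinablyAbelianByFinite M 𝒢
  cover⇒abelianByFinite L K (S , gS , T , gT , covers) =
    q ℕ.+ L ℕ.* N , (par ⧺ S) , subgroupF ,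
    (λ x h → proj₁ (out (subgroup-sem x) h)) ,
    into (subgroup-sem e) (e-in , from (bicentral 𝔾.ε) bicentral-ε) ,
    (λ x y hx hy → let gx , bx = out (subgroup-sem x) hx; gy , by = out (subgroup-sem y) hy in
      into (subgroup-sem (op x y)) (op-closed x y gx gy ,
        from (bicentral ((x , gx) 𝔾.∙ (y , gy))) (bicentral-∙ {x , gx} {y , gy} (to (bicentral (x , gx)) bx) (to (bicentral (y , gy)) by)))) ,
    -- From x y ≈ e follows y ≈ x ⟍ ε, so closure under left division yields inverses.
    (λ x y hx gy xy≡e → let gx , bx = out (subgroup-sem x) hx in
      into (subgroup-sem y) (gy , from (bicentral (y , gy)) (bicentral-cong
        {x = (x , gx) 𝔾.⟍ 𝔾.ε} {y = y , gy}
        (𝔾.trans {(x , gx) 𝔾.⟍ 𝔾.ε} {(x , gx) 𝔾.⟍ ((x , gx) 𝔾.∙ (y , gy))} {y , gy}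
          (𝔾.∙-congˡ {(x , gx) 𝔾.⁻¹} {𝔾.ε} {(x , gx) 𝔾.∙ (y , gy)} (λ i → sym (xy≡e i)))
          (𝔾.∙-⟍ (x , gx) (y , gy)))
        (bicentral-⟍ {x , gx} {𝔾.ε} (to (bicentral (x , gx)) bx) bicentral-ε)))) ,
    (λ x y hx hy → let gx , bx = out (subgroup-sem x) hx; gy , by = out (subgroup-sem y) hy in
      bicentral-comm {x , gx} {y , gy} (to (bicentral (x , gx)) bx) (to (bicentral (y , gy)) by)) ,
    K , split K T , gT ,
    λ x gx → let j , h , gh , bh , m = covers x gx in
      j , h , into (subgroup-sem h) (gh , bh) , mul-op (split K T j) h x (gT j) gh gx m
    where
    s : Fin L → 𝔾.Carrier
    s i = split L S i , gS i
    open 𝔾.Bicenter s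
    bicentral : ∀ x → Bicenter (split L S) (proj₁ x) ⇔ Bicentral x
    bicentral = Bicenter⇔Bicentral s λ _ _ → refl
    -- In the environment `par ⧺ S` the new parameters come after the old ones, whereas `blocks`
    -- expects them in front.
    s-block : Fin L → Block (q ℕ.+ L ℕ.* N) N
    s-block i = wk q (combine i)
    subgroupF : Formula (N ℕ.+ (q ℕ.+ L ℕ.* N))
    subgroupF = inG (wk N fresh) fresh ∧f bicenterF (wk N fresh) (λ i → wk N (s-block i)) fresh
    subgroup-sem : ∀ x → subgroupF / (x ⧺ (par ⧺ S)) ⟺ (G x × Bicenter (split L S) x)
    subgroup-sem x = inG-sem (wk-⇝ N fresh-⇝) fresh-⇝ ×-sem
      bicenterF-sem (wk-⇝ N fresh-⇝) (λ i → wk-⇝ N (wk-⇝ q (reads λ _ → refl))) fresh-⇝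

-- Integer vectors

timesℕ : ∀ {k} → ℕ → Term k → Term k
timesℕ zero    t = zer
timesℕ (suc n) t = t ⊕ timesℕ n t

times : ∀ {k} → ℤ → Term k → Term k
times (+ n)    t = timesℕ n t
times -[1+ n ] t = neg (timesℕ (suc n) t)

-- Quantifier elimination yields forms. Turning them back into terms lets a formula say that a given
-- affine map is in force, and elimination is then applied to that formula.
termOf : ∀ {k} → Form k → Term k
termOf {zero}  c       = times c one
termOf {suc k} (a , l) = times a (var zero) ⊕ renameT suc (termOf l)

module ℤ-Sem = Semantics ℤ-structure

eval-timesℕ : ∀ {k} n (t : Term k) v → evalT ℤ-structure (timesℕ n t) v ≡ + n * evalT ℤ-structure t v
eval-timesℕ zero    t v = sym (ℤₚ.*-zeroˡ (evalT ℤ-structure t v))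
eval-timesℕ (suc n) t v = trans (cong (λ z → evalT ℤ-structure t v + z) (eval-timesℕ n t v)) (sym (ℤₚ.suc-* (+ n) (evalT ℤ-structure t v)))

eval-times : ∀ {k} c (t : Term k) v → evalT ℤ-structure (times c t) v ≡ c * evalT ℤ-structure t v
eval-times (+ n)    t v = eval-timesℕ n t v
eval-times -[1+ n ] t v = trans (cong -_ (eval-timesℕ (suc n) t v)) (ℤₚ.neg-distribˡ-* (+ suc n) (evalT ℤ-structure t v))

eval-termOf : ∀ {k} (l : Form k) v → evalT ℤ-structure (termOf l) v ≡ eval l v
eval-termOf {zero}  c       v = trans (eval-times c one v) (ℤₚ.*-identityʳ c)
eval-termOf {suc k} (a , l) v = cong₂ _+_ (eval-times a (var zero) v)
  (trans (ℤ-Sem.evalT-rename suc (termOf l) (ℤ-Sem.reads λ _ → refl)) (eval-termOf l (v ∘ suc)))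

-- The contribution of the left factor. For the sign conditions it is the integer α in which they
-- are monotone; for the solution forms it is `lin`.
leading : ∀ n {k} → Form (n ℕ.+ k) → Vector ℤ n → ℤ
leading zero    l       x = 0ℤ
leading (suc n) (a , l) x = a * x zero + leading n l (x ∘ suc)

trailing : ∀ n {k} → Form (n ℕ.+ k) → Form k
trailing zero    l       = l
trailing (suc n) (a , l) = trailing n l

eval-⧺ : ∀ n {k} (l : Form (n ℕ.+ k)) x v → eval l (x ⧺ v) ≡ leading n l x + eval (trailing n l) v
eval-⧺ zero    l       x v = sym (ℤₚ.+-identityˡ (eval l v))
eval-⧺ (suc n) (a , l) x v = trans (cong (λ z → a * x zero + z) (trans (eval-cong l (⧺-◂ x v ∘ suc)) (eval-⧺ n l (x ∘ suc) v)))
  (sym (ℤₚ.+-assoc (a * x zero) (leading n l (x ∘ suc)) (eval (trailing n l) v)))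

weight : ∀ {k} → Form k → ℕ
weight {zero}  c       = ∣ c ∣
weight {suc k} (a , l) = ∣ a ∣ ℕ.+ weight l

eval-bound : ∀ {k} (l : Form k) {v} B .{{_ : ℕ.NonZero B}} → (∀ i → ∣ v i ∣ ℕ.≤ B) → ∣ eval l v ∣ ℕ.≤ weight l ℕ.* B
eval-bound {zero}  c       {v} B _ = ℕₚ.m≤m*n ∣ c ∣ B
eval-bound {suc k} (a , l) {v} B h = begin
  ∣ a * v zero + eval l (v ∘ suc) ∣           ≤⟨ ℤₚ.∣i+j∣≤∣i∣+∣j∣ (a * v zero) _ ⟩
  ∣ a * v zero ∣ ℕ.+ ∣ eval l (v ∘ suc) ∣     ≡⟨ cong (ℕ._+ _) (ℤₚ.abs-* a (v zero)) ⟩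
  ∣ a ∣ ℕ.* ∣ v zero ∣ ℕ.+ ∣ eval l (v ∘ suc) ∣ ≤⟨ ℕₚ.+-mono-≤ (ℕₚ.*-monoʳ-≤ ∣ a ∣ (h zero)) (eval-bound l B (h ∘ suc)) ⟩
  ∣ a ∣ ℕ.* B ℕ.+ weight l ℕ.* B             ≡⟨ ℕₚ.*-distribʳ-+ B ∣ a ∣ (weight l) ⟨
  weight (a , l) ℕ.* B                       ∎
  where open ℕₚ.≤-Reasoning

root-bound : ∀ {k} (l : Form (suc k)) z v → proj₁ l ≢ 0ℤ → eval l (z ◂ v) ≡ 0ℤ → ∣ z ∣ ℕ.≤ ∣ eval (proj₂ l) v ∣
root-bound (a , l) z v a≢0 eq = begin
  ∣ z ∣              ≤⟨ ℕₚ.m≤n*m ∣ z ∣ ∣ a ∣ {{ℕ.>-nonZero (abs≢0 a≢0)}} ⟩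
  ∣ a ∣ ℕ.* ∣ z ∣    ≡⟨ ℤₚ.abs-* a z ⟨
  ∣ a * z ∣          ≡⟨ cong ∣_∣ (trans (lemma (a * z) (eval l v)) (cong (_- eval l v) eq)) ⟩
  ∣ 0ℤ - eval l v ∣  ≡⟨ cong ∣_∣ (ℤₚ.+-identityˡ (- eval l v)) ⟩
  ∣ - eval l v ∣     ≡⟨ ℤₚ.∣-i∣≡∣i∣ (eval l v) ⟩
  ∣ eval l v ∣       ∎
  where
  open ℕₚ.≤-Reasoning
  lemma : ∀ x y → x ≡ x + y - y
  lemma = solve-∀

isPos-mono : ∀ {u v} → u ≤ v → isPos u ≡ true → isPos v ≡ true
isPos-mono {u} le pos = 0<⇒isPos (ℤₚ.<-≤-trans (isPos⇒0< u pos) le)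

%-congruent : ∀ m .{{_ : ℕ.NonZero m}} x y → x %ℕ m ≡ y %ℕ m → (+ m) ℤˢ.∣ (x - y)
%-congruent m x y eq = divides (x /ℕ m - y /ℕ m) (trans
  (cong₂ _-_ (a≡a%ℕn+[a/ℕn]*n x m) (trans (a≡a%ℕn+[a/ℕn]*n y m) (cong (λ r → + r + y /ℕ m * + m) (sym eq))))
  (lemma (+ (x %ℕ m)) (x /ℕ m) (y /ℕ m) (+ m)))
  where
  lemma : ∀ r a b m → r + a * m - (r + b * m) ≡ (a - b) * m
  lemma = solve-∀

sup : ∀ {n} → (Fin n → ℕ) → ℕ
sup {zero}  f = 0
sup {suc n} f = f zero ℕ.⊔ sup (f ∘ suc)

≤-sup : ∀ {n} (f : Fin n → ℕ) i → f i ℕ.≤ sup f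
≤-sup f zero    = ℕₚ.m≤m⊔n (f zero) _
≤-sup f (suc i) = ℕₚ.≤-trans (≤-sup (f ∘ suc) i) (ℕₚ.m≤n⊔m (f zero) _)

sup-≤ : ∀ {n} {f : Fin n → ℕ} {k} → (∀ i → f i ℕ.≤ k) → sup f ℕ.≤ k
sup-≤ {zero}  h = ℕ.z≤n
sup-≤ {suc n} h = ℕₚ.⊔-lub (h zero) (sup-≤ (h ∘ suc))

interval : ℕ → List ℤ
interval R = List.map (λ i → + i - + R) (List.upTo (suc (R ℕ.+ R)))

interval-sound : ∀ R → All (λ z → ∣ z ∣ ℕ.≤ R) (interval R)
interval-sound R = Allₚ.map⁺ (All.tabulate λ {i} i∈ → bound i (ℕₚ.≤-pred (upTo-< i∈)))
  where
  upTo-< : ∀ {i} → i ∈ List.upTo (suc (R ℕ.+ R)) → i ℕ.< suc (R ℕ.+ R)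
  upTo-< i∈ = All.lookup (Allₚ.all-upTo (suc (R ℕ.+ R))) i∈
  bound : ∀ i → i ℕ.≤ R ℕ.+ R → ∣ + i - + R ∣ ℕ.≤ R
  bound i le with ℕₚ.≤-total i R
  ... | inj₁ i≤R = ℕₚ.≤-trans (ℕₚ.≤-reflexive (trans (cong ∣_∣ (ℤₚ.m-n≡m⊖n i R)) (trans (ℤₚ.∣⊖∣-≤ i≤R) refl))) (ℕₚ.m∸n≤m R i)
  ... | inj₂ R≤i = ℕₚ.≤-trans (ℕₚ.≤-reflexive (cong ∣_∣ (trans (ℤₚ.m-n≡m⊖n i R) (ℤₚ.⊖-≥ R≤i)))) (ℕₚ.m≤n+o⇒m∸n≤o i R le)

interval-complete : ∀ R z → ∣ z ∣ ℕ.≤ R → z ∈ interval R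
interval-complete R z le = subst (_∈ interval R) back (∈-map⁺ (λ i → + i - + R) (∈-upTo⁺ (ℕ.s≤s
    (ℕₚ.≤-trans (ℤₚ.∣i+j∣≤∣i∣+∣j∣ z (+ R)) (ℕₚ.+-monoˡ-≤ R le)))))
  where
  lemma : ∀ z r → z + r - r ≡ z
  lemma = solve-∀
  -∣z∣≤z : ∀ z → - (+ ∣ z ∣) ≤ z
  -∣z∣≤z (+ zero)  = ℤₚ.≤-refl
  -∣z∣≤z (+ suc n) = ℤₚ.neg-≤-pos
  -∣z∣≤z -[1+ n ]  = ℤₚ.≤-refl
  0≤z+R : 0ℤ ≤ z + + R
  0≤z+R = subst (_≤ z + + R) (ℤₚ.+-inverseˡ (+ R)) (ℤₚ.+-monoˡ-≤ (+ R)
    (ℤₚ.≤-trans (ℤₚ.neg-mono-≤ (Data.Integer.+≤+ le)) (-∣z∣≤z z)))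
  back : + ∣ z + + R ∣ - + R ≡ z
  back = trans (cong (_- + R) (ℤₚ.0≤i⇒+∣i∣≡i 0≤z+R)) (lemma z (+ R))

interval-unique : ∀ R → AllPairs _≢_ (interval R)
interval-unique R = Uniqueₚ.map⁺ (λ {i} {j} eq → ℤₚ.+-injective (trans (sym (lemma (+ i) (+ R))) (trans (cong (λ z → z + + R) eq) (lemma (+ j) (+ R))))) (Uniqueₚ.upTo⁺ (suc (R ℕ.+ R)))
  where
  lemma : ∀ z r → z - r + r ≡ z
  lemma = solve-∀

interval-length : ∀ R → length (interval R) ≡ suc (R ℕ.+ R)
interval-length R = trans (Listₚ.length-map (λ i → + i - + R) (List.upTo (suc (R ℕ.+ R)))) (Listₚ.length-upTo (suc (R ℕ.+ R)))

box : ℕ → ∀ n → List (Vector ℤ n)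
box R zero    = (λ ()) ∷ []
box R (suc n) = List.cartesianProductWith _◂_ (interval R) (box R n)

box-sound : ∀ R n → All (λ v → ∀ i → ∣ v i ∣ ℕ.≤ R) (box R n)
box-sound R zero    = (λ ()) ∷ []
box-sound R (suc n) = Allₚ.cartesianProductWith⁺ (≡.setoid ℤ) (≡.setoid (Vector ℤ n)) _◂_ (interval R) (box R n) λ
  { z∈ v∈ zero → All.lookup (interval-sound R) z∈ ; z∈ v∈ (suc i) → All.lookup (box-sound R n) v∈ i }

box-complete : ∀ R {n} (v : Vector ℤ n) → (∀ i → ∣ v i ∣ ℕ.≤ R) → Any (v ≗ᵇ_) (box R n)
box-complete R {zero}  v h = here λ ()
box-complete R {suc n} v h = Anyₚ.cartesianProductWith⁺ _◂_ {P = v zero ≡_} {Q = (v ∘ suc) ≗ᵇ_}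
  (λ { e f zero → e ; e f (suc i) → f i }) (interval-complete R (v zero) (h zero)) (box-complete R (v ∘ suc) (h ∘ suc))

box-unique : ∀ R n → AllPairs (λ v w → ¬ v ≗ᵇ w) (box R n)
box-unique R zero    = [] ∷ []
box-unique R (suc n) = go (interval-unique R)
  where
  go : ∀ {zs} → AllPairs _≢_ zs → AllPairs (λ v w → ¬ v ≗ᵇ w) (List.cartesianProductWith _◂_ zs (box R n))
  go []                  = []
  go (_∷_ {z} {zs} z≢ d) = AllPairsₚ.++⁺
    (AllPairsₚ.map⁺ (AllPairs.map (λ v≉w e → v≉w (e ∘ suc)) (box-unique R n)))
    (go d)
    (Allₚ.map⁺ (All.tabulate λ _ → Allₚ.cartesianProductWith⁺ (≡.setoid ℤ) (≡.setoid (Vector ℤ n)) _◂_ zs (box R n)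
      λ y∈ _ e → All.lookup z≢ y∈ (e zero)))

box-length : ∀ R n → length (box R n) ≡ suc (R ℕ.+ R) ℕ.^ n
box-length R zero    = refl
box-length R (suc n) = trans (go (interval R)) (cong₂ ℕ._*_ (interval-length R) (box-length R n))
  where
  go : ∀ zs → length (List.cartesianProductWith _◂_ zs (box R n)) ≡ length zs ℕ.* length (box R n)
  go []       = refl
  go (z ∷ zs) = trans (Listₚ.length-++ (List.map (z ◂_) (box R n))) (cong₂ ℕ._+_ (Listₚ.length-map (z ◂_) (box R n)) (go zs))

module _ {A : Set} {P : A → Set} (P? : ∀ x → Dec (P x)) where
  select : List A → List (Σ A P)
  select []       = []
  select (x ∷ xs) with P? x
  ... | yes p = (x , p) ∷ select xs
  ... | no _  = select xs

  select-All : ∀ {Q : A → Set} {xs} → All Q xs → All (Q ∘ proj₁) (select xs)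
  select-All []                 = []
  select-All (_∷_ {x} q qs) with P? x
  ... | yes _ = q ∷ select-All qs
  ... | no _  = select-All qs

  select-AllPairs : ∀ {R : A → A → Set} {xs} → AllPairs R xs → AllPairs (λ x y → R (proj₁ x) (proj₁ y)) (select xs)
  select-AllPairs []                 = []
  select-AllPairs (_∷_ {x} r rs) with P? x
  ... | yes _ = select-All r ∷ select-AllPairs rs
  ... | no _  = select-AllPairs rs

  select-Any : ∀ {Q : A → Set} {xs} → (∀ {x} → Q x → P x) → Any Q xs → Any (Q ∘ proj₁) (select xs)
  select-Any {xs = x ∷ _} h a with P? x | a
  ... | yes _ | here q  = here q
  ... | no ¬p | here q  = ⊥-elim (¬p (h q))
  ... | yes _ | there q = there (select-Any h q)
  ... | no _  | there q = select-Any h q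

  select-length : ∀ xs → length (select xs) ℕ.≤ length xs
  select-length []       = ℕ.z≤n
  select-length (x ∷ xs) with P? x
  ... | yes _ = ℕ.s≤s (select-length xs)
  ... | no _  = ℕₚ.m≤n⇒m≤1+n (select-length xs)

-- Groups definable in ℤ

module Integers (N q : ℕ) (domF : Formula (N ℕ.+ q)) (graphF : Formula (((N ℕ.+ N) ℕ.+ N) ℕ.+ q)) where
  open GroupFormulas N q domF graphF
  open GroupSemantics ℤ-structure
  open Semantics ℤ-structure
  open Laws N q domF graphF ℤ-structure

  -- Formulas about x, y and the parameters b live over the environment x ⧺ (y ⧺ b).
  k : ℕ
  k = N ℕ.+ (N ℕ.+ q)

  X Y : Block k N
  X = fresh
  Y = wk N fresh

  P : Block k q
  P = wk N (wk N id)

  module _ {x y : Vec′} {b : Vector ℤ q} where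
    X⇝ : (x ⧺ (y ⧺ b)) ⊢ X ⇝ x
    X⇝ = fresh-⇝

    Y⇝ : (x ⧺ (y ⧺ b)) ⊢ Y ⇝ y
    Y⇝ = wk-⇝ N fresh-⇝

    P⇝ : (x ⧺ (y ⧺ b)) ⊢ P ⇝ b
    P⇝ = wk-⇝ N (wk-⇝ N (reads λ _ → refl))

  suc-⇝ : ∀ {n k} {σ : Block k n} {z} {ρ : Vector ℤ k} {x} → ρ ⊢ σ ⇝ x → (z ◂ ρ) ⊢ suc ∘ σ ⇝ x
  suc-⇝ e = reads (at e)

  variables-sem : ∀ {k i j z w} {ρ : Vector ℤ k} → ρ i ≡ z → ρ j ≡ w → (var i ≐ var j) / ρ ⟺ (z ≡ w)
  variables-sem e f = sem (subst₂ _≡_ e f) (subst₂ _≡_ (sym e) (sym f))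

  first-⇝ : ∀ {z : ℤ} {w : Vec′} {ρ : Vector ℤ k} → (w ⧺ (z ◂ ρ)) ⊢ wk N (λ (_ : Fin 1) → zero) ⇝ (λ _ → z)
  first-⇝ = wk-⇝ N (reads λ _ → refl)

  -- Each defines its first variable uniquely from the others whenever x, y lie in a group, so that
  -- coordinate is a zero of one of finitely many affine forms with nonzero slope.
  product-coord quotient-coord : Fin N → Formula (suc k)
  product-coord t  = ∃G (suc ∘ P) (mul (wk N (suc ∘ P)) (wk N (suc ∘ X)) (wk N (suc ∘ Y)) fresh ∧f
    (var (fresh t) ≐ var (N ↑ʳ zero)))
  quotient-coord t = ∃G (suc ∘ P) (mul (wk N (suc ∘ P)) (wk N (suc ∘ X)) fresh (wk N (suc ∘ Y)) ∧f
    (var (fresh t) ≐ var (N ↑ʳ zero)))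

  affine : ∀ {l k} → Form (suc l) → Fin k → Block k l → Formula k
  affine F i σ = rename (i ◂ σ) (termOf F ≐ zer)

  affine-sem : ∀ {l k} (F : Form (suc l)) {i : Fin k} {σ : Block k l} {ρ z v} → ρ i ≡ z → ρ ⊢ σ ⇝ v →
               affine F i σ / ρ ⟺ (eval F (z ◂ v) ≡ 0ℤ)
  affine-sem F {z = z} {v} e f = let r = rename-sem (termOf F ≐ zer) {ρ′ = z ◂ v} (reads λ { zero → e ; (suc i) → at f i }) in
    sem (λ s → trans (sym (eval-termOf F (z ◂ v))) (out r s)) (λ s → into r (trans (eval-termOf F (z ◂ v)) s))

  -- Both speak of one family of maps, those computing a product. In the second formula y is the
  -- product and w the right factor, so that the equation for p = x (x ⟍ p) can be carried from one
  -- x to another at a fixed p. Forms for the quotient itself serve only to bound its size.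
  product-affine quotient-affine : Fin N → Form (suc k) → Formula k
  product-affine t F  = ∃G P (mul (wk N P) (wk N X) (wk N Y) fresh ∧f affine F (fresh t) (wk N id))
  quotient-affine t F = ∃G P (mul (wk N P) (wk N X) fresh (wk N Y) ∧f affine F (wk N Y t) (wk N X ⧺ (fresh ⧺ wk N P)))

  opaque
    coord-forms : Formula (suc k) → List (Form (suc k))
    coord-forms φ = solution-forms (presburger φ)

    coord-forms-slope : ∀ φ {F} → F ∈ coord-forms φ → proj₁ F ≢ 0ℤ
    coord-forms-slope φ = solution-forms-slope (presburger φ)

    coord-solution : ∀ φ z v → Sat ℤ-structure φ (z ◂ v) → (∀ z′ → Sat ℤ-structure φ (z′ ◂ v) → z′ ≡ z) →
                     ∃ λ F → F ∈ coord-forms φ × eval F (z ◂ v) ≡ 0ℤ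
    coord-solution φ = unique-solution (presburger φ)

  product-forms quotient-forms : Fin N → List (Form (suc k))
  product-forms t  = coord-forms (product-coord t)
  quotient-forms t = coord-forms (quotient-coord t)

  opaque
    -- Elimination is applied once more, now to the finitely many formulas saying which map is in
    -- force. Their forms and moduli make up the conditions by which elements are classified.
    relevant : List (Formula k)
    relevant = List.concatMap (λ t → List.concatMap (λ F → product-affine t F ∷ quotient-affine t F ∷ []) (product-forms t)) (List.allFin N)

    relevant-∈ : ∀ t {F ψ} → F ∈ product-forms t → ψ ∈ product-affine t F ∷ quotient-affine t F ∷ [] → ψ ∈ relevant
    relevant-∈ t F∈ ψ∈ = ∈-concatMap⁺ (λ t → List.concatMap (λ F → product-affine t F ∷ quotient-affine t F ∷ []) (product-forms t))
      (lose (∈-allFin t) (∈-concatMap⁺ (λ F → product-affine t F ∷ quotient-affine t F ∷ []) (lose F∈ ψ∈)))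

  product-affine-relevant : ∀ t {F} → F ∈ product-forms t → product-affine t F ∈ relevant
  product-affine-relevant t F∈ = relevant-∈ t F∈ (here refl)

  quotient-affine-relevant : ∀ t {F} → F ∈ product-forms t → quotient-affine t F ∈ relevant
  quotient-affine-relevant t F∈ = relevant-∈ t F∈ (there (here refl))

  opaque
    cell-forms : List (Form k)
    cell-forms = List.concatMap (λ ψ → forms (presburger ψ)) relevant

    cell-modulus : ℕ
    cell-modulus = product (List.map (λ ψ → modulus (presburger ψ)) relevant)

    cell-modulus>0 : ℕ.NonZero cell-modulus
    cell-modulus>0 = product≢0 relevant
      where
      product≢0 : ∀ (ψs : List (Formula k)) → ℕ.NonZero (product (List.map (λ ψ → modulus (presburger ψ)) ψs))
      product≢0 []       = _
      product≢0 (ψ ∷ ψs) = ℕₚ.m*n≢0 (modulus (presburger ψ)) (product (List.map (λ ψ → modulus (presburger ψ)) ψs)) {{modulus≢0 (presburger ψ)}} {{product≢0 ψs}}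

    relevant-invariant : ∀ {ψ} → ψ ∈ relevant → ∀ {v w} → SameCell cell-forms cell-modulus v w → Sat ℤ-structure ψ v → Sat ℤ-structure ψ w
    relevant-invariant {ψ} ψ∈ s = invariant (presburger ψ) (SameCell-weaken
      (λ l∈ → ∈-concatMap⁺ (λ ψ → forms (presburger ψ)) (lose ψ∈ l∈)) (∈⇒∣product-map (λ ψ → modulus (presburger ψ)) ψ∈) s)

    growth-forms : List (Form (suc k))
    growth-forms = List.concatMap (λ t → product-forms t List.++ quotient-forms t) (List.allFin N)

    product-growth : ∀ {t F} → F ∈ product-forms t → F ∈ growth-forms
    product-growth {t} F∈ = ∈-concatMap⁺ (λ t → product-forms t List.++ quotient-forms t) (lose (∈-allFin t) (∈-++⁺ˡ F∈))

    quotient-growth : ∀ {t F} → F ∈ quotient-forms t → F ∈ growth-forms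
    quotient-growth {t} F∈ = ∈-concatMap⁺ (λ t → product-forms t List.++ quotient-forms t) (lose (∈-allFin t) (∈-++⁺ʳ (product-forms t) F∈))

    C₀ : ℕ
    C₀ = sum (List.map (λ F → weight (proj₂ F)) growth-forms)

    -- The successor keeps the growth constant positive even if all weights vanish, so that levels
    -- never decrease.
    weight≤C₀ : ∀ {F} → F ∈ growth-forms → weight (proj₂ F) ℕ.≤ suc C₀
    weight≤C₀ F∈ = ℕₚ.m≤n⇒m≤1+n (∈⇒≤sum (λ F → weight (proj₂ F)) F∈)

  instance
    cell-modulus≢0 : ℕ.NonZero cell-modulus
    cell-modulus≢0 = cell-modulus>0

  J : ℕ
  J = length cell-forms

  module Instance (b : Vector ℤ q) (isGroup : Relations.GroupLaws b) where
    open Relations b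
    open FromLaws b isGroup
    open GroupTheory group using (Carrier; _≈_; _∙_; ε; _⁻¹; _⟍_; ⟍-∙; ∙-⟍; ∙-congˡ)

    env : Vec′ → Vec′ → Vector ℤ k
    env x y = x ⧺ (y ⧺ b)

    product-coord-sem : ∀ t x y z → product-coord t / (z ◂ env x y) ⟺ (∃ λ w → G w × Mul x y w × w t ≡ z)
    product-coord-sem t x y z = ∃G-sem (suc-⇝ P⇝) λ w →
      mul-sem (wk-⇝ N (suc-⇝ P⇝)) (wk-⇝ N (suc-⇝ X⇝)) (wk-⇝ N (suc-⇝ Y⇝)) fresh-⇝ ×-sem variables-sem (at fresh-⇝ t) (at (first-⇝ {w = w}) zero)

    quotient-coord-sem : ∀ t x y z → quotient-coord t / (z ◂ env x y) ⟺ (∃ λ w → G w × Mul x w y × w t ≡ z)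
    quotient-coord-sem t x y z = ∃G-sem (suc-⇝ P⇝) λ w →
      mul-sem (wk-⇝ N (suc-⇝ P⇝)) (wk-⇝ N (suc-⇝ X⇝)) fresh-⇝ (wk-⇝ N (suc-⇝ Y⇝)) ×-sem variables-sem (at fresh-⇝ t) (at (first-⇝ {w = w}) zero)

    product-affine-sem : ∀ t F x y → product-affine t F / env x y ⟺ (∃ λ w → G w × Mul x y w × eval F (w t ◂ env x y) ≡ 0ℤ)
    product-affine-sem t F x y = ∃G-sem P⇝ λ w →
      mul-sem (wk-⇝ N P⇝) (wk-⇝ N X⇝) (wk-⇝ N Y⇝) fresh-⇝ ×-sem affine-sem F (at fresh-⇝ t) (wk-⇝ N (reads λ _ → refl))

    quotient-affine-sem : ∀ t F x y → quotient-affine t F / env x y ⟺ (∃ λ w → G w × Mul x w y × eval F (y t ◂ env x w) ≡ 0ℤ)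
    quotient-affine-sem t F x y = ∃G-sem P⇝ λ w →
      mul-sem (wk-⇝ N P⇝) (wk-⇝ N X⇝) fresh-⇝ (wk-⇝ N Y⇝) ×-sem
      affine-sem F (at (wk-⇝ N Y⇝) t) (⧺-⇝ (wk-⇝ N X⇝) (⧺-⇝ fresh-⇝ (wk-⇝ N P⇝)))

    coords : Carrier → Fin N → ℤ
    coords (x , _) = x

    mul⇒∙ : ∀ x y z → Mul (coords x) (coords y) (coords z) → x ∙ y ≈ z
    mul⇒∙ x y z = to (Mul⇔∙ x y z)

    ∙⇒mul : ∀ x y z → x ∙ y ≈ z → Mul (coords x) (coords y) (coords z)
    ∙⇒mul x y z = from (Mul⇔∙ x y z)

    quotient-unique : ∀ x y w → x ∙ w ≈ y → x ⟍ y ≈ w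
    quotient-unique x y w e = Group.trans group {x ⟍ y} {x ⟍ (x ∙ w)} {w} (∙-congˡ {x ⁻¹} {y} {x ∙ w} (λ i → sym (e i))) (∙-⟍ x w)

    product-solution : ∀ t x y → ∃ λ F → F ∈ product-forms t × eval F (coords (x ∙ y) t ◂ env (coords x) (coords y)) ≡ 0ℤ
    product-solution t x y = coord-solution (product-coord t) (coords (x ∙ y) t) (env (coords x) (coords y))
      (into (product-coord-sem t (coords x) (coords y) _) (coords (x ∙ y) , proj₂ (x ∙ y) , ∙⇒mul x y (x ∙ y) (λ _ → refl) , refl))
      λ z s → let w , gw , m , w≡z = out (product-coord-sem t (coords x) (coords y) z) s in
        trans (sym w≡z) (sym (mul⇒∙ x y (w , gw) m t))

    quotient-solution : ∀ t x y → ∃ λ F → F ∈ quotient-forms t × eval F (coords (x ⟍ y) t ◂ env (coords x) (coords y)) ≡ 0ℤ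
    quotient-solution t x y = coord-solution (quotient-coord t) (coords (x ⟍ y) t) (env (coords x) (coords y))
      (into (quotient-coord-sem t (coords x) (coords y) _) (coords (x ⟍ y) , proj₂ (x ⟍ y) , ∙⇒mul x (x ⟍ y) y (⟍-∙ x y) , refl))
      λ z s → let w , gw , m , w≡z = out (quotient-coord-sem t (coords x) (coords y) z) s in
        trans (sym w≡z) (sym (quotient-unique x y (w , gw) (mul⇒∙ x (w , gw) y m) t))

    size : Carrier → ℕ
    size x = sup λ t → ∣ coords x t ∣

    -- The parameters b enter the size estimates only here. The successor makes the bound on the
    -- environment at least 1, as is needed to absorb the constant terms of forms.
    β : ℕ
    β = suc (sup (λ i → ∣ b i ∣) ℕ.+ size ε)

    env-bound : ∀ x y i → ∣ env (coords x) (coords y) i ∣ ℕ.≤ size x ℕ.+ size y ℕ.+ β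
    env-bound x y i with splitAt N i
    ... | inj₁ t = ℕₚ.≤-trans (≤-sup (λ t → ∣ coords x t ∣) t) (ℕₚ.≤-trans (ℕₚ.m≤m+n (size x) (size y)) (ℕₚ.m≤m+n _ β))
    ... | inj₂ i with splitAt N i
    ...   | inj₁ t = ℕₚ.≤-trans (≤-sup (λ t → ∣ coords y t ∣) t) (ℕₚ.≤-trans (ℕₚ.m≤n+m (size y) (size x)) (ℕₚ.m≤m+n _ β))
    ...   | inj₂ i = ℕₚ.≤-trans (≤-sup (λ i → ∣ b i ∣) i) (ℕₚ.≤-trans (ℕₚ.m≤n⇒m≤1+n (ℕₚ.m≤m+n _ (size ε))) (ℕₚ.m≤n+m β (size x ℕ.+ size y)))

    solution-bound : ∀ {F} z x y → F ∈ growth-forms → proj₁ F ≢ 0ℤ → eval F (z ◂ env (coords x) (coords y)) ≡ 0ℤ →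
                     ∣ z ∣ ℕ.≤ suc C₀ ℕ.* (size x ℕ.+ size y ℕ.+ β)
    solution-bound {F} z x y F∈ a≢0 eq = ℕₚ.≤-trans (root-bound F z _ a≢0 eq) (ℕₚ.≤-trans
      (eval-bound (proj₂ F) (size x ℕ.+ size y ℕ.+ β) {{ℕ.>-nonZero (ℕₚ.<-≤-trans (ℕ.s≤s ℕ.z≤n) (ℕₚ.m≤n+m β (size x ℕ.+ size y)))}} (env-bound x y))
      (ℕₚ.*-monoˡ-≤ _ (weight≤C₀ F∈)))

    G? : ∀ x → Dec (G x)
    G? x = decide (presburger domF) (x ⧺ b)

    ball : ℕ → List Carrier
    ball R = select G? (box R N)

    cell-form : Fin J → Form k
    cell-form = List.lookup cell-forms

    -- The two environments share p and b, so residues have to be compared only for the coordinates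
    -- of the left factor.
    agree⇒cell : ∀ x x′ p →
      (∀ t → Fin.fromℕ< (n%ℕd<d (x t) cell-modulus) ≡ Fin.fromℕ< (n%ℕd<d (x′ t) cell-modulus)) →
      (∀ j → isPos (eval (cell-form j) (env x p)) ≡ isPos (eval (cell-form j) (env x′ p))) →
      SameCell cell-forms cell-modulus (env x p) (env x′ p)
    agree⇒cell x x′ p res agree = cell signs′ residues′
      where
      signs′ : ∀ {l} → l ∈ cell-forms → isPos (eval l (env x p)) ≡ isPos (eval l (env x′ p))
      signs′ l∈ = subst (λ l → isPos (eval l (env x p)) ≡ isPos (eval l (env x′ p))) (sym (Anyₚ.lookup-index l∈)) (agree (Any.index l∈))
      residues′ : ∀ i → (+ cell-modulus) ℤˢ.∣ (env x p i - env x′ p i)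
      residues′ i with splitAt N i
      ... | inj₁ t = %-congruent cell-modulus (x t) (x′ t) (Finₚ.fromℕ<-injective _ _ (n%ℕd<d (x t) cell-modulus) (n%ℕd<d (x′ t) cell-modulus) (res t))
      ... | inj₂ j = divides 0ℤ (trans (ℤₚ.+-inverseʳ ((p ⧺ b) j)) (sym (ℤₚ.*-zeroˡ (+ cell-modulus))))

    private
      Index : Fin N → Set
      Index t = Fin (length (product-forms t))

      solution : ∀ t → Index t → Form (suc k)
      solution t i = List.lookup (product-forms t) i

      solution∈ : ∀ t i → solution t i ∈ product-forms t
      solution∈ t i = ∈-lookup {xs = product-forms t} i

      lin rest : ∀ t → Index t → Carrier → ℤ
      lin  t i x = leading N (proj₂ (solution t i)) (coords x)
      rest t i y = eval (trailing N (proj₂ (solution t i))) (coords y ⧺ b)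

      Solves : ∀ t → Index t → Carrier → Carrier → Set
      Solves t i x y = proj₁ (solution t i) * coords (x ∙ y) t + (lin t i x + rest t i y) ≡ 0ℤ

      split-equation : ∀ t (i : Index t) x y → eval (solution t i) (coords (x ∙ y) t ◂ env (coords x) (coords y)) ≡
                       proj₁ (solution t i) * coords (x ∙ y) t + (lin t i x + rest t i y)
      split-equation t i x y = cong (λ r → proj₁ (solution t i) * coords (x ∙ y) t + r) (eval-⧺ N (proj₂ (solution t i)) (coords x) (coords y ⧺ b))

      affine-cong : ∀ (F : Form (suc k)) {z z′ x x′ y y′} → z ≡ z′ → x ≗ᵇ x′ → y ≗ᵇ y′ → eval F (z ◂ env x y) ≡ eval F (z′ ◂ env x′ y′)
      affine-cong F refl e f = eval-cong F (◂-cong _ (⧺-cong e (⧺-cong f λ _ → refl)))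

      solves⇒product : ∀ t (i : Index t) x y → Solves t i x y → Sat ℤ-structure (product-affine t (solution t i)) (env (coords x) (coords y))
      solves⇒product t i x y s = into (product-affine-sem t (solution t i) (coords x) (coords y))
        (coords (x ∙ y) , proj₂ (x ∙ y) , ∙⇒mul x y (x ∙ y) (λ _ → refl) , trans (split-equation t i x y) s)

      product⇒solves : ∀ t (i : Index t) x y → Sat ℤ-structure (product-affine t (solution t i)) (env (coords x) (coords y)) → Solves t i x y
      product⇒solves t i x y s = conclude (out (product-affine-sem t (solution t i) (coords x) (coords y)) s)
        where
        conclude : (∃ λ w → G w × Mul (coords x) (coords y) w × eval (solution t i) (w t ◂ env (coords x) (coords y)) ≡ 0ℤ) → Solves t i x y
        conclude (w , gw , m , eq) = trans (sym (split-equation t i x y))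
          (trans (affine-cong (solution t i) (mul⇒∙ x y (w , gw) m t) (λ _ → refl) (λ _ → refl)) eq)

      solves⇒quotient : ∀ t (i : Index t) x p → Solves t i x (x ⟍ p) → Sat ℤ-structure (quotient-affine t (solution t i)) (env (coords x) (coords p))
      solves⇒quotient t i x p s = into (quotient-affine-sem t (solution t i) (coords x) (coords p))
        (coords (x ⟍ p) , proj₂ (x ⟍ p) , ∙⇒mul x (x ⟍ p) p (⟍-∙ x p) ,
         trans (affine-cong (solution t i) (sym (⟍-∙ x p t)) (λ _ → refl) (λ _ → refl)) (trans (split-equation t i x (x ⟍ p)) s))

      quotient⇒solves : ∀ t (i : Index t) x p → Sat ℤ-structure (quotient-affine t (solution t i)) (env (coords x) (coords p)) → Solves t i x (x ⟍ p)
      quotient⇒solves t i x p s = conclude (out (quotient-affine-sem t (solution t i) (coords x) (coords p)) s)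
        where
        conclude : (∃ λ w → G w × Mul (coords x) w (coords p) × eval (solution t i) (coords p t ◂ env (coords x) w) ≡ 0ℤ) → Solves t i x (x ⟍ p)
        conclude (w , gw , m , eq) = trans (sym (split-equation t i x (x ⟍ p)))
          (trans (affine-cong (solution t i) (⟍-∙ x p t) (λ _ → refl) (quotient-unique x p (w , gw) (mul⇒∙ x (w , gw) p m))) eq)

    affineGroup : AffineGroup N J cell-modulus (suc C₀)
    affineGroup = record
      { 𝔾 = group
      ; coords = coords
      ; coords-cong = id
      ; coords-injective = id
      ; size = size
      ; ball = ball
      ; ball-unique = λ R → select-AllPairs G? (box-unique R N)
      ; ball-sound = λ R → All.map sup-≤ (select-All G? (box-sound R N))
      ; ball-complete = λ R {x} le → select-Any G? (λ e → G-cong b e (proj₂ x))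
          (box-complete R (coords x) λ t → ℕₚ.≤-trans (≤-sup (λ t → ∣ coords x t ∣) t) le)
      ; ball-length = λ R → ℕₚ.≤-trans (select-length G? (box R N)) (ℕₚ.≤-reflexive (box-length R N))
      ; β = β
      ; size-∙ = λ x y → sup-≤ λ t → let F , F∈ , eq = product-solution t x y in
          solution-bound (coords (x ∙ y) t) x y (product-growth F∈) (coord-forms-slope (product-coord t) F∈) eq
      ; size-⟍ = λ x y → sup-≤ λ t → let F , F∈ , eq = quotient-solution t x y in
          solution-bound (coords (x ⟍ y) t) x y (quotient-growth F∈) (coord-forms-slope (quotient-coord t) F∈) eq
      ; size-ε = ℕₚ.m≤n⇒m≤1+n (ℕₚ.m≤n+m (size ε) _)
      ; α = λ j x → leading N (cell-form j) (coords x)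
      ; U = λ j x p → isPos (eval (cell-form j) (env (coords x) (coords p)))
      ; U-mono = λ j {x} {x′} le p → subst₂ (λ u v → isPos u ≡ true → isPos v ≡ true)
          (sym (eval-⧺ N (cell-form j) (coords x) (coords p ⧺ b))) (sym (eval-⧺ N (cell-form j) (coords x′) (coords p ⧺ b)))
          (isPos-mono (ℤₚ.+-monoˡ-≤ _ le))
      ; U-cong = λ j x e → cong isPos (eval-cong (cell-form j) (⧺-cong {x = coords x} (λ _ → refl) (⧺-cong e λ _ → refl)))
      ; residue = λ t x → Fin.fromℕ< (n%ℕd<d (coords x t) cell-modulus)
      ; I = Index
      ; slope = λ t i → proj₁ (solution t i)
      ; slope≢0 = λ t i → coord-forms-slope (product-coord t) (solution∈ t i)
      ; lin = lin
      ; rest = rest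
      ; rest-cong = λ t i e → eval-cong (trailing N (proj₂ (solution t i))) (⧺-cong e λ _ → refl)
      ; solves = λ t x y → let F , F∈ , eq = product-solution t x y in
          Any.index F∈ , trans (sym (split-equation t (Any.index F∈) x y))
            (trans (cong (λ F → eval F (coords (x ∙ y) t ◂ env (coords x) (coords y))) (sym (Anyₚ.lookup-index F∈))) eq)
      ; agree-∙ = λ t i {x} {x′} {p} res agree s → product⇒solves t i x′ p
          (relevant-invariant (product-affine-relevant t (solution∈ t i)) (agree⇒cell (coords x) (coords x′) (coords p) res agree) (solves⇒product t i x p s))
      ; agree-⟍ = λ t i {x} {x′} {p} res agree s → quotient⇒solves t i x′ p
          (relevant-invariant (quotient-affine-relevant t (solution∈ t i)) (agree⇒cell (coords x) (coords x′) (coords p) res agree) (solves⇒quotient t i x p s))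
      }

  -- `L` and `K` are the values of `chainLength` and `index` for this κ. They are fixed before any
  -- parameters b, so one sentence covers the whole family.
  κ L K : ℕ
  κ = Constants.κ N J cell-modulus C₀
  L = (κ ℕ.* κ) ℕ.* 2
  K = κ ℕ.^ L ℕ.* κ

  module _ (b : Vector ℤ q) (isGroup : Relations.GroupLaws b) where
    open Relations b
    open FromLaws b isGroup
    open Instance b isGroup using (affineGroup; size; ∙⇒mul)
    open Counting affineGroup using (_≈?_; local)
    open GroupTheory group using (Carrier; _⟍_; ⟍-∙)
    open GroupTheory.Bicenter group using (Bicentral)
    open GroupTheory.LocallyAbelian group _≈?_ size κ local using (bicenter-cover)

    bicentral? : ∀ {n} (s : Fin n → Carrier) x → Dec (Bicentral s x)
    bicentral? {n} s x = map′ (to bicentral ∘ out meaning) (into meaning ∘ from bicentral)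
      (decide (presburger bicentralF) (proj₁ x ⧺ (join b (proj₁ ∘ s) ⧺ b)))
      where
      bicentralF : Formula (N ℕ.+ (n ℕ.* N ℕ.+ q))
      bicentralF = bicenterF (wk N (wk (n ℕ.* N) id)) (λ i → wk N (blocks n i)) fresh
      meaning : bicentralF / (proj₁ x ⧺ (join b (proj₁ ∘ s) ⧺ b)) ⟺ Bicenter (split n (join b (proj₁ ∘ s))) (proj₁ x)
      meaning = bicenterF-sem (wk-⇝ N (wk-⇝ (n ℕ.* N) (reads λ _ → refl))) (λ i → wk-⇝ N (blocks-⇝ n _ i)) fresh-⇝
      bicentral : Bicenter (split n (join b (proj₁ ∘ s))) (proj₁ x) ⇔ Bicentral s x
      bicentral = Bicenter⇔Bicentral s (split-join b (proj₁ ∘ s)) x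

    -- The classical arguments in the group yield the cover only under a double negation. As the
    -- cover is expressed by a formula over ℤ, it is decidable, and the double negation goes.
    cover? : Dec (Cover L K)
    cover? = map′ (out meaning) (into meaning) (decide (presburger (coverF L K id)) b)
      where
      meaning : coverF L K id / b ⟺ Cover L K
      meaning = coverF-sem L K (reads λ _ → refl)

    cover : Cover L K
    cover = decidable-stable cover? λ ¬cover → bicenter-cover bicentral? λ (s , g , covers) → ¬cover
      ( join b (proj₁ ∘ s) , (λ i → G-cong b (λ t → sym (split-join b (proj₁ ∘ s) i t)) (proj₂ (s i)))
      , join b (proj₁ ∘ g) , (λ j → G-cong b (λ t → sym (split-join b (proj₁ ∘ g) j t)) (proj₂ (g j)))
      , λ x gx → let j , bic = covers (x , gx); h = g j ⟍ (x , gx) in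
          j , proj₁ h , proj₂ h , from (Bicenter⇔Bicentral s (split-join b (proj₁ ∘ s)) h) bic ,
          Mul-cong b (λ t → sym (split-join b (proj₁ ∘ g) j t)) (λ _ → refl) (λ _ → refl)
            (∙⇒mul (g j) h (x , gx) (⟍-∙ (g j) (x , gx))) )

  sentence-holds : Models ℤ-structure (abelianByFiniteF L K)
  sentence-holds = into (abelianByFiniteF-sem L K) cover

theorem1 : (M : Structure) → IsPresburgerModel M → (G : DefinableGroup M) → DefinablyAbelianByFinite M G
-- The sentence true in ℤ for all parameters is instantiated in M at the parameters of the given
-- group; no ball or counting is needed there.
theorem1 M model 𝒢 = Transfer.cover⇒abelianByFinite M 𝒢 L K
  (Semantics.out (GroupFormulas.GroupSemantics.abelianByFiniteF-sem dim nPar domF graphF M L K)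
    (model (GroupFormulas.abelianByFiniteF dim nPar domF graphF L K) sentence-holds) par (Transfer.groupLaws M 𝒢))
  where
  open DefinableGroup 𝒢 using (dim; nPar; domF; graphF; par)
  open Integers dim nPar domF graphF using (L; K; sentence-holds)
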